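{- Let $r$ be a positive integer such that $r+1$ is a prime that is not a Mersenne prime. Suppose there exist a positive integer $N$ and distinct primes $p_1,p_2$ such that $\operatorname{ord}_{p_1}(r+1)=\operatorname{ord}_{p_2}(r+1)=2^N$. Then there are infinitely many primes $p$ such that $(r+1)^{\alpha}p$ is a Schemmel nontotient number of order $r$ for every nonnegative integer $\alpha$.
   Context: For a positive integer $r$, the Schemmel totient function $S_r$ is the multiplicative arithmetic function determined by $S_r(p^{\alpha}) = 0$ if $p \le r$ and $S_r(p^{\alpha}) = p^{\alpha-1}(p-r)$ if $p > r$, for all primes $p$ and positive integers $\alpha$ (and $S_r(1)=1$). A Schemmel nontotient number of order $r$ is a positive integer not in the range of $S_r$. A Mersenne prime is a prime of the form $2^k-1$. $\operatorname{ord}_q(a)$ denotes the multiplicative order of $a$ modulo the prime $q$. -}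

module Defs where

open import Data.Nat using (ℕ; zero; suc; _+_; _*_; _∸_; _^_; _≤_; _<_; _≤?_)
open import Data.Nat.Divisibility using (_∣_; _∣?_)
open import Data.Nat.Primality using (Prime; prime?)
open import Data.Product using (Σ; ∃; _×_)
open import Relation.Nullary using (¬_; yes; no)
open import Relation.Binary.PropositionalEquality using (_≡_)

-- p-adic valuation of m (for p ≥ 2, m ≥ 1): the largest k with p ^ k ∣ m,
-- computed as the number of k ∈ {1..m} with p ^ k ∣ m (these form an initial
-- segment {1..v}, and v ≤ m since p ^ v ≤ m).
val : ℕ → ℕ → ℕ
val p m = go m
  where
  go : ℕ → ℕ
  go zero = zero
  go (suc k) with (p ^ suc k) ∣? m
  ... | yes _ = suc (go k)
  ... | no  _ = go k

Sr-pp : ℕ → ℕ → ℕ → ℕ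
Sr-pp r p α with p ≤? r
... | yes _ = 0
... | no  _ = p ^ (α ∸ 1) * (p ∸ r)

-- Schemmel totient S_r(m) for m ≥ 1: the product over the primes p ∣ m
-- of S_r(p ^ v_p(m))  (multiplicativity); S_r(1) = 1 (empty product).
Sr : ℕ → ℕ → ℕ
Sr r m = go m
  where
  go : ℕ → ℕ
  go zero = 1
  go (suc p) with prime? (suc p) | suc p ∣? m
  ... | yes _ | yes _ = Sr-pp r (suc p) (val (suc p) m) * go p
  ... | _     | _     = go p

SchemmelNontotient : ℕ → ℕ → Set
SchemmelNontotient r n = 1 ≤ n × ¬ (Σ ℕ λ m → 1 ≤ m × Sr r m ≡ n)

MersennePrime : ℕ → Set
MersennePrime q = Prime q × Σ ℕ λ k → q ≡ 2 ^ k ∸ 1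

IsOrd : ℕ → ℕ → ℕ → Set
IsOrd q a k = 1 ≤ k × q ∣ (a ^ k ∸ 1)
              × (∀ j → 1 ≤ j → j < k → ¬ (q ∣ (a ^ j ∸ 1)))

{-# OPTIONS --safe #-}
module Submission where

-- Put q = r + 1. Every exponent β lies in one of the classes 2^j mod 2^(j+1), j < N, or 0 mod 2^N. In the former
-- q^β ≡ -1 modulo an odd prime divisor of q^(2^j) + 1 (p₁ when j = N - 1), in the latter q^β ≡ 1 modulo p₂. Hence if
-- p ≡ r modulo the former primes and p ≡ -r modulo p₂, no q^β p + r is prime, and this keeps q^α p out of the range of
-- S_r. That there are arbitrarily large such primes p is Dirichlet's theorem, for which an effective argument over ℚ is
-- given. Call φ a test function if its sums along multiples are bounded, and let P_y φ = Σ_{m≤y} Λ(m)φ(m)/m.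
-- From Λ * 1 = log one gets P_y L(1,φ(m·)) = O(1), and Möbius inversion gives P_x φ + φ(1) log x = Q_x + O(1), where
-- Q_x is a combination of values L(1,φ(n·)). Composing the two for y enormously larger than x removes L: if u_x(b) is
-- the share of the class b in P_x, then u_y ∗ u_x + u_y is almost constant on the units. Were there no primes in the
-- unit class a, this would force u to be almost uniform on the complement of a subgroup of index 2, so that
-- P_x χ ≈ - log x for a real character χ; but P_x χ L(1,χ) = O(1) and L(1,χ) has an explicit positive lower bound,
-- obtained by comparing Σ_{n≤x} (x - n) (1 * χ)(n) with its contribution from squares.

-- No limit of u_x is formed; only pairs of scales are related, and the argument rests on
-- extremality. On the units of the modulus M, u_y + u_y ∗ u_x is nearly κ = 2/φ(M). Hence u ≤ K for
-- some K just above κ, and as u has total mass about 1, u_y ∗ u_x is at most about K there. If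
-- u_y(a) ≈ 0, the convolution nearly attains this maximum at a, so u_x(h) (K - u_y(g)) ≈ 0 whenever
-- gh = a, and likewise with the roles exchanged. Thus u_y(g) ≈ u_x(h), which leaves only the values
-- 0 and K, and a detour through a third scale shows that u_x and u_y agree. The relation now says
-- that full times full is empty and full times empty is full: the sign of a real character. Möbius
-- inversion needs a logarithm that is exactly additive, so log is replaced by a rational function
-- with this property and the right growth. On the arithmetic side, S_r(m) = q^α p must also be
-- excluded when the factor p comes from a power of p dividing m. Then p - r would divide q^α p,
-- which a prime d ∣ q + 1 with p ≡ r mod d prevents.

open import Data.Nat as ℕ using (ℕ; zero; suc; z≤n; s≤s)
import Data.Nat.Properties as ℕₚ
open import Data.Product using (Σ; _×_; _,_; proj₁; proj₂)
open import Data.Sum using (_⊎_; inj₁; inj₂)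
open import Data.Empty using (⊥; ⊥-elim)
open import Function using (_∘_)
open import Relation.Nullary using (¬_; Dec; yes; no)
open import Relation.Binary.PropositionalEquality

-- Rational arithmetic and certificates for inequalities.

module Rationals where

  open import Data.Rational
  open import Data.Rational.Properties

  open import Data.Maybe using (Maybe; just; nothing)
  open import Level using (0ℓ)
  open import Relation.Nullary.Decidable using (True; toWitness)
  open import Tactic.RingSolver.Core.AlmostCommutativeRing using (AlmostCommutativeRing; fromCommutativeRing)
  open import Tactic.RingSolver public using (solve-∀; solve)
  open import Data.List public using (_∷_; [])

  ring : AlmostCommutativeRing 0ℓ 0ℓ
  ring = fromCommutativeRing +-*-commutativeRing 0≟
    where
    0≟ : (x : ℚ) → Maybe (0ℚ ≡ x)
    0≟ x with 0ℚ ≟ x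
    ... | yes p = just p
    ... | no  _ = nothing

  δ : ∀ {a b} → a ≤ b → 0ℚ ≤ b - a
  δ {a} {b} h = subst (_≤ b - a) (+-inverseʳ a) (+-monoˡ-≤ (- a) h)

  infixl 6 _⊞_
  infixl 7 _⊠_

  _⊞_ : ∀ {a b} → 0ℚ ≤ a → 0ℚ ≤ b → 0ℚ ≤ a + b
  h ⊞ k = +-mono-≤ h k

  _⊠_ : ∀ {a b} → 0ℚ ≤ a → 0ℚ ≤ b → 0ℚ ≤ a * b
  _⊠_ {a} {b} h k =
    nonNegative⁻¹ (a * b) {{nonNeg*nonNeg⇒nonNeg a {{nonNegative h}} b {{nonNegative k}}}}

  -- The form of most polynomial inequalities below: the differences `δ h` of the hypotheses are
  -- combined by `⊞`, `⊠` and nonnegative constants, and the ring solver checks that the result is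
  -- exactly b - a. Equations enter as `δ (≤-reflexive e)`. Odd constants in such a certificate are
  -- merely multipliers that make this identity hold.
  ≤by : ∀ {a b d} → 0ℚ ≤ d → d ≡ b - a → a ≤ b
  ≤by {a} {b} h refl = subst₂ _≤_ (+-identityˡ a) (eq a b) (+-monoˡ-≤ a h)
    where
    eq : ∀ a b → b - a + a ≡ b
    eq = solve-∀ ring

  const≥0 : (q : ℚ) {_ : True (0ℚ ≤? q)} → 0ℚ ≤ q
  const≥0 q {t} = toWitness t

  <⇒≱ : ∀ {a b} → a < b → ¬ (b ≤ a)
  <⇒≱ h k = <-irrefl refl (<-≤-trans h k)

  *-pos : ∀ {a b} → 0ℚ < a → 0ℚ < b → 0ℚ < a * b
  *-pos {a} {b} h k = positive⁻¹ (a * b) {{pos*pos⇒pos a {{positive h}} b {{positive k}}}}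

  *-monoʳ : ∀ {a b : ℚ} (c : ℚ) → a ≤ b → 0ℚ ≤ c → a * c ≤ b * c
  *-monoʳ {a} {b} c h k = ≤by (δ h ⊠ δ k) (solve (a ∷ b ∷ c ∷ []) ring)

  *-monoˡ : ∀ (c : ℚ) {a b : ℚ} → a ≤ b → 0ℚ ≤ c → c * a ≤ c * b
  *-monoˡ c {a} {b} h k = ≤by (δ h ⊠ δ k) (solve (c ∷ a ∷ b ∷ []) ring)

  *-mono : ∀ {a b c d : ℚ} → a ≤ b → c ≤ d → 0ℚ ≤ a → 0ℚ ≤ c → a * c ≤ b * d
  *-mono {a} {b} {c} {d} h k u v = ≤by (δ h ⊠ δ k ⊞ δ h ⊠ δ v ⊞ δ u ⊠ δ k) (solve (a ∷ b ∷ c ∷ d ∷ []) ring)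

  ≤-neg : ∀ {a b : ℚ} → a ≤ b → - b ≤ - a
  ≤-neg {a} {b} h = ≤by (δ h) (solve (a ∷ b ∷ []) ring)

  +-mono : ∀ {a b c d : ℚ} → a ≤ b → c ≤ d → a + c ≤ b + d
  +-mono {a} {b} {c} {d} h k = ≤by (δ h ⊞ δ k) (solve (a ∷ b ∷ c ∷ d ∷ []) ring)

  *-≤1 : ∀ {a b : ℚ} → a ≤ 1ℚ → 0ℚ ≤ b → a * b ≤ b
  *-≤1 {a} {b} h k = ≤by (δ h ⊠ δ k) (solve (a ∷ b ∷ []) ring)

  *-cancelˡ : ∀ c {a b} → 0ℚ < c → c * a ≤ c * b → a ≤ b
  *-cancelˡ c p = *-cancelˡ-≤-pos c {{positive p}}

  zero-* : ∀ {x} y → x ≡ 0ℚ → x * y ≡ 0ℚ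
  zero-* y refl = *-zeroˡ y

  *-zero′ : ∀ x {y} → y ≡ 0ℚ → x * y ≡ 0ℚ
  *-zero′ x refl = *-zeroʳ x

  abs≤ : ∀ {p c} → - c ≤ p → p ≤ c → ∣ p ∣ ≤ c
  abs≤ {p} {c} h k with ∣p∣≡p∨∣p∣≡-p p
  ... | inj₁ e = subst (_≤ c) (sym e) k
  ... | inj₂ e = subst (_≤ c) (sym e) (lem h)
    where
    lem : ∀ {p c : ℚ} → - c ≤ p → - p ≤ c
    lem {p} {c} h = ≤by (δ h) (solve (p ∷ c ∷ []) ring)

  ≤abs : ∀ p → p ≤ ∣ p ∣
  ≤abs p with ≤-total 0ℚ p
  ... | inj₁ h = ≤-reflexive (sym (0≤p⇒∣p∣≡p h))
  ... | inj₂ h = ≤-trans h (0≤∣p∣ p)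

  -abs≤ : ∀ p → - ∣ p ∣ ≤ p
  -abs≤ p = lem (subst (- p ≤_) (∣-p∣≡∣p∣ p) (≤abs (- p)))
    where
    lem : ∀ {p c : ℚ} → - p ≤ c → - c ≤ p
    lem {p} {c} h = ≤by (δ h) (solve (p ∷ c ∷ []) ring)

  abs-upper : ∀ {p c} → ∣ p ∣ ≤ c → p ≤ c
  abs-upper {p} h = ≤-trans (≤abs p) h

  abs-lower : ∀ {p c} → ∣ p ∣ ≤ c → - c ≤ p
  abs-lower {p} h = ≤-trans (≤-neg h) (-abs≤ p)

  abs-nonneg : ∀ {p} → 0ℚ ≤ p → ∣ p ∣ ≡ p
  abs-nonneg = 0≤p⇒∣p∣≡p

  triangle : ∀ p q {a b} → ∣ p ∣ ≤ a → ∣ q ∣ ≤ b → ∣ p + q ∣ ≤ a + b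
  triangle p q h k = ≤-trans (∣p+q∣≤∣p∣+∣q∣ p q) (+-mono h k)

  triangle⁻ : ∀ p q {a b} → ∣ p ∣ ≤ a → ∣ q ∣ ≤ b → ∣ p - q ∣ ≤ a + b
  triangle⁻ p q h k = ≤-trans (∣p-q∣≤∣p∣+∣q∣ p q) (+-mono h k)

  abs-* : ∀ p q {a b} → ∣ p ∣ ≤ a → ∣ q ∣ ≤ b → ∣ p * q ∣ ≤ a * b
  abs-* p q {a} h k = ≤-trans (≤-reflexive (∣p*q∣≡∣p∣*∣q∣ p q)) (*-mono h k (0≤∣p∣ p) (0≤∣p∣ q))

  ι : ℕ → ℚ
  ι zero    = 0ℚ
  ι (suc n) = 1ℚ + ι n

  ι-+ : ∀ m n → ι (m ℕ.+ n) ≡ ι m + ι n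
  ι-+ zero    n = sym (+-identityˡ (ι n))
  ι-+ (suc m) n = trans (cong (λ z → 1ℚ + z) (ι-+ m n)) (sym (+-assoc 1ℚ (ι m) (ι n)))

  ι-* : ∀ m n → ι (m ℕ.* n) ≡ ι m * ι n
  ι-* zero    n = sym (*-zeroˡ (ι n))
  ι-* (suc m) n = trans (ι-+ n (m ℕ.* n)) (trans (cong (ι n +_) (ι-* m n)) (eq (ι m) (ι n)))
    where
    eq : ∀ m n → n + m * n ≡ (1ℚ + m) * n
    eq = solve-∀ ring

  ι≥0 : ∀ n → 0ℚ ≤ ι n
  ι≥0 zero    = ≤-refl
  ι≥0 (suc n) = const≥0 1ℚ ⊞ ι≥0 n

  ι-mono : ∀ {m n} → m ℕ.≤ n → ι m ≤ ι n
  ι-mono {n = n} ℕ.z≤n = ι≥0 n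
  ι-mono (ℕ.s≤s h) = +-monoʳ-≤ 1ℚ (ι-mono h)

  ι-pos : ∀ n → 0ℚ < ι (suc n)
  ι-pos n = <-≤-trans (toWitness {a? = 0ℚ <? 1ℚ} _) (ι-mono {1} {suc n} (ℕ.s≤s ℕ.z≤n))

  -- The junk value is inv 0 = 0.
  inv : ℕ → ℚ
  inv zero    = 0ℚ
  inv (suc n) = (1/ ι (suc n)) {{>-nonZero (ι-pos n)}}

  ι-inv : ∀ n → 1 ℕ.≤ n → ι n * inv n ≡ 1ℚ
  ι-inv (suc n) _ = *-inverseʳ (ι (suc n)) {{>-nonZero (ι-pos n)}}

  inv-pos : ∀ n → 0ℚ < inv (suc n)
  inv-pos n = positive⁻¹ (inv (suc n)) {{1/pos⇒pos (ι (suc n)) {{positive (ι-pos n)}}}}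

  inv≥0 : ∀ n → 0ℚ ≤ inv n
  inv≥0 zero    = ≤-refl
  inv≥0 (suc n) = <⇒≤ (inv-pos n)

  ≤-inv : ∀ n {a} → 1 ℕ.≤ n → ι n * a ≤ 1ℚ → a ≤ inv n
  ≤-inv (suc n) {a} h k = *-cancelˡ (ι (suc n)) (ι-pos n) (≤-trans k (≤-reflexive (sym (ι-inv (suc n) h))))

  inv-≤ : ∀ n {a} → 1 ℕ.≤ n → 1ℚ ≤ ι n * a → inv n ≤ a
  inv-≤ (suc n) {a} h k = *-cancelˡ (ι (suc n)) (ι-pos n) (≤-trans (≤-reflexive (ι-inv (suc n) h)) k)

  inv-* : ∀ m n → inv (m ℕ.* n) ≡ inv m * inv n
  inv-* zero    n = sym (*-zeroˡ (inv n))
  inv-* (suc m) zero    = trans (cong inv (ℕₚ.*-zeroʳ (suc m))) (sym (*-zeroʳ (inv (suc m))))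
  inv-* (suc m) (suc n) = ≤-antisym
    (inv-≤ (suc m ℕ.* suc n) (ℕ.s≤s ℕ.z≤n) (≤-reflexive (sym one)))
    (≤-inv (suc m ℕ.* suc n) (ℕ.s≤s ℕ.z≤n) (≤-reflexive one))
    where
    eq : ∀ a b c d → (a * b) * (c * d) ≡ (a * c) * (b * d)
    eq = solve-∀ ring
    one : ι (suc m ℕ.* suc n) * (inv (suc m) * inv (suc n)) ≡ 1ℚ
    one = trans (cong (_* (inv (suc m) * inv (suc n))) (ι-* (suc m) (suc n)))
         (trans (eq (ι (suc m)) (ι (suc n)) (inv (suc m)) (inv (suc n)))
                (cong₂ _*_ (ι-inv (suc m) (ℕ.s≤s ℕ.z≤n)) (ι-inv (suc n) (ℕ.s≤s ℕ.z≤n))))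

  inv-antitone : ∀ {m n} → 1 ℕ.≤ m → m ℕ.≤ n → inv n ≤ inv m
  inv-antitone {m} {n} h k = inv-≤ n (ℕₚ.≤-trans h k)
    (≤-trans (≤-reflexive (sym (ι-inv m h))) (*-monoʳ (inv m) (ι-mono k) (inv≥0 m)))

  inv≤1 : ∀ n → inv n ≤ 1ℚ
  inv≤1 zero    = const≥0 1ℚ
  inv≤1 (suc n) = inv-antitone {1} {suc n} ℕₚ.≤-refl (ℕ.s≤s ℕ.z≤n)

  inv-diff : ∀ n → inv (suc n) - inv (suc (suc n)) ≡ inv (suc n) * inv (suc (suc n))
  inv-diff n = trans (cong₂ _-_ (sym (*-identityʳ a)) (sym (*-identityʳ b)))
              (trans (cong₂ (λ u v → a * u - b * v) (sym (ι-inv (suc (suc n)) (ℕ.s≤s ℕ.z≤n)))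
                (sym (ι-inv (suc n) (ℕ.s≤s ℕ.z≤n))))
                     (eq a b (ι (suc n))))
    where
    a = inv (suc n)
    b = inv (suc (suc n))
    eq : ∀ a b x → a * ((1ℚ + x) * b) - b * (x * a) ≡ a * b
    eq = solve-∀ ring

-- Finite sums, partial summation and bounded search.

module Sums where

  open Rationals
  open import Data.Rational
  open import Data.Rational.Properties
  open import Data.Nat.Divisibility using (_∣_; _∣?_; ∣m+n∣m⇒∣n; m∣m*n; ∣⇒≤; n∣m*n)

  𝟙 : {P : Set} → Dec P → ℚ
  𝟙 (yes _) = 1ℚ
  𝟙 (no  _) = 0ℚ

  𝟙-yes : {P : Set} (d : Dec P) → P → 𝟙 d ≡ 1ℚ
  𝟙-yes (yes _) _ = refl
  𝟙-yes (no ¬p) p = ⊥-elim (¬p p)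

  𝟙-no : {P : Set} (d : Dec P) → ¬ P → 𝟙 d ≡ 0ℚ
  𝟙-no (yes p) ¬p = ⊥-elim (¬p p)
  𝟙-no (no _)  _  = refl

  𝟙-cong : {P Q : Set} (d : Dec P) (e : Dec Q) → (P → Q) → (Q → P) → 𝟙 d ≡ 𝟙 e
  𝟙-cong (yes p) e f g = sym (𝟙-yes e (f p))
  𝟙-cong (no ¬p) e f g = sym (𝟙-no e (¬p ∘ g))

  𝟙≥0 : {P : Set} (d : Dec P) → 0ℚ ≤ 𝟙 d
  𝟙≥0 (yes _) = const≥0 1ℚ
  𝟙≥0 (no  _) = ≤-refl

  𝟙≤1 : {P : Set} (d : Dec P) → 𝟙 d ≤ 1ℚ
  𝟙≤1 (yes _) = ≤-refl
  𝟙≤1 (no  _) = const≥0 1ℚ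

  -- ∑ n f = f 1 + ⋯ + f n.
  ∑ : ℕ → (ℕ → ℚ) → ℚ
  ∑ zero    f = 0ℚ
  ∑ (suc n) f = ∑ n f + f (suc n)

  ∑-cong : ∀ n {f h} → (∀ k → 1 ℕ.≤ k → k ℕ.≤ n → f k ≡ h k) → ∑ n f ≡ ∑ n h
  ∑-cong zero    e = refl
  ∑-cong (suc n) e = cong₂ _+_ (∑-cong n (λ k p q → e k p (ℕₚ.m≤n⇒m≤1+n q))) (e (suc n) (s≤s z≤n) ℕₚ.≤-refl)

  ∑-ext : ∀ n {f h} → (∀ k → f k ≡ h k) → ∑ n f ≡ ∑ n h
  ∑-ext n e = ∑-cong n (λ k _ _ → e k)

  ∑-mono : ∀ n {f h} → (∀ k → 1 ℕ.≤ k → k ℕ.≤ n → f k ≤ h k) → ∑ n f ≤ ∑ n h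
  ∑-mono zero    e = ≤-refl
  ∑-mono (suc n) e = +-mono (∑-mono n (λ k p q → e k p (ℕₚ.m≤n⇒m≤1+n q))) (e (suc n) (s≤s z≤n) ℕₚ.≤-refl)

  ∑-zero : ∀ n {f} → (∀ k → 1 ℕ.≤ k → k ℕ.≤ n → f k ≡ 0ℚ) → ∑ n f ≡ 0ℚ
  ∑-zero zero    e = refl
  ∑-zero (suc n) e = trans (cong₂ _+_ (∑-zero n (λ k p q → e k p (ℕₚ.m≤n⇒m≤1+n q))) (e (suc n) (s≤s z≤n) ℕₚ.≤-refl))
    (+-identityˡ 0ℚ)

  ∑≥0 : ∀ n {f} → (∀ k → 1 ℕ.≤ k → k ℕ.≤ n → 0ℚ ≤ f k) → 0ℚ ≤ ∑ n f
  ∑≥0 n {f} e = ≤-trans (≤-reflexive (sym (∑-zero n {λ _ → 0ℚ} (λ _ _ _ → refl)))) (∑-mono n e)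

  ∑-+ : ∀ n f h → ∑ n (λ k → f k + h k) ≡ ∑ n f + ∑ n h
  ∑-+ zero    f h = sym (+-identityˡ 0ℚ)
  ∑-+ (suc n) f h = trans (cong (λ z → z + (f (suc n) + h (suc n))) (∑-+ n f h))
    (eq (∑ n f) (∑ n h) (f (suc n)) (h (suc n)))
    where
    eq : ∀ a b c d → a + b + (c + d) ≡ a + c + (b + d)
    eq = solve-∀ ring

  ∑-*ˡ : ∀ n c f → ∑ n (λ k → c * f k) ≡ c * ∑ n f
  ∑-*ˡ zero    c f = sym (*-zeroʳ c)
  ∑-*ˡ (suc n) c f = trans (cong (λ z → z + c * f (suc n)) (∑-*ˡ n c f)) (sym (*-distribˡ-+ c (∑ n f) (f (suc n))))

  ∑-*ʳ : ∀ n c f → ∑ n (λ k → f k * c) ≡ ∑ n f * c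
  ∑-*ʳ n c f = trans (∑-ext n (λ k → *-comm (f k) c)) (trans (∑-*ˡ n c f) (*-comm c (∑ n f)))

  ∑-neg : ∀ n f → ∑ n (λ k → - f k) ≡ - ∑ n f
  ∑-neg zero    f = refl
  ∑-neg (suc n) f = trans (cong (λ z → z + - f (suc n)) (∑-neg n f)) (eq (∑ n f) (f (suc n)))
    where
    eq : ∀ a b → - a + - b ≡ - (a + b)
    eq = solve-∀ ring

  ∑-sub : ∀ n f h → ∑ n (λ k → f k - h k) ≡ ∑ n f - ∑ n h
  ∑-sub n f h = trans (∑-+ n f (λ k → - h k)) (cong (λ z → ∑ n f + z) (∑-neg n h))

  ∑-swap : ∀ m n (f : ℕ → ℕ → ℚ) → ∑ m (λ i → ∑ n (λ j → f i j)) ≡ ∑ n (λ j → ∑ m (λ i → f i j))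
  ∑-swap zero    n f = sym (∑-zero n (λ _ _ _ → refl))
  ∑-swap (suc m) n f = trans (cong (λ z → z + ∑ n (f (suc m))) (∑-swap m n f))
    (sym (∑-+ n (λ j → ∑ m (λ i → f i j)) (f (suc m))))

  ∑-abs : ∀ n f → ∣ ∑ n f ∣ ≤ ∑ n (λ k → ∣ f k ∣)
  ∑-abs zero    f = ≤-refl
  ∑-abs (suc n) f = ≤-trans (∣p+q∣≤∣p∣+∣q∣ (∑ n f) (f (suc n))) (+-monoˡ-≤ ∣ f (suc n) ∣ (∑-abs n f))

  ∑-const : ∀ n c → ∑ n (λ _ → c) ≡ ι n * c
  ∑-const zero    c = sym (*-zeroˡ c)
  ∑-const (suc n) c = trans (cong (λ z → z + c) (∑-const n c)) (eq (ι n) c)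
    where
    eq : ∀ n c → n * c + c ≡ (1ℚ + n) * c
    eq = solve-∀ ring

  ∑-shift : ∀ m n f → ∑ (m ℕ.+ n) f ≡ ∑ m f + ∑ n (λ k → f (m ℕ.+ k))
  ∑-shift m zero    f = trans (cong (λ z → ∑ z f) (ℕₚ.+-identityʳ m)) (sym (+-identityʳ (∑ m f)))
  ∑-shift m (suc n) f = trans (cong (λ z → ∑ z f) (ℕₚ.+-suc m n))
    (trans (cong₂ _+_ (∑-shift m n f) (cong f (sym (ℕₚ.+-suc m n)))) (+-assoc (∑ m f) _ _))

  ∑-head : ∀ n (f : ℕ → ℚ) → 1 ℕ.≤ n → ∑ n f ≡ f 1 + ∑ (ℕ.pred n) (λ k → f (suc k))
  ∑-head (suc n) f _ = trans (∑-shift 1 n f) (cong (_+ ∑ n (λ k → f (suc k))) (+-identityˡ (f 1)))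

  ∑-last : ∀ n (f : ℕ → ℚ) → 1 ℕ.≤ n → ∑ n f ≡ ∑ (ℕ.pred n) f + f n
  ∑-last (suc n) f _ = refl

  ∑-extend : ∀ {m n} (f : ℕ → ℚ) → m ℕ.≤ n → (∀ k → m ℕ.< k → f k ≡ 0ℚ) → ∑ n f ≡ ∑ m f
  ∑-extend {m} {n} f h e = trans (cong (λ z → ∑ z f) (sym (ℕₚ.m+[n∸m]≡n h)))
    (trans (∑-shift m (n ℕ.∸ m) f)
    (trans (cong (λ z → ∑ m f + z) (∑-zero (n ℕ.∸ m) (λ { (suc k) _ _ → e (m ℕ.+ suc k) (ℕₚ.m<m+n m (s≤s z≤n)) })))
           (+-identityʳ (∑ m f))))

  ∑-monoʳ : ∀ {m n} (f : ℕ → ℚ) → m ℕ.≤ n → (∀ k → 0ℚ ≤ f k) → ∑ m f ≤ ∑ n f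
  ∑-monoʳ {m} {n} f h e = ≤-trans
    (≤-trans (≤-reflexive (sym (+-identityʳ (∑ m f)))) (+-monoʳ-≤ (∑ m f) (∑≥0 (n ℕ.∸ m) (λ k _ _ → e (m ℕ.+ k)))))
    (≤-reflexive (trans (sym (∑-shift m (n ℕ.∸ m) f)) (cong (λ z → ∑ z f) (ℕₚ.m+[n∸m]≡n h))))

  ∑-single-range : ∀ n (f : ℕ → ℚ) j → 1 ℕ.≤ j → j ℕ.≤ n → (∀ k → 1 ℕ.≤ k → k ℕ.≤ n → k ≢ j → f k ≡ 0ℚ) → ∑ n f ≡ f j
  ∑-single-range zero    f (suc j) p () e
  ∑-single-range (suc n) f j p q e with j ℕ.≟ suc n
  ... | yes refl = trans (cong (_+ f (suc n)) (∑-zero n (λ k s r → e k s (ℕₚ.m≤n⇒m≤1+n r) (ℕₚ.<⇒≢ (s≤s r)))))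
    (+-identityˡ (f (suc n)))
  ... | no  j≢   = trans (cong₂ _+_
    (∑-single-range n f j p (ℕₚ.≤-pred (ℕₚ.≤∧≢⇒< q j≢)) (λ k s r → e k s (ℕₚ.m≤n⇒m≤1+n r)))
    (e (suc n) (s≤s z≤n) ℕₚ.≤-refl (j≢ ∘ sym))) (+-identityʳ (f j))

  ∑-single : ∀ n (f : ℕ → ℚ) j → 1 ℕ.≤ j → j ℕ.≤ n → (∀ k → k ≢ j → f k ≡ 0ℚ) → ∑ n f ≡ f j
  ∑-single n f j p q e = ∑-single-range n f j p q (λ k _ _ → e k)

  ∑-term : ∀ n (f : ℕ → ℚ) j → 1 ℕ.≤ j → j ℕ.≤ n → (∀ k → 0ℚ ≤ f k) → f j ≤ ∑ n f
  ∑-term zero    f (suc j) p () e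
  ∑-term (suc n) f j p q e with j ℕ.≟ suc n
  ... | yes refl = lem (∑≥0 n (λ k _ _ → e k))
    where
    lem : ∀ {a b : ℚ} → 0ℚ ≤ a → b ≤ a + b
    lem {a} {b} h = ≤by (δ h) (solve (a ∷ b ∷ []) ring)

  ... | no  j≢   = lem (∑-term n f j p (ℕₚ.≤-pred (ℕₚ.≤∧≢⇒< q j≢)) e) (e (suc n))
    where
    lem : ∀ {a b c : ℚ} → c ≤ a → 0ℚ ≤ b → c ≤ a + b
    lem {a} {b} {c} h k = ≤by (δ h ⊞ δ k) (solve (a ∷ b ∷ c ∷ []) ring)

  ∑-cut : ∀ n y (f : ℕ → ℚ) → y ℕ.≤ n → ∑ n (λ k → 𝟙 (k ℕ.≤? y) * f k) ≡ ∑ y f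
  ∑-cut n y f h = trans (∑-extend _ h (λ k q → trans (cong (λ z → z * f k) (𝟙-no (k ℕ.≤? y) (ℕₚ.<⇒≱ q)))
    (*-zeroˡ (f k))))
    (∑-cong y (λ k _ q → trans (cong (λ z → z * f k) (𝟙-yes (k ℕ.≤? y) q)) (*-identityˡ (f k))))

  ∑-multiples-block : ∀ d n (f : ℕ → ℚ) → ∑ (n ℕ.* suc d) (λ k → 𝟙 (suc d ∣? k) * f k) ≡ ∑ n (λ j → f (suc d ℕ.* j))
  ∑-multiples-block d zero    f = refl
  ∑-multiples-block d (suc n) f =
    trans (cong (λ z → ∑ z F) (ℕₚ.+-comm (suc d) (n ℕ.* suc d)))
    (trans (∑-shift (n ℕ.* suc d) (suc d) F)
    (cong₂ _+_ (∑-multiples-block d n f)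
      (trans (cong₂ _+_ (∑-zero d small)
        (trans (cong (λ z → z * f last) (𝟙-yes (suc d ∣? last) (subst (suc d ∣_) (sym last≡) (m∣m*n (suc n)))))
        (*-identityˡ (f last))))
      (trans (+-identityˡ (f last)) (cong f last≡)))))
    where
    F = λ k → 𝟙 (suc d ∣? k) * f k
    last = n ℕ.* suc d ℕ.+ suc d
    last≡ : last ≡ suc d ℕ.* suc n
    last≡ = trans (ℕₚ.+-comm (n ℕ.* suc d) (suc d)) (ℕₚ.*-comm (suc n) (suc d))
    small : ∀ k → 1 ℕ.≤ k → k ℕ.≤ d → F (n ℕ.* suc d ℕ.+ k) ≡ 0ℚ
    small (suc k) p q = trans (cong (λ z → z * f (n ℕ.* suc d ℕ.+ suc k))
      (𝟙-no (suc d ∣? (n ℕ.* suc d ℕ.+ suc k)) (λ e → ℕₚ.<⇒≱ (s≤s q) (∣⇒≤ (∣m+n∣m⇒∣n e (n∣m*n n))))))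
      (*-zeroˡ (f (n ℕ.* suc d ℕ.+ suc k)))

  -- Letting j run up to n instead of n / m keeps quotients out of the statement; the surplus terms
  -- vanish by the support condition.
  ∑-multiples : ∀ {m} n (f : ℕ → ℚ) → 1 ℕ.≤ m → (∀ k → n ℕ.< k → f k ≡ 0ℚ) →
    ∑ n (λ k → 𝟙 (m ∣? k) * f k) ≡ ∑ n (λ j → f (m ℕ.* j))
  ∑-multiples {suc d} n f _ e = trans
    (sym (∑-extend _ (ℕₚ.m≤m*n n (suc d))
      (λ k q → trans (cong (λ z → 𝟙 (suc d ∣? k) * z) (e k q)) (*-zeroʳ (𝟙 (suc d ∣? k))))))
    (∑-multiples-block d n f)

  -- Abel summation: φ enters only through its partial sums, so C multiplies the total variation of
  -- b together with its last value.
  ∑-by-parts : ∀ C (φ b : ℕ → ℚ) → (∀ w → ∣ ∑ w φ ∣ ≤ C) → ∀ n →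
    ∣ ∑ (suc n) (λ k → φ k * b k) ∣ ≤ C * (∣ b (suc n) ∣ + ∑ n (λ k → ∣ b k - b (suc k) ∣))
  ∑-by-parts C φ b h n = ≤-trans (≤-reflexive (cong ∣_∣ (eq (∑ n (λ k → φ k * b k)) (∑ n φ) (φ (suc n)) (b (suc n)))))
    (≤-trans (triangle (∑ (suc n) φ * b (suc n)) (∑ n (λ k → φ k * b k) - ∑ n φ * b (suc n))
      (bound (suc n) (b (suc n))) (main n)) (≤-reflexive (sym (*-distribˡ-+ C _ _))))
    where
    eq : ∀ S Φ p q → S + p * q ≡ (Φ + p) * q + (S - Φ * q)
    eq = solve-∀ ring

    step : ∀ S Φ p q r → S + p * q - (Φ + p) * r ≡ (S - Φ * q) + (Φ + p) * (q - r)
    step = solve-∀ ring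

    bound : ∀ w x → ∣ ∑ w φ * x ∣ ≤ C * ∣ x ∣
    bound w x = ≤-trans (≤-reflexive (∣p*q∣≡∣p∣*∣q∣ (∑ w φ) x)) (*-monoʳ ∣ x ∣ (h w) (0≤∣p∣ x))
    main : ∀ n → ∣ ∑ n (λ k → φ k * b k) - ∑ n φ * b (suc n) ∣ ≤ C * ∑ n (λ k → ∣ b k - b (suc k) ∣)
    main zero    = ≤-reflexive (trans (cong ∣_∣ (z (b 1))) (sym (*-zeroʳ C)))
      where
      z : ∀ x → 0ℚ - 0ℚ * x ≡ 0ℚ
      z = solve-∀ ring

    main (suc n) = ≤-trans (≤-reflexive
      (cong ∣_∣ (step (∑ n (λ k → φ k * b k)) (∑ n φ) (φ (suc n)) (b (suc n)) (b (suc (suc n))))))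
      (≤-trans (triangle (∑ n (λ k → φ k * b k) - ∑ n φ * b (suc n)) (∑ (suc n) φ * (b (suc n) - b (suc (suc n))))
        (main n) (bound (suc n) (b (suc n) - b (suc (suc n))))) (≤-reflexive (sym (*-distribˡ-+ C _ _))))

  ∑-antitone : ∀ (b : ℕ → ℚ) → (∀ k → b (suc (suc k)) ≤ b (suc k)) → ∀ n →
    ∑ n (λ k → ∣ b k - b (suc k) ∣) ≡ b 1 - b (suc n)
  ∑-antitone b h zero    = sym (+-inverseʳ (b 1))
  ∑-antitone b h (suc n) = trans (cong₂ _+_ (∑-antitone b h n) (abs-nonneg (δ (h n))))
    (eq (b 1) (b (suc n)) (b (suc (suc n))))
    where
    eq : ∀ x y z → x - y + (y - z) ≡ x - z
    eq = solve-∀ ring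

  -- Partial sums of φ started at w are differences of two partial sums, hence at most 2C. For a
  -- nonnegative decreasing b, variation and last value add up to the first value b (w + 1).
  ∑-tail : ∀ C (φ b : ℕ → ℚ) → (∀ w → ∣ ∑ w φ ∣ ≤ C) → (∀ k → b (suc (suc k)) ≤ b (suc k)) → (∀ k → 0ℚ ≤ b (suc k)) →
    ∀ {w X} → w ℕ.≤ X → ∣ ∑ X (λ k → φ k * b k) - ∑ w (λ k → φ k * b k) ∣ ≤ ι 2 * C * b (suc w)
  ∑-tail C φ b h dec b≥0 {w} {X} w≤X with ℕₚ.m≤n⇒∃[o]m+o≡n w≤X
  ... | n , refl = ≤-trans (≤-reflexive
    (cong ∣_∣ (trans (cong (_- ∑ w F) (∑-shift w n F)) (canc (∑ w F) (∑ n (F ∘ (w ℕ.+_))))))) (go n)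
    where
    F = λ k → φ k * b k
    canc : ∀ x y → x + y - x ≡ y
    canc = solve-∀ ring

    C≥0 : 0ℚ ≤ C
    C≥0 = ≤-trans (0≤∣p∣ 0ℚ) (h 0)
    φ' = φ ∘ (w ℕ.+_)
    b' = b ∘ (w ℕ.+_)
    h' : ∀ v → ∣ ∑ v φ' ∣ ≤ ι 2 * C
    h' v = ≤-trans (≤-reflexive (cong ∣_∣
      (trans (sym (canc (∑ w φ) (∑ v φ'))) (cong (_- ∑ w φ) (sym (∑-shift w v φ))))))
      (≤-trans (∣p-q∣≤∣p∣+∣q∣ (∑ (w ℕ.+ v) φ) (∑ w φ)) (≤-trans (+-mono (h (w ℕ.+ v)) (h w)) (≤-reflexive (two C))))
      where
      two : ∀ C → C + C ≡ ι 2 * C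
      two = solve-∀ ring

    dec' : ∀ k → b' (suc (suc k)) ≤ b' (suc k)
    dec' k = subst₂ _≤_ (cong b (trans (cong suc (sym (ℕₚ.+-suc w k))) (sym (ℕₚ.+-suc w (suc k)))))
      (cong b (sym (ℕₚ.+-suc w k))) (dec (w ℕ.+ k))
    first : b' 1 ≡ b (suc w)
    first = cong b (ℕₚ.+-comm w 1)
    go : ∀ n → ∣ ∑ n (λ k → φ' k * b' k) ∣ ≤ ι 2 * C * b (suc w)
    go zero    = (const≥0 (ι 2) ⊠ C≥0) ⊠ b≥0 w
    go (suc n) = ≤-trans (∑-by-parts (ι 2 * C) φ' b' h' n)
      (≤-reflexive (cong (ι 2 * C *_)
        (trans (cong₂ _+_ (abs-nonneg nn) (∑-antitone b' dec' n)) (trans (eq (b' (suc n)) (b' 1)) first))))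
      where
      nn : 0ℚ ≤ b' (suc n)
      nn = subst (0ℚ ≤_) (cong b (sym (ℕₚ.+-suc w n))) (b≥0 (w ℕ.+ n))
      eq : ∀ x y → x + (y - x) ≡ y
      eq = solve-∀ ring

  search : {Q : ℕ → Set} → (∀ n → Dec (Q n)) → ∀ n →
    (Σ ℕ λ b → 1 ℕ.≤ b × b ℕ.≤ n × Q b) ⊎ (∀ b → 1 ℕ.≤ b → b ℕ.≤ n → ¬ Q b)
  search Q? zero = inj₂ (λ b 1≤b b≤0 _ → ℕₚ.<⇒≱ 1≤b b≤0)
  search Q? (suc n) with Q? (suc n) | search Q? n
  ... | yes q | _ = inj₁ (suc n , s≤s z≤n , ℕₚ.≤-refl , q)
  ... | no _  | inj₁ (b , 1≤b , b≤n , q) = inj₁ (b , 1≤b , ℕₚ.m≤n⇒m≤1+n b≤n , q)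
  ... | no ¬q | inj₂ none = inj₂ below
    where
    below : ∀ b → 1 ℕ.≤ b → b ℕ.≤ suc n → ¬ _
    below b 1≤b b≤ with b ℕ.≟ suc n
    ... | yes refl = ¬q
    ... | no b≢    = none b 1≤b (ℕₚ.≤-pred (ℕₚ.≤∧≢⇒< b≤ b≢))

-- Harmonic sums as an approximate logarithm.

module Harmonic where

  open Rationals
  open Sums
  open import Data.Rational
  open import Data.Rational.Properties

  H : ℕ → ℚ
  H n = ∑ n inv

  block : ℕ → ℕ → ℚ
  block n j = ∑ n (λ i → inv (ℕ.pred j ℕ.* n ℕ.+ i))

  H-blocks : ∀ n J → H (J ℕ.* n) ≡ ∑ J (block n)
  H-blocks n zero    = refl
  H-blocks n (suc J) = trans (cong H (ℕₚ.+-comm n (J ℕ.* n)))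
    (trans (∑-shift (J ℕ.* n) n inv) (cong (_+ block n (suc J)) (H-blocks n J)))

  ι-inv-* : ∀ n j → 1 ℕ.≤ n → ι n * inv (j ℕ.* n) ≡ inv j
  ι-inv-* n j h = trans (cong (ι n *_) (inv-* j n))
    (trans (eq (ι n) (inv j) (inv n)) (trans (cong (inv j *_) (ι-inv n h)) (*-identityʳ (inv j))))
    where
    eq : ∀ a b c → a * (b * c) ≡ b * (a * c)
    eq = solve-∀ ring

  block-lower : ∀ n j → 1 ℕ.≤ n → inv (suc j) ≤ block n (suc j)
  block-lower n j h = subst (_≤ block n (suc j)) (trans (∑-const n (inv (suc j ℕ.* n))) (ι-inv-* n (suc j) h))
    (∑-mono n (λ i p q → inv-antitone (ℕₚ.≤-trans p (ℕₚ.m≤n+m i (j ℕ.* n)))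
      (subst (j ℕ.* n ℕ.+ i ℕ.≤_) (ℕₚ.+-comm (j ℕ.* n) n) (ℕₚ.+-monoʳ-≤ (j ℕ.* n) q))))

  block-upper : ∀ n j → 1 ℕ.≤ n → block n (suc (suc j)) ≤ inv (suc j)
  block-upper n j h = subst (block n (suc (suc j)) ≤_) (trans (∑-const n (inv (suc j ℕ.* n))) (ι-inv-* n (suc j) h))
    (∑-mono n (λ i p q → inv-antitone (ℕₚ.≤-trans h (ℕₚ.m≤m+n n (j ℕ.* n))) (ℕₚ.m≤m+n (suc j ℕ.* n) i)))

  block≥0 : ∀ n j → 0ℚ ≤ block n j
  block≥0 n j = ∑≥0 n (λ i _ _ → inv≥0 (ℕ.pred j ℕ.* n ℕ.+ i))

  -- H (n K) - H K = 1/(K+1) + ⋯ + 1/(nK) is a rational stand-in for log n, additive up to 1/K.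
  module ApproximateLog (k : ℕ) where

    K : ℕ
    K = suc k

    g : ℕ → ℚ
    g n = H (n ℕ.* K) - H K

    g1 : g 1 ≡ 0ℚ
    g1 = trans (cong (λ z → H z - H K) (ℕₚ.*-identityˡ K)) (+-inverseʳ (H K))

    g-suc : ∀ n → g (suc n) ≡ g n + block K (suc n)
    g-suc n = trans (cong (_- H K) (trans (cong H (ℕₚ.+-comm K (n ℕ.* K))) (∑-shift (n ℕ.* K) K inv)))
      (eq (H (n ℕ.* K)) (block K (suc n)) (H K))
      where
      eq : ∀ a b c → a + b - c ≡ a - c + b
      eq = solve-∀ ring

    g-mono : ∀ n → g n ≤ g (suc n)
    g-mono n = subst (g n ≤_) (sym (g-suc n)) (lem (block≥0 K (suc n)))
      where
      lem : ∀ {a b : ℚ} → 0ℚ ≤ b → a ≤ a + b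
      lem {a} {b} h = ≤by (δ h) (solve (a ∷ b ∷ []) ring)

    g-step : ∀ n → g (suc (suc n)) ≤ g (suc n) + inv (suc n)
    g-step n = subst (_≤ g (suc n) + inv (suc n)) (sym (g-suc (suc n)))
      (+-monoʳ-≤ (g (suc n)) (block-upper K n (s≤s z≤n)))

    g≥0 : ∀ n → 0ℚ ≤ g (suc n)
    g≥0 zero    = ≤-reflexive (sym g1)
    g≥0 (suc n) = ≤-trans (g≥0 n) (g-mono (suc n))

    g≤ι : ∀ n → g (suc n) ≤ ι n
    g≤ι zero    = ≤-reflexive g1
    g≤ι (suc n) = ≤-trans (g-step n) (lem (g≤ι n) (inv≤1 (suc n)))
      where
      lem : ∀ {a b c : ℚ} → a ≤ c → b ≤ 1ℚ → a + b ≤ 1ℚ + c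
      lem {a} {b} {c} h k = ≤by (δ h ⊞ δ k) (solve (a ∷ b ∷ c ∷ []) ring)

    g2 : inv 2 ≤ g 2
    g2 = subst (inv 2 ≤_) (sym (trans (g-suc 1) (trans (cong (_+ block K 2) g1) (+-identityˡ (block K 2)))))
      (block-lower K 1 (s≤s z≤n))

    -- `H` at the large argument is cut into blocks of length `suc n`. The first K blocks make up
    -- `g (suc n)`; beyond them the j-th block is paired with 1/j. The two differ by something
    -- between 0 and 1/(j-1) - 1/j, and telescoping yields the error 1/K of `g-*`.
    g-*-gap : ∀ m n → g (suc m ℕ.* suc n) - g (suc n) - g (suc m) ≡ ∑ (m ℕ.* K)
      (λ i → block (suc n) (K ℕ.+ i) - inv (K ℕ.+ i))
    g-*-gap m n = trans (cong₂ (λ u v → u - H K - (v - H K) - g (suc m))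
        (trans (cong H (trans (cong (ℕ._* K) (ℕₚ.*-comm (suc m) (suc n)))
          (trans (ℕₚ.*-assoc (suc n) (suc m) K) (ℕₚ.*-comm (suc n) (suc m ℕ.* K)))))
          (H-blocks (suc n) (K ℕ.+ m ℕ.* K)))
        (trans (cong H (ℕₚ.*-comm (suc n) K)) (H-blocks (suc n) K)))
      (trans (cong₂ (λ u v → u - H K - (∑ K (block (suc n)) - H K) - (v - H K)) (∑-shift K (m ℕ.* K) (block (suc n)))
        (∑-shift K (m ℕ.* K) inv))
      (trans (eq (∑ K (block (suc n))) (∑ (m ℕ.* K) (block (suc n) ∘ (K ℕ.+_))) (H K) (∑ (m ℕ.* K) (inv ∘ (K ℕ.+_))))
             (sym (∑-sub (m ℕ.* K) (block (suc n) ∘ (K ℕ.+_)) (inv ∘ (K ℕ.+_))))))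
      where
      eq : ∀ a b h c → a + b - h - (a - h) - (h + c - h) ≡ b - c
      eq = solve-∀ ring

    ∑-telescope : ∀ L → ∑ L (λ i → inv (k ℕ.+ i) - inv (K ℕ.+ i)) ≡ inv K - inv (K ℕ.+ L)
    ∑-telescope zero    = sym (trans (cong (λ z → inv K - inv z) (ℕₚ.+-identityʳ K)) (+-inverseʳ (inv K)))
    ∑-telescope (suc L) = trans (cong₂ _+_ (∑-telescope L) (cong (λ z → inv z - inv (K ℕ.+ suc L)) (ℕₚ.+-suc k L)))
      (eq (inv K) (inv (K ℕ.+ L)) (inv (K ℕ.+ suc L)))
      where
      eq : ∀ a b c → a - b + (b - c) ≡ a - c
      eq = solve-∀ ring

    g-* : ∀ m n → 1 ℕ.≤ m → 1 ℕ.≤ n → ∣ g (m ℕ.* n) - g n - g m ∣ ≤ inv K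
    g-* (suc m) (suc n) _ _ = abs≤
      (≤-trans (lem₁ (inv≥0 K)) (subst (0ℚ ≤_) (sym (g-*-gap m n))
        (∑≥0 (m ℕ.* K) (λ i _ _ → δ (block-lower (suc n) (k ℕ.+ i) (s≤s z≤n))))))
      (subst (_≤ inv K) (sym (g-*-gap m n)) (≤-trans
        (∑-mono (m ℕ.* K) (λ { (suc i) _ _ → +-monoˡ-≤ (- inv (K ℕ.+ suc i))
          (subst (λ z → block (suc n) (suc z) ≤ inv z) (sym (ℕₚ.+-suc k i))
            (block-upper (suc n) (k ℕ.+ i) (s≤s z≤n))) }))
        (≤-trans (≤-reflexive (∑-telescope (m ℕ.* K))) (lem₂ (inv≥0 (K ℕ.+ m ℕ.* K))))))
      where
      lem₁ : ∀ {a : ℚ} → 0ℚ ≤ a → - a ≤ 0ℚ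
      lem₁ {a} h = ≤by (δ h) (solve (a ∷ []) ring)

      lem₂ : ∀ {a b : ℚ} → 0ℚ ≤ b → a - b ≤ a
      lem₂ {a} {b} h = ≤by (δ h) (solve (a ∷ b ∷ []) ring)

    -- Summation by parts for Σ log p / (p (p + 1)), using 1/(p (p + 1)) = 1/p - 1/(p + 1). The
    -- boundary term is kept in the statement so that the induction closes; the bound 1 for the sum
    -- is what is used later.
    ∑-log-ratio : ∀ n → ∑ n (λ p → g p * (inv p * inv (suc p))) + g (suc n) * inv (suc n) ≤ 1ℚ - inv (suc n)
    ∑-log-ratio zero    = ≤-reflexive (trans (cong (λ z → 0ℚ + z * inv 1) g1) refl)
    ∑-log-ratio (suc n) = lem (∑ n (λ p → g p * (inv p * inv (suc p)))) (inv (suc n)) (inv (suc (suc n))) (g (suc n))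
      (g (suc (suc n)))
      (∑-log-ratio n) (inv≥0 (suc (suc n))) (inv-diff n) (g-step n)
      where
      lem : ∀ (s a b u v : ℚ) → s + u * a ≤ 1ℚ - a → 0ℚ ≤ b → a - b ≡ a * b → v ≤ u + a →
        s + u * (a * b) + v * b ≤ 1ℚ - b
      lem s a b u v h q e st =
        ≤by (δ h ⊞ δ (≤-reflexive (sym e)) ⊞ δ st ⊠ δ q ⊞ δ (≤-reflexive (cong (λ z → z * u) (sym e))))
          (solve (s ∷ a ∷ b ∷ u ∷ v ∷ []) ring)

-- Elementary facts on primes and prime powers.

module Primes where

  open import Data.Nat
  open import Data.Nat.Properties
  open import Data.Nat.Primality
  open import Data.Nat.Primality.Factorisation using (factorise; PrimeFactorisation)
  open import Data.Nat.Divisibility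
  open import Data.Nat.Coprimality using (Coprime)
  open import Data.Nat.ListAction using (product)
  open import Data.List using (List; []; _∷_)
  open import Data.List.Relation.Unary.All using (All; []; _∷_)

  prime≥2 : ∀ {p} → Prime p → 2 ≤ p
  prime≥2 {p} pr = nonTrivial⇒n>1 p {{prime⇒nonTrivial pr}}

  prime≥1 : ∀ {p} → Prime p → 1 ≤ p
  prime≥1 pr = ≤-trans (s≤s z≤n) (prime≥2 pr)

  prime-induction : (P : ℕ → Set) → P 1 → (∀ p k → Prime p → 1 ≤ k → P k → P (p * k)) → ∀ n → 1 ≤ n → P n
  prime-induction P P1 Pp n@(suc _) _ = subst P (sym isFactorisation) (go _ factorsPrime)
    where
    open PrimeFactorisation (factorise n)
    go : ∀ ps → All Prime ps → P (product ps)
    go []       []         = P1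
    go (p ∷ ps) (pr ∷ prs) = Pp p (product ps) pr (productOfPrimes≥1 prs) (go ps prs)

  prime-divisor : ∀ n → 2 ≤ n → Σ ℕ λ p → Prime p × p ∣ n
  prime-divisor n@(suc _) h with factorise n
  ... | record { factors = []; isFactorisation = e } = ⊥-elim (<⇒≢ h (sym e))
  ... | record { factors = p ∷ ps; isFactorisation = e; factorsPrime = pr ∷ _ } = p , pr , divides (product ps)
    (trans e (*-comm p (product ps)))

  prime∣prime : ∀ {p q} → Prime p → Prime q → p ∣ q → p ≡ q
  prime∣prime pp pq d with prime⇒irreducible pq d
  ... | inj₁ refl = ⊥-elim (¬prime[1] pp)
  ... | inj₂ e    = e

  prime∣^ : ∀ {p} a n → Prime p → p ∣ a ^ n → p ∣ a
  prime∣^ a zero    pp d = ⊥-elim (¬prime[1] (subst Prime (∣1⇒≡1 d) pp))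
  prime∣^ a (suc n) pp d with euclidsLemma a (a ^ n) pp d
  ... | inj₁ e = e
  ... | inj₂ e = prime∣^ a n pp e

  prime-∤⇒coprime : ∀ {p n} → Prime p → ¬ p ∣ n → Coprime p n
  prime-∤⇒coprime pp ∤ (d∣p , d∣n) with prime⇒irreducible pp d∣p
  ... | inj₁ e    = e
  ... | inj₂ refl = ⊥-elim (∤ d∣n)

  ^∣*-prime : ∀ {p q} i k → Prime p → Prime q → q ≢ p → q ^ i ∣ p * k → q ^ i ∣ k
  ^∣*-prime zero    k pp pq ne d = 1∣ k
  ^∣*-prime {p} {q} (suc i) k pp pq ne d with ^∣*-prime i k pp pq ne (∣-trans (n∣m*n q) d)
  ... | divides k' refl with euclidsLemma p k' pq
    (*-cancelʳ-∣ (q ^ i) {{m^n≢0 q i {{prime⇒nonZero pq}}}} (subst (q * q ^ i ∣_) (sym (*-assoc p k' (q ^ i))) d))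
  ...   | inj₁ e = ⊥-elim (ne (prime∣prime pq pp e))
  ...   | inj₂ e = *-monoˡ-∣ (q ^ i) e

  n<m^n : ∀ m n → 2 ≤ m → n < m ^ n
  n<m^n m zero    h = s≤s z≤n
  n<m^n m (suc n) h = ≤-trans (s≤s (n<m^n m n h)) (≤-trans (+-monoˡ-≤ (m ^ n) (≤-trans (s≤s z≤n) (n<m^n m n h)))
    (≤-trans (≤-reflexive (cong (m ^ n +_) (sym (+-identityʳ (m ^ n))))) (*-monoˡ-≤ (m ^ n) h)))

  1≤^ : ∀ {m} n → 1 ≤ m → 1 ≤ m ^ n
  1≤^ {suc m} n _ = m^n>0 (suc m) n

-- An exactly additive rational logarithm and its von Mangoldt function.

module Logarithms where

  open Rationals
  open Sums
  open Primes
  open Harmonic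
  open import Data.Rational
  open import Data.Rational.Properties
  open import Data.Nat.Divisibility using (_∣_; _∣?_; divides; ∣-trans; ∣⇒≤; m∣m*n; *-monoʳ-∣; *-cancelˡ-∣)
  open import Data.Nat.Primality using (Prime; prime?; prime⇒nonZero)

  -- A completely additive function with the growth of a logarithm on {1,…,Z},
  -- together with its von Mangoldt function.
  record Logarithm (Z : ℕ) : Set where
    field
      ℓ Λ    : ℕ → ℚ
      ℓ≥0    : ∀ m → 0ℚ ≤ ℓ m
      Λ≥0    : ∀ m → 0ℚ ≤ Λ m
      ℓ-*    : ∀ m n → 1 ℕ.≤ m → 1 ℕ.≤ n → m ℕ.* n ℕ.≤ Z → ℓ (m ℕ.* n) ≡ ℓ m + ℓ n
      ℓ-step : ∀ n → 1 ℕ.≤ n → suc n ℕ.≤ Z → ∣ ℓ (suc n) - ℓ n ∣ ≤ ι 2 * inv n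
      ℓ2     : inv 4 ≤ ℓ 2
      ∑-Λ    : ∀ k → 1 ℕ.≤ k → k ℕ.≤ Z → ∑ Z (λ m → 𝟙 (m ∣? k) * Λ m) ≡ ℓ k
      Λ-sparse : ∀ B (e : ℕ → ℚ) → (∀ m → 0ℚ ≤ e m) → (∀ m → e m ≤ 1ℚ) →
        (∀ p → Prime p → B ℕ.< p → p ℕ.≤ Z → e p ≡ 0ℚ) → ∑ Z (λ m → Λ m * (inv m * e m)) ≤ ι B + ι 4

  -- `g` is additive only up to 1/K, so it is kept on the primes and extended additively. At n ≤ Z
  -- this changes it by at most n/K. The bound 2Z² ≤ K keeps that change below increments of size
  -- 1/n, and 16 ≤ K leaves `ℓ 2` at least 1/4 out of `g 2` at least 1/2.
  module Construction (Z k : ℕ) (Z≥2 : 2 ℕ.≤ Z) (k≥16 : 16 ℕ.≤ suc k) (k≥2ZZ : Z ℕ.* (Z ℕ.+ Z) ℕ.≤ suc k) where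

    open ApproximateLog k

    Z≥1 : 1 ℕ.≤ Z
    Z≥1 = ℕₚ.≤-trans (s≤s z≤n) Z≥2

    Z' : ℕ
    Z' = ℕ.pred Z

    w : ℕ → ℚ
    w p = 𝟙 (prime? p) * g p

    w-prime : ∀ {p} → Prime p → w p ≡ g p
    w-prime {p} pp = trans (cong (_* g p) (𝟙-yes (prime? p) pp)) (*-identityˡ (g p))

    w-¬prime : ∀ {p} → ¬ Prime p → w p ≡ 0ℚ
    w-¬prime {p} ¬pp = trans (cong (_* g p) (𝟙-no (prime? p) ¬pp)) (*-zeroˡ (g p))

    w≥0 : ∀ p → 0ℚ ≤ w p
    w≥0 zero    = ≤-reflexive (sym (w-¬prime (λ pr → ℕₚ.<⇒≱ (s≤s z≤n) (prime≥1 pr))))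
    w≥0 (suc p) = 𝟙≥0 (prime? (suc p)) ⊠ g≥0 p

    -- The p-adic valuation for prime p and 1 ≤ k ≤ Z: since p^Z > Z, exponents up to Z suffice. For
    -- the same reason the top term that `v-same` has to supply is 0.
    v : ℕ → ℕ → ℚ
    v p k = ∑ Z (λ i → 𝟙 (p ℕ.^ i ∣? k))

    ℓ : ℕ → ℚ
    ℓ k = ∑ Z (λ p → w p * v p k)

    Λ : ℕ → ℚ
    Λ m = ∑ Z (λ p → w p * ∑ Z (λ i → 𝟙 (p ℕ.^ i ℕ.≟ m)))

    v≥0 : ∀ p k → 0ℚ ≤ v p k
    v≥0 p k = ∑≥0 Z (λ i _ _ → 𝟙≥0 (p ℕ.^ i ∣? k))

    ℓ≥0 : ∀ k → 0ℚ ≤ ℓ k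
    ℓ≥0 k = ∑≥0 Z (λ p _ _ → w≥0 p ⊠ v≥0 p k)

    Λ≥0 : ∀ m → 0ℚ ≤ Λ m
    Λ≥0 m = ∑≥0 Z (λ p _ _ → w≥0 p ⊠ ∑≥0 Z (λ i _ _ → 𝟙≥0 (p ℕ.^ i ℕ.≟ m)))

    pick : ∀ a (F : ℕ → ℚ) → 1 ℕ.≤ a → ∑ Z (λ m → 𝟙 (a ℕ.≟ m) * F m) ≡ 𝟙 (a ℕ.≤? Z) * F a
    pick a F 1≤a with a ℕ.≤? Z
    ... | yes a≤Z = trans (∑-single Z _ a 1≤a a≤Z
      (λ k ne → trans (cong (_* F k) (𝟙-no (a ℕ.≟ k) (ne ∘ sym))) (*-zeroˡ (F k))))
                          (cong (_* F a) (𝟙-yes (a ℕ.≟ a) refl))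
    ... | no  a≰Z = trans (∑-zero Z (λ k _ k≤Z → trans (cong (_* F k) (𝟙-no (a ℕ.≟ k) (λ { refl → a≰Z k≤Z })))
      (*-zeroˡ (F k))))
                          (sym (*-zeroˡ (F a)))

    Λ-sum : ∀ (F : ℕ → ℚ) → ∑ Z (λ m → Λ m * F m) ≡ ∑ Z (λ p → w p * ∑ Z (λ i → 𝟙 (p ℕ.^ i ℕ.≤? Z) * F (p ℕ.^ i)))
    Λ-sum F =
      trans (∑-ext Z (λ m → trans (sym (∑-*ʳ Z (F m) _))
        (∑-ext Z (λ p → trans (*-assoc (w p) (s p m) (F m)) (cong (w p *_) (sym (∑-*ʳ Z (F m) _)))))))
      (trans (∑-swap Z Z (λ m p → w p * ∑ Z (λ i → 𝟙 (p ℕ.^ i ℕ.≟ m) * F m)))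
      (∑-cong Z (λ p 1≤p _ → trans (∑-*ˡ Z (w p) _) (cong (w p *_)
        (trans (∑-swap Z Z (λ m i → 𝟙 (p ℕ.^ i ℕ.≟ m) * F m)) (∑-ext Z (λ i → pick (p ℕ.^ i) F (1≤^ i 1≤p))))))))
      where
      s : ℕ → ℕ → ℚ
      s p m = ∑ Z (λ i → 𝟙 (p ℕ.^ i ℕ.≟ m))

    ∑-Λ : ∀ k → 1 ℕ.≤ k → k ℕ.≤ Z → ∑ Z (λ m → 𝟙 (m ∣? k) * Λ m) ≡ ℓ k
    ∑-Λ k@(suc _) _ k≤Z = trans (∑-ext Z (λ m → *-comm (𝟙 (m ∣? k)) (Λ m))) (trans (Λ-sum (λ m → 𝟙 (m ∣? k)))
      (∑-ext Z (λ p → cong (w p *_) (∑-ext Z (λ i → drop (p ℕ.^ i))))))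
      where
      drop : ∀ a → 𝟙 (a ℕ.≤? Z) * 𝟙 (a ∣? k) ≡ 𝟙 (a ∣? k)
      drop a with a ∣? k
      ... | yes d = trans (*-identityʳ (𝟙 (a ℕ.≤? Z))) (𝟙-yes (a ℕ.≤? Z) (ℕₚ.≤-trans (∣⇒≤ d) k≤Z))
      ... | no  _ = *-zeroʳ (𝟙 (a ℕ.≤? Z))

    v-other : ∀ {p q} k → Prime p → Prime q → q ≢ p → v q (p ℕ.* k) ≡ v q k
    v-other {p} {q} k pp pq ne = ∑-ext Z (λ i → 𝟙-cong (q ℕ.^ i ∣? p ℕ.* k) (q ℕ.^ i ∣? k)
      (^∣*-prime i k pp pq ne) (λ d → ∣-trans d (divides p refl)))

    v-same : ∀ {p} k → Prime p → 1 ℕ.≤ k → k ℕ.≤ Z → v p (p ℕ.* k) ≡ v p k + 1ℚ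
    v-same {p} k@(suc _) pp _ k≤Z = trans (∑-head Z (λ i → 𝟙 (p ℕ.^ i ∣? p ℕ.* k)) Z≥1)
      (trans (cong₂ _+_ (𝟙-yes (p ℕ.^ 1 ∣? p ℕ.* k) (subst (_∣ p ℕ.* k) (sym (ℕₚ.^-identityʳ p)) (m∣m*n k)))
        (∑-ext Z' (λ i → 𝟙-cong (p ℕ.^ suc i ∣? p ℕ.* k) (p ℕ.^ i ∣? k) (*-cancelˡ-∣ p {{prime⇒nonZero pp}})
          (*-monoʳ-∣ p))))
      (trans (eq (∑ Z' (λ i → 𝟙 (p ℕ.^ i ∣? k))))
        (cong (_+ 1ℚ) (trans (cong (∑ Z' (λ i → 𝟙 (p ℕ.^ i ∣? k)) +_)
          (sym (𝟙-no (p ℕ.^ Z ∣? k) (λ d → ℕₚ.<⇒≱ (n<m^n p Z (prime≥2 pp)) (ℕₚ.≤-trans (∣⇒≤ d) k≤Z)))))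
          (sym (∑-last Z (λ i → 𝟙 (p ℕ.^ i ∣? k)) Z≥1))))))
      where
      eq : ∀ a → 1ℚ + a ≡ a + 0ℚ + 1ℚ
      eq = solve-∀ ring

    ℓ-prime : ∀ p k → Prime p → p ℕ.≤ Z → 1 ℕ.≤ k → k ℕ.≤ Z → ℓ (p ℕ.* k) ≡ ℓ k + g p
    ℓ-prime p k pp p≤Z 1≤k k≤Z = trans (∑-ext Z term)
      (trans (∑-+ Z (λ q → w q * v q k) (λ q → 𝟙 (p ℕ.≟ q) * g q))
        (cong (ℓ k +_) (trans (pick p g (prime≥1 pp))
          (trans (cong (_* g p) (𝟙-yes (p ℕ.≤? Z) p≤Z)) (*-identityˡ (g p))))))
      where
      one : ∀ w v → w * (v + 1ℚ) ≡ w * v + 1ℚ * w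
      one = solve-∀ ring

      none : ∀ w v g → w * v ≡ w * v + 0ℚ * g
      none = solve-∀ ring

      zeros : ∀ {x} a b c → x ≡ 0ℚ → x * a ≡ x * b + 0ℚ * c
      zeros a b c refl = eq a b c
        where
        eq : ∀ a b c → 0ℚ * a ≡ 0ℚ * b + 0ℚ * c
        eq = solve-∀ ring

      term : ∀ q → w q * v q (p ℕ.* k) ≡ w q * v q k + 𝟙 (p ℕ.≟ q) * g q
      term q with p ℕ.≟ q | prime? q
      ... | yes refl | yes pq = trans (cong (λ z → 1ℚ * g p * z) (v-same k pp 1≤k k≤Z))
        (trans (one (1ℚ * g p) (v p k)) (cong (λ z → 1ℚ * g p * v p k + 1ℚ * z) (*-identityˡ (g p))))
      ... | yes refl | no ¬pq = ⊥-elim (¬pq pp)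
      ... | no  ne   | yes pq = trans (cong (λ z → 1ℚ * g q * z) (v-other k pp pq (ne ∘ sym)))
        (none (1ℚ * g q) (v q k) (g q))
      ... | no  _    | no  _  = zeros (v q (p ℕ.* k)) (v q k) (g q) (*-zeroˡ (g q))

    ℓ1 : ℓ 1 ≡ 0ℚ
    ℓ1 = ∑-zero Z (λ p _ _ → term p)
      where
      term : ∀ p → w p * v p 1 ≡ 0ℚ
      term p with prime? p
      ... | no  _  = trans (cong (_* v p 1) (*-zeroˡ (g p))) (*-zeroˡ (v p 1))
      ... | yes pp = trans (cong (1ℚ * g p *_) (∑-zero Z (λ i 1≤i _ → 𝟙-no (p ℕ.^ i ∣? 1)
                       (λ d → ℕₚ.<⇒≱ (ℕₚ.≤-<-trans 1≤i (n<m^n p i (prime≥2 pp))) (∣⇒≤ d))))) (*-zeroʳ (1ℚ * g p))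

    factor≤ : ∀ {p k} → 1 ℕ.≤ k → p ℕ.* k ℕ.≤ Z → p ℕ.≤ Z
    factor≤ {p} {suc k} _ h = ℕₚ.≤-trans (ℕₚ.m≤m*n p (suc k)) h

    cofactor≤ : ∀ {p k} → 1 ℕ.≤ p → p ℕ.* k ℕ.≤ Z → k ℕ.≤ Z
    cofactor≤ {suc p} {k} _ h = ℕₚ.≤-trans (ℕₚ.m≤m+n k (p ℕ.* k)) h

    ℓ-* : ∀ m n → 1 ℕ.≤ m → 1 ℕ.≤ n → m ℕ.* n ℕ.≤ Z → ℓ (m ℕ.* n) ≡ ℓ m + ℓ n
    ℓ-* m n 1≤m 1≤n = prime-induction (λ m → m ℕ.* n ℕ.≤ Z → ℓ (m ℕ.* n) ≡ ℓ m + ℓ n)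
      (λ _ → trans (cong ℓ (ℕₚ.*-identityˡ n)) (sym (trans (cong (_+ ℓ n) ℓ1) (+-identityˡ (ℓ n)))))
      step m 1≤m
      where
      eq : ∀ a b c → a + b + c ≡ a + c + b
      eq = solve-∀ ring

      step : ∀ p k → Prime p → 1 ℕ.≤ k → (k ℕ.* n ℕ.≤ Z → ℓ (k ℕ.* n) ≡ ℓ k + ℓ n) →
             p ℕ.* k ℕ.* n ℕ.≤ Z → ℓ (p ℕ.* k ℕ.* n) ≡ ℓ (p ℕ.* k) + ℓ n
      step p k pp 1≤k ih h = trans (cong ℓ (ℕₚ.*-assoc p k n))
        (trans (ℓ-prime p (k ℕ.* n) pp p≤Z (ℕₚ.*-mono-≤ 1≤k 1≤n) kn≤Z)
        (trans (cong (_+ g p) (ih kn≤Z)) (trans (eq (ℓ k) (ℓ n) (g p))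
          (cong (_+ ℓ n) (sym (ℓ-prime p k pp p≤Z 1≤k (factor≤ 1≤n kn≤Z)))))))
        where
        h' : p ℕ.* (k ℕ.* n) ℕ.≤ Z
        h' = subst (ℕ._≤ Z) (ℕₚ.*-assoc p k n) h
        kn≤Z = cofactor≤ (prime≥1 pp) h'
        p≤Z = factor≤ (ℕₚ.*-mono-≤ 1≤k 1≤n) h'

    -- Splitting off one prime p from pk costs 1/K by `g-*`, and k + 1 ≤ pk lets the bound n/K
    -- absorb it.
    ℓ≈g : ∀ n → 1 ℕ.≤ n → n ℕ.≤ Z → ∣ ℓ n - g n ∣ ≤ ι n * inv K
    ℓ≈g = prime-induction (λ n → n ℕ.≤ Z → ∣ ℓ n - g n ∣ ≤ ι n * inv K)
      (λ _ → subst (_≤ ι 1 * inv K) (sym (cong ∣_∣ (trans (cong₂ _-_ ℓ1 g1) (+-inverseʳ 0ℚ)))) (ι≥0 1 ⊠ inv≥0 K)) step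
      where
      split : ∀ a b c d → a + b - c ≡ (a - d) - (c - d - b)
      split = solve-∀ ring

      step : ∀ p k → Prime p → 1 ℕ.≤ k → (k ℕ.≤ Z → ∣ ℓ k - g k ∣ ≤ ι k * inv K) → p ℕ.* k ℕ.≤ Z →
        ∣ ℓ (p ℕ.* k) - g (p ℕ.* k) ∣ ≤ ι (p ℕ.* k) * inv K
      step p k pp 1≤k ih h = ≤-trans (≤-reflexive (cong ∣_∣
          (trans (cong (_- g (p ℕ.* k)) (ℓ-prime p k pp (factor≤ 1≤k h) 1≤k (cofactor≤ (prime≥1 pp) h)))
            (split (ℓ k) (g p) (g (p ℕ.* k)) (g k)))))
        (≤-trans (triangle⁻ (ℓ k - g k) (g (p ℕ.* k) - g k - g p) (ih (cofactor≤ (prime≥1 pp) h))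
          (g-* p k (prime≥1 pp) 1≤k))
        (≤-trans (≤-reflexive (eq (ι k) (inv K))) (*-monoʳ (inv K) (ι-mono {suc k} {p ℕ.* k} k<pk) (inv≥0 K))))
        where
        eq : ∀ a b → a * b + b ≡ (1ℚ + a) * b
        eq = solve-∀ ring

        k<pk : k ℕ.< p ℕ.* k
        k<pk = ℕₚ.≤-trans (ℕₚ.+-monoˡ-≤ k 1≤k) (ℕₚ.≤-trans (ℕₚ.≤-reflexive (cong (k ℕ.+_) (sym (ℕₚ.+-identityʳ k))))
          (ℕₚ.*-monoˡ-≤ k (prime≥2 pp)))

    ZZ-bound : ∀ n → suc n ℕ.≤ Z → ι n * (ι (suc n) + ι n) * inv K ≤ 1ℚ
    ZZ-bound n h = subst (ι n * (ι (suc n) + ι n) * inv K ≤_) (ι-inv K (s≤s z≤n)) (*-monoʳ (inv K)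
      (subst (_≤ ι K) (trans (ι-* n (suc n ℕ.+ n)) (cong (ι n *_) (ι-+ (suc n) n))) (ι-mono bound)) (inv≥0 K))
      where
      n≤Z = ℕₚ.≤-trans (ℕₚ.n≤1+n n) h
      bound : n ℕ.* (suc n ℕ.+ n) ℕ.≤ K
      bound = ℕₚ.≤-trans (ℕₚ.*-mono-≤ n≤Z (ℕₚ.+-mono-≤ h n≤Z)) k≥2ZZ

    ℓ-step : ∀ n → 1 ℕ.≤ n → suc n ℕ.≤ Z → ∣ ℓ (suc n) - ℓ n ∣ ≤ ι 2 * inv n
    ℓ-step n@(suc m) 1≤n h = ≤-trans (≤-reflexive (cong ∣_∣ (eq (ℓ (suc n)) (g (suc n)) (g n) (ℓ n))))
      (≤-trans (triangle⁻ (ℓ (suc n) - g (suc n) + (g (suc n) - g n)) (ℓ n - g n)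
        (triangle (ℓ (suc n) - g (suc n)) (g (suc n) - g n) (ℓ≈g (suc n) (s≤s z≤n) h)
          (≤-trans (≤-reflexive (abs-nonneg (δ (g-mono n)))) (lem₁ (g-step m))))
        (ℓ≈g n 1≤n (ℕₚ.≤-trans (ℕₚ.n≤1+n n) h)))
      (lem₂ (ι (suc n)) (inv K) (inv n) (ι n)
        (≤-inv n 1≤n (≤-trans (≤-reflexive (assoc (ι n) (ι (suc n) + ι n) (inv K))) (ZZ-bound n h)))))
      where
      eq : ∀ a b c d → a - d ≡ a - b + (b - c) - (d - c)
      eq = solve-∀ ring

      assoc : ∀ a b c → a * (b * c) ≡ a * b * c
      assoc = solve-∀ ring

      lem₁ : ∀ {a b c : ℚ} → a ≤ b + c → a - b ≤ c
      lem₁ {a} {b} {c} h = ≤by (δ h) (solve (a ∷ b ∷ c ∷ []) ring)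

      lem₂ : ∀ (a i v n : ℚ) → (a + n) * i ≤ v → a * i + v + n * i ≤ ι 2 * v
      lem₂ a i v n h = ≤by (δ h) (solve (a ∷ i ∷ v ∷ n ∷ []) ring)

    inv-K : inv K ≤ inv 16
    inv-K = inv-antitone (s≤s z≤n) k≥16

    ℓ2 : inv 4 ≤ ℓ 2
    ℓ2 = lem (abs-lower (ℓ≈g 2 (s≤s z≤n) Z≥2)) g2 inv-K
      where
      lem : ∀ {l g k : ℚ} → - (ι 2 * k) ≤ l - g → inv 2 ≤ g → k ≤ inv 16 → inv 4 ≤ l
      lem {l} {g} {k} a b c = ≤by (δ a ⊞ δ b ⊞ const≥0 (ι 2) ⊠ δ c ⊞ const≥0 (inv 8)) (solve (l ∷ g ∷ k ∷ []) ring)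

    inv-suc-double : ∀ n → 1 ℕ.≤ n → inv n ≤ ι 2 * inv (suc n)
    inv-suc-double n@(suc m) 1≤n = lem (inv n) (inv (suc n)) (inv-diff m) (inv≤1 n) (inv≥0 (suc n))
      where
      lem : ∀ (a b : ℚ) → a - b ≡ a * b → a ≤ 1ℚ → 0ℚ ≤ b → a ≤ ι 2 * b
      lem a b e h k = ≤by (δ (≤-reflexive e) ⊞ δ h ⊠ δ k) (solve (a ∷ b ∷ []) ring)

    -- The tail from exponent 2 on of the series in 1/p. Carrying twice the next term makes the
    -- induction close for every ratio at most 1/2.
    geometric : ∀ p → 2 ℕ.≤ p → ∀ n →
      ∑ n (λ i → inv (p ℕ.^ suc i)) + ι 2 * inv (p ℕ.^ suc (suc n)) ≤ ι 2 * (inv p * inv p)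
    geometric p 2≤p zero    = ≤-reflexive
      (trans (+-identityˡ _) (cong (ι 2 *_)
      (trans (inv-* p (p ℕ.* 1)) (cong (λ z → inv p * inv z) (ℕₚ.*-identityʳ p)))))
    geometric p 2≤p (suc n) = lem (∑ n (λ i → inv (p ℕ.^ suc i))) (inv (p ℕ.^ suc (suc n)))
      (inv (p ℕ.^ suc (suc (suc n)))) (inv p) (geometric p 2≤p n)
        (inv-* p (p ℕ.^ suc (suc n))) (inv-antitone {2} {p} (s≤s z≤n) 2≤p) (inv≥0 (p ℕ.^ suc (suc n)))
      where
      lem : ∀ (s x y a : ℚ) → s + ι 2 * x ≤ ι 2 * (a * a) → y ≡ a * x → a ≤ inv 2 → 0ℚ ≤ x →
        s + x + ι 2 * y ≤ ι 2 * (a * a)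
      lem s x y a h e k u =
        ≤by (δ h ⊞ const≥0 (ι 2) ⊠ δ (≤-reflexive e) ⊞ const≥0 (ι 2) ⊠ δ k ⊠ δ u)
          (solve (s ∷ x ∷ y ∷ a ∷ []) ring)

    -- At exponent 1 only primes up to B contribute, each at most g p / p ≤ 1. Higher powers are not
    -- restricted by e, but Σ p^(-i) over i ≥ 2 is at most 2/p² ≤ 4/(p (p + 1)), so that
    -- `∑-log-ratio` bounds their total by 4.
    Λ-sparse : ∀ B (e : ℕ → ℚ) → (∀ m → 0ℚ ≤ e m) → (∀ m → e m ≤ 1ℚ) →
      (∀ p → Prime p → B ℕ.< p → p ℕ.≤ Z → e p ≡ 0ℚ) → ∑ Z (λ m → Λ m * (inv m * e m)) ≤ ι B + ι 4
    Λ-sparse B e e≥0 e≤1 sparse = ≤-trans (≤-reflexive (Λ-sum F)) (≤-trans (∑-mono Z term)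
      (≤-trans (≤-reflexive (trans (∑-+ Z small (λ p → ι 4 * (g p * (inv p * inv (suc p)))))
        (cong (∑ Z small +_) (∑-*ˡ Z (ι 4) _))))
      (+-mono small-sum (*-monoˡ (ι 4) {b = 1ℚ}
        (lem (∑ Z (λ p → g p * (inv p * inv (suc p)))) (g (suc Z) * inv (suc Z)) (inv (suc Z)) (∑-log-ratio Z)
        (g≥0 Z ⊠ inv≥0 (suc Z)) (inv≥0 (suc Z))) (ι≥0 4)))))
      where
      F : ℕ → ℚ
      F m = inv m * e m
      small : ℕ → ℚ
      small p = 𝟙 (p ℕ.≤? B) * 1ℚ
      lem : ∀ (s t u : ℚ) → s + t ≤ 1ℚ - u → 0ℚ ≤ t → 0ℚ ≤ u → s ≤ 1ℚ
      lem s t u h a b = ≤by (δ h ⊞ δ a ⊞ δ b) (solve (s ∷ t ∷ u ∷ []) ring)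

      small-sum : ∑ Z small ≤ ι B
      small-sum = ≤-trans (∑-monoʳ small (ℕₚ.m≤n+m Z B) (λ k → 𝟙≥0 (k ℕ.≤? B) ⊠ const≥0 1ℚ))
        (≤-reflexive (trans (∑-cut (B ℕ.+ Z) B (λ _ → 1ℚ) (ℕₚ.m≤m+n B Z)) (trans (∑-const B 1ℚ) (*-identityʳ (ι B)))))
      cut≤ : ∀ a → 𝟙 (a ℕ.≤? Z) * F a ≤ F a
      cut≤ a = *-≤1 (𝟙≤1 (a ℕ.≤? Z)) (inv≥0 a ⊠ e≥0 a)
      F≤inv : ∀ a → F a ≤ inv a
      F≤inv a = ≤-trans (*-monoˡ (inv a) (e≤1 a) (inv≥0 a)) (≤-reflexive (*-identityʳ (inv a)))
      powers : ∀ {p} → Prime p → ∑ Z (λ i → 𝟙 (p ℕ.^ i ℕ.≤? Z) * F (p ℕ.^ i)) ≤ inv p * e p + ι 2 * (inv p * inv p)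
      powers {p} pp = ≤-trans (≤-trans (∑-mono Z (λ i _ _ → cut≤ (p ℕ.^ i)))
        (≤-reflexive (∑-head Z (λ i → F (p ℕ.^ i)) Z≥1)))
        (+-mono (≤-reflexive (cong F (ℕₚ.^-identityʳ p)))
          (≤-trans (∑-mono Z' (λ i _ _ → F≤inv (p ℕ.^ suc i)))
            (lem₂ (geometric p (prime≥2 pp) Z') (const≥0 (ι 2) ⊠ inv≥0 (p ℕ.^ suc (suc Z'))))))
        where
        lem₂ : ∀ {a b c : ℚ} → a + b ≤ c → 0ℚ ≤ b → a ≤ c
        lem₂ {a} {b} {c} h k = ≤by (δ h ⊞ δ k) (solve (a ∷ b ∷ c ∷ []) ring)

      gp≤1 : ∀ p → g (suc p) * inv (suc p) ≤ 1ℚ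
      gp≤1 p = ≤-trans (*-monoʳ (inv (suc p)) (≤-trans (g≤ι p) (ι-mono (ℕₚ.n≤1+n p))) (inv≥0 (suc p)))
        (≤-reflexive (ι-inv (suc p) (s≤s z≤n)))
      term : ∀ p → 1 ℕ.≤ p → p ℕ.≤ Z →
        w p * ∑ Z (λ i → 𝟙 (p ℕ.^ i ℕ.≤? Z) * F (p ℕ.^ i)) ≤ small p + ι 4 * (g p * (inv p * inv (suc p)))
      term (suc p) _ p≤Z = helper (prime? (suc p))
        where
        q = suc p
        S = ∑ Z (λ i → 𝟙 (q ℕ.^ i ℕ.≤? Z) * F (q ℕ.^ i))
        rest≥0 : 0ℚ ≤ ι 4 * (g q * (inv q * inv (suc q)))
        rest≥0 = const≥0 (ι 4) ⊠ (g≥0 p ⊠ (inv≥0 q ⊠ inv≥0 (suc q)))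
        first : Prime q → g q * (inv q * e q) ≤ small q
        first pp with q ℕ.≤? B
        ... | yes _   = ≤-trans (*-monoˡ (g q) (F≤inv q) (g≥0 p)) (gp≤1 p)
        ... | no  q≰B = ≤-reflexive (trans (cong (λ z → g q * (inv q * z)) (sparse q pp (ℕₚ.≰⇒> q≰B) p≤Z))
          (eq (g q) (inv q)))
          where
          eq : ∀ a b → a * (b * 0ℚ) ≡ 0ℚ * 1ℚ
          eq = solve-∀ ring

        helper : Dec (Prime q) → w q * S ≤ small q + ι 4 * (g q * (inv q * inv (suc q)))
        helper (no ¬pp) = ≤-trans (≤-reflexive (trans (cong (_* S) (w-¬prime ¬pp)) (*-zeroˡ S)))
          ((𝟙≥0 (q ℕ.≤? B) ⊠ const≥0 1ℚ) ⊞ rest≥0)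
        helper (yes pp) = lem₃ (w q) (g q) S (inv q) (inv (suc q)) (inv q * e q) (small q) (w-prime pp) (powers pp)
          (inv-suc-double q (s≤s z≤n)) (inv≥0 q) (g≥0 p) (first pp)
          where
          lem₃' : ∀ (g s a b f m : ℚ) → s ≤ f + ι 2 * (a * a) → a ≤ ι 2 * b → 0ℚ ≤ a → 0ℚ ≤ g → g * f ≤ m →
            g * s ≤ m + ι 4 * (g * (a * b))
          lem₃' g s a b f m h k u v c =
            ≤by (δ c ⊞ δ v ⊠ δ h ⊞ const≥0 (ι 2) ⊠ δ v ⊠ δ u ⊠ δ k)
              (solve (g ∷ s ∷ a ∷ b ∷ f ∷ m ∷ []) ring)

          lem₃ : ∀ w g s a b f m → w ≡ g → s ≤ f + ι 2 * (a * a) → a ≤ ι 2 * b → 0ℚ ≤ a → 0ℚ ≤ g → g * f ≤ m →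
            w * s ≤ m + ι 4 * (g * (a * b))
          lem₃ w .w s a b f m refl = lem₃' w s a b f m

    logarithm : Logarithm Z
    logarithm = record { ℓ = ℓ ; Λ = Λ ; ℓ≥0 = ℓ≥0 ; Λ≥0 = Λ≥0 ; ℓ-* = ℓ-* ; ℓ-step = ℓ-step ; ℓ2 = ℓ2 ; ∑-Λ = ∑-Λ ;
      Λ-sparse = Λ-sparse }

  logarithm : ∀ Z → 2 ℕ.≤ Z → Logarithm Z
  logarithm Z h = Construction.logarithm Z (16 ℕ.+ Z ℕ.* (Z ℕ.+ Z)) h
    (ℕₚ.≤-trans (ℕₚ.m≤m+n 16 (Z ℕ.* (Z ℕ.+ Z))) (ℕₚ.n≤1+n _))
      (ℕₚ.≤-trans (ℕₚ.m≤n+m (Z ℕ.* (Z ℕ.+ Z)) 16) (ℕₚ.n≤1+n _))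

-- Möbius inversion through the sieve of Eratosthenes.

module Moebius where

  open Rationals
  open Sums
  open Primes
  open import Data.Rational
  open import Data.Rational.Properties
  open import Data.Nat.DivMod using (m*n/n≡m)
  open import Data.Nat.Divisibility using (_∣_; _∣?_; divides; ∣-trans; ∣⇒≤; ∣1⇒≡1; n∣m*n)
  open import Data.Nat.Primality using (Prime; prime?; ¬prime[1]; euclidsLemma)

  SupportedBy : ℕ → (ℕ → ℚ) → Set
  SupportedBy Z F = ∀ k → Z ℕ.< k → F k ≡ 0ℚ

  supported-multiple : ∀ {Z F} n → 1 ℕ.≤ n → SupportedBy Z F → SupportedBy Z (λ j → F (n ℕ.* j))
  supported-multiple (suc n) _ s k h = s (suc n ℕ.* k) (ℕₚ.≤-trans h (ℕₚ.m≤m+n k (n ℕ.* k)))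

  -- Stage k of the sieve of Eratosthenes: μ k n is the Möbius function
  -- restricted to those n all of whose prime factors are at most k.
  μ : ℕ → ℕ → ℚ
  μ zero    n = 𝟙 (1 ℕ.≟ n)
  μ (suc k) n = μ k n - 𝟙 (prime? (suc k)) * (𝟙 (suc k ∣? n) * μ k (n ℕ./ suc k))

  -- The indicator of having no prime factor up to k, built by the recursion that the induction in
  -- `sieve` produces.
  unsieved : ℕ → ℕ → ℚ
  unsieved zero    j = 1ℚ
  unsieved (suc k) j = unsieved k j - 𝟙 (prime? (suc k)) * (𝟙 (suc k ∣? j) * unsieved k j)

  μ-support : ∀ k {p} n → Prime p → k ℕ.< p → p ∣ n → μ k n ≡ 0ℚ
  μ-support zero    n pp _ d = 𝟙-no (1 ℕ.≟ n) (λ { refl → ¬prime[1] (subst Prime (∣1⇒≡1 d) pp) })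
  μ-support (suc k) {p} n pp h d with prime? (suc k) | suc k ∣? n
  ... | no _   | w = trans (eq (μ k n) (𝟙 w * μ k (n ℕ./ suc k))) (μ-support k n pp (ℕₚ.<-trans (ℕₚ.n<1+n k) h) d)
    where
    eq : ∀ a b → a - 0ℚ * b ≡ a
    eq = solve-∀ ring

  ... | yes _  | no _ = trans (eq (μ k n) (μ k (n ℕ./ suc k))) (μ-support k n pp (ℕₚ.<-trans (ℕₚ.n<1+n k) h) d)
    where
    eq : ∀ a b → a - 1ℚ * (0ℚ * b) ≡ a
    eq = solve-∀ ring

  ... | yes pk | yes (divides n' refl) = cong₂ (λ a b → a - 1ℚ * (1ℚ * b))
    (μ-support k n pp (ℕₚ.<-trans (ℕₚ.n<1+n k) h) d)
      (trans (cong (μ k) (m*n/n≡m n' (suc k))) (μ-support k n' pp (ℕₚ.<-trans (ℕₚ.n<1+n k) h) p∣n'))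
    where
    p∣n' : p ∣ n'
    p∣n' with euclidsLemma n' (suc k) pp d
    ... | inj₁ e = e
    ... | inj₂ e = ⊥-elim (ℕₚ.<⇒≱ h (∣⇒≤ e))

  -- When the prime `suc k` divides n, the old value is 0 by `μ-support`, so at every stage only one
  -- of the two terms is present.
  μ-bound : ∀ k n → ∣ μ k n ∣ ≤ 1ℚ
  μ-bound zero    n = ≤-trans (≤-reflexive (abs-nonneg (𝟙≥0 (1 ℕ.≟ n)))) (𝟙≤1 (1 ℕ.≟ n))
  μ-bound (suc k) n with prime? (suc k) | suc k ∣? n
  ... | no _   | w = ≤-trans (≤-reflexive (cong ∣_∣ (eq (μ k n) (𝟙 w * μ k (n ℕ./ suc k))))) (μ-bound k n)
    where
    eq : ∀ a b → a - 0ℚ * b ≡ a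
    eq = solve-∀ ring

  ... | yes _  | no _ = ≤-trans (≤-reflexive (cong ∣_∣ (eq (μ k n) (μ k (n ℕ./ suc k))))) (μ-bound k n)
    where
    eq : ∀ a b → a - 1ℚ * (0ℚ * b) ≡ a
    eq = solve-∀ ring

  ... | yes pk | yes d = ≤-trans (≤-reflexive
    (trans (cong (λ z → ∣ z - 1ℚ * (1ℚ * μ k (n ℕ./ suc k)) ∣) (μ-support k n pk (ℕₚ.n<1+n k) d))
      (trans (cong ∣_∣ (eq (μ k (n ℕ./ suc k)))) (∣-p∣≡∣p∣ _)))) (μ-bound k (n ℕ./ suc k))
    where
    eq : ∀ b → 0ℚ - 1ℚ * (1ℚ * b) ≡ - b
    eq = solve-∀ ring

  unsieved-* : ∀ k {p} j → Prime p → k ℕ.< p → unsieved k (p ℕ.* j) ≡ unsieved k j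
  unsieved-* zero    j pp h = refl
  unsieved-* (suc k) {p} j pp h with prime? (suc k)
  ... | no _   = trans (drop (unsieved k (p ℕ.* j)) (𝟙 (suc k ∣? p ℕ.* j) * unsieved k (p ℕ.* j)))
    (trans (unsieved-* k j pp (ℕₚ.<-trans (ℕₚ.n<1+n k) h))
    (sym (drop (unsieved k j) (𝟙 (suc k ∣? j) * unsieved k j))))
    where
    drop : ∀ a b → a - 0ℚ * b ≡ a
    drop = solve-∀ ring

  ... | yes pk = cong₂ (λ a b → a - 1ℚ * (b * a)) (unsieved-* k j pp (ℕₚ.<-trans (ℕₚ.n<1+n k) h))
      (𝟙-cong (suc k ∣? p ℕ.* j) (suc k ∣? j) to (λ d → ∣-trans d (n∣m*n p)))
    where
    to : suc k ∣ p ℕ.* j → suc k ∣ j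
    to d with euclidsLemma p j pk d
    ... | inj₁ e = ⊥-elim (ℕₚ.<⇒≢ h (prime∣prime pk pp e))
    ... | inj₂ e = e

  unsieved-zero : ∀ k {q} j → Prime q → q ℕ.≤ k → q ∣ j → unsieved k j ≡ 0ℚ
  unsieved-zero zero    j pq h d = ⊥-elim (ℕₚ.<⇒≱ (prime≥1 pq) h)
  unsieved-zero (suc k) {q} j pq h d with q ℕ.≟ suc k
  ... | yes refl = trans (cong₂ (λ a b → unsieved k j - a * (b * unsieved k j)) (𝟙-yes (prime? q) pq)
    (𝟙-yes (q ∣? j) d)) (eq (unsieved k j))
    where
    eq : ∀ a → a - 1ℚ * (1ℚ * a) ≡ 0ℚ
    eq = solve-∀ ring

  ... | no  ne   = trans (cong (λ z → z - 𝟙 (prime? (suc k)) * (𝟙 (suc k ∣? j) * z))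
    (unsieved-zero k j pq (ℕₚ.≤-pred (ℕₚ.≤∧≢⇒< h ne)) d)) (eq (𝟙 (prime? (suc k))) (𝟙 (suc k ∣? j)))
    where
    eq : ∀ a b → 0ℚ - a * (b * 0ℚ) ≡ 0ℚ
    eq = solve-∀ ring

  unsieved-one : ∀ k → unsieved k 1 ≡ 1ℚ
  unsieved-one zero    = refl
  unsieved-one (suc k) with prime? (suc k)
  ... | no _   = trans (eq (unsieved k 1) (𝟙 (suc k ∣? 1) * unsieved k 1)) (unsieved-one k)
    where
    eq : ∀ a b → a - 0ℚ * b ≡ a
    eq = solve-∀ ring

  ... | yes pk = trans (cong (λ z → unsieved k 1 - 1ℚ * (z * unsieved k 1))
    (𝟙-no (suc k ∣? 1) (λ d → ¬prime[1] (subst Prime (∣1⇒≡1 d) pk))))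
      (trans (eq (unsieved k 1)) (unsieved-one k))
    where
    eq : ∀ a → a - 1ℚ * (0ℚ * a) ≡ a
    eq = solve-∀ ring

  -- Stage p removes the multiples of p. The induction hypothesis is applied to F and to F (p ·),
  -- which is why F stays general, and `unsieved k` does not notice the extra factor p.
  sieve : ∀ Z → 1 ℕ.≤ Z → ∀ k (F : ℕ → ℚ) → SupportedBy Z F →
    ∑ Z (λ n → μ k n * ∑ Z (λ j → F (n ℕ.* j))) ≡ ∑ Z (λ j → unsieved k j * F j)
  sieve Z 1≤Z zero F sF = trans (∑-single Z _ 1 ℕₚ.≤-refl 1≤Z
    (λ k ne → trans (cong (_* ∑ Z (λ j → F (k ℕ.* j))) (𝟙-no (1 ℕ.≟ k) (ne ∘ sym)))
    (*-zeroˡ (∑ Z (λ j → F (k ℕ.* j))))))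
    (trans (*-identityˡ (∑ Z (λ j → F (1 ℕ.* j))))
      (∑-ext Z (λ j → trans (cong F (ℕₚ.*-identityˡ j)) (sym (*-identityˡ (F j))))))
  sieve Z 1≤Z (suc k) F sF = trans (∑-ext Z (λ n → eq (μ k n) π (𝟙 (p ∣? n)) (μ k (n ℕ./ p)) (S n)))
    (trans (∑-sub Z (λ n → μ k n * S n) (λ n → π * (𝟙 (p ∣? n) * (μ k (n ℕ./ p) * S n))))
    (trans (cong₂ _-_ (sieve Z 1≤Z k F sF) (trans (∑-*ˡ Z π (λ n → 𝟙 (p ∣? n) * (μ k (n ℕ./ p) * S n)))
      (removed (prime? p))))
    (trans (sym (∑-sub Z (λ j → unsieved k j * F j) (λ j → π * (𝟙 (p ∣? j) * (unsieved k j * F j)))))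
           (∑-ext Z (λ j → sym (eq (unsieved k j) π (𝟙 (p ∣? j)) (unsieved k j) (F j)))))))
    where
    p = suc k
    π = 𝟙 (prime? p)
    S : ℕ → ℚ
    S n = ∑ Z (λ j → F (n ℕ.* j))
    eq : ∀ m π d m' s → (m - π * (d * m')) * s ≡ m * s - π * (d * (m' * s))
    eq = solve-∀ ring

    S-support : SupportedBy Z S
    S-support n h = ∑-zero Z (λ j 1≤j _ → sF (n ℕ.* j)
      (ℕₚ.≤-trans h (subst (ℕ._≤ n ℕ.* j) (ℕₚ.*-identityʳ n) (ℕₚ.*-monoʳ-≤ n 1≤j))))
    removed : (d : Dec (Prime p)) →
      𝟙 d * ∑ Z (λ n → 𝟙 (p ∣? n) * (μ k (n ℕ./ p) * S n)) ≡ ∑ Z (λ j → 𝟙 d * (𝟙 (p ∣? j) * (unsieved k j * F j)))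
    removed (no _)   = trans (*-zeroˡ (∑ Z (λ n → 𝟙 (p ∣? n) * (μ k (n ℕ./ p) * S n))))
      (sym (∑-zero Z (λ j _ _ → *-zeroˡ (𝟙 (p ∣? j) * (unsieved k j * F j)))))
    removed (yes pp) = trans (cong (1ℚ *_)
      (trans (∑-multiples {p} Z (λ n → μ k (n ℕ./ p) * S n) (s≤s z≤n)
        (λ n h → trans (cong (μ k (n ℕ./ p) *_) (S-support n h)) (*-zeroʳ (μ k (n ℕ./ p)))))
      (trans (∑-ext Z (λ n → cong₂ _*_ (cong (μ k) (trans (cong (ℕ._/ p) (ℕₚ.*-comm p n)) (m*n/n≡m n p)))
        (∑-ext Z (λ j → cong F (ℕₚ.*-assoc p n j)))))
      (trans (sieve Z 1≤Z k (λ j → F (p ℕ.* j)) (supported-multiple p (s≤s z≤n) sF))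
      (trans (∑-ext Z (λ j → cong (_* F (p ℕ.* j)) (sym (unsieved-* k j pp (ℕₚ.n<1+n k)))))
             (sym (∑-multiples {p} Z (λ j → unsieved k j * F j) (s≤s z≤n)
               (λ j h → trans (cong (unsieved k j *_) (sF j h)) (*-zeroʳ (unsieved k j))))))))))
      (sym (∑-*ˡ Z 1ℚ (λ j → 𝟙 (p ∣? j) * (unsieved k j * F j))))

  moebius-inversion : ∀ Z → 1 ℕ.≤ Z → (F : ℕ → ℚ) → SupportedBy Z F →
    ∑ Z (λ n → μ Z n * ∑ Z (λ j → F (n ℕ.* j))) ≡ F 1
  moebius-inversion Z 1≤Z F sF = trans (sieve Z 1≤Z Z F sF)
    (trans (∑-cong Z first)
    (trans (∑-single Z _ 1 ℕₚ.≤-refl 1≤Z (λ k ne → trans (cong (_* F k) (𝟙-no (1 ℕ.≟ k) (ne ∘ sym)))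
      (*-zeroˡ (F k)))) (*-identityˡ (F 1))))
    where
    first : ∀ j → 1 ℕ.≤ j → j ℕ.≤ Z → unsieved Z j * F j ≡ 𝟙 (1 ℕ.≟ j) * F j
    first 1 _ _ = cong (_* F 1) (unsieved-one Z)
    first j@(suc (suc _)) _ h with prime-divisor j (s≤s (s≤s z≤n))
    ... | q , pq , d = cong (_* F j) (unsieved-zero Z j pq (ℕₚ.≤-trans (∣⇒≤ d) h) d)

-- Chebyshev and Mertens bounds, and averages of L(1,φ) against Λ.

module Mertens where

  open Rationals
  open Sums
  open Moebius
  open Logarithms using (Logarithm)
  open import Data.Rational
  open import Data.Rational.Properties
  open import Data.Nat as ℕ using (ℕ; zero; suc; z≤n; s≤s; ⌈_/2⌉)
  open import Data.Nat.Induction using (<-rec)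
  open import Data.Nat.DivMod using (m/n≤m; m/n*n≤m; m*n/n≡m; /-monoˡ-≤)
  open import Data.Nat.Divisibility using (_∣_; _∣?_)

  -- The junk value is quot y 0 = 0.
  quot : ℕ → ℕ → ℕ
  quot y zero    = 0
  quot y (suc m) = y ℕ./ suc m

  quot≤ : ∀ y m → quot y m ℕ.≤ y
  quot≤ y zero    = z≤n
  quot≤ y (suc m) = m/n≤m y (suc m)

  ≤quot⇒*≤ : ∀ y m j → 1 ℕ.≤ m → j ℕ.≤ quot y m → m ℕ.* j ℕ.≤ y
  ≤quot⇒*≤ y (suc m) j _ h = ℕₚ.≤-trans (ℕₚ.*-monoʳ-≤ (suc m) h)
    (ℕₚ.≤-trans (ℕₚ.≤-reflexive (ℕₚ.*-comm (suc m) (y ℕ./ suc m))) (m/n*n≤m y (suc m)))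

  *≤⇒≤quot : ∀ y m j → 1 ℕ.≤ m → m ℕ.* j ℕ.≤ y → j ℕ.≤ quot y m
  *≤⇒≤quot y (suc m) j _ h = ℕₚ.≤-trans
    (ℕₚ.≤-reflexive (sym (trans (cong (ℕ._/ suc m) (ℕₚ.*-comm (suc m) j)) (m*n/n≡m j (suc m)))))
    (/-monoˡ-≤ (suc m) h)

  <*suc-quot : ∀ y m → 1 ℕ.≤ m → y ℕ.< m ℕ.* suc (quot y m)
  <*suc-quot y m 1≤m = ℕₚ.≰⇒> (λ h → ℕₚ.<-irrefl refl (*≤⇒≤quot y m (suc (quot y m)) 1≤m h))

  quot-zero : ∀ y m → 1 ℕ.≤ m → y ℕ.< m → quot y m ≡ 0
  quot-zero y m 1≤m h = ℕₚ.n<1⇒n≡0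
    (ℕₚ.≰⇒> (λ q → ℕₚ.<⇒≱ h (subst (ℕ._≤ y) (ℕₚ.*-identityʳ m) (≤quot⇒*≤ y m 1 1≤m q))))

  -- Test C φ: the sums of φ along multiples stay bounded; this is the only way
  -- in which characters and differences of residue classes enter.
  Test : ℚ → (ℕ → ℚ) → Set
  Test C φ = ∀ m → 1 ℕ.≤ m → ∀ w → ∣ ∑ w (λ n → φ (m ℕ.* n)) ∣ ≤ C

  test-multiple : ∀ {C} φ n → 1 ℕ.≤ n → Test C φ → Test C (λ j → φ (n ℕ.* j))
  test-multiple {C} φ n 1≤n t m 1≤m w = subst (_≤ C) (cong ∣_∣ (∑-ext w (λ j → cong φ (ℕₚ.*-assoc n m j))))
    (t (n ℕ.* m) (ℕₚ.*-mono-≤ 1≤n 1≤m) w)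

  test-1 : ∀ {C} φ → Test C φ → ∀ w → ∣ ∑ w φ ∣ ≤ C
  test-1 {C} φ t w = subst (_≤ C) (cong ∣_∣ (∑-ext w (λ j → cong φ (ℕₚ.*-identityˡ j)))) (t 1 ℕₚ.≤-refl w)

  test-C≥0 : ∀ {C} φ → Test C φ → 0ℚ ≤ C
  test-C≥0 φ t = ≤-trans (0≤∣p∣ 0ℚ) (test-1 φ t 0)

  -- The partial sum of L(1,φ).
  L : ℕ → (ℕ → ℚ) → ℚ
  L X φ = ∑ X (λ j → φ j * inv j)

  L-tail : ∀ {C} φ → Test C φ → ∀ {w X} → w ℕ.≤ X → ∣ L X φ - L w φ ∣ ≤ ι 2 * C * inv (suc w)
  L-tail {C} φ t = ∑-tail C φ inv (test-1 φ t) (λ k → inv-antitone (s≤s z≤n) (ℕₚ.n≤1+n (suc k))) (λ k → inv≥0 (suc k))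

  module _ (Z : ℕ) (log : Logarithm Z) where

    open Logarithm log

    ℓ1 : 1 ℕ.≤ Z → ℓ 1 ≡ 0ℚ
    ℓ1 1≤Z = lem (ℓ 1) (ℓ-* 1 1 ℕₚ.≤-refl ℕₚ.≤-refl 1≤Z)
      where
      lem : ∀ a → a ≡ a + a → a ≡ 0ℚ
      lem a e = trans (trans (sym (+-identityʳ a))
        (trans (cong (a +_) (sym (+-inverseʳ a))) (trans (sym (+-assoc a a (- a))) (cong (_- a) (sym e)))))
        (+-inverseʳ a)

    P : ℕ → (ℕ → ℚ) → ℚ
    P y φ = ∑ y (λ m → Λ m * (inv m * φ m))

    P-ext : ∀ y {φ ψ : ℕ → ℚ} → (∀ k → φ k ≡ ψ k) → P y φ ≡ P y ψ
    P-ext y e = ∑-ext y (λ m → cong (λ z → Λ m * (inv m * z)) (e m))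

    ψ : ℕ → ℚ
    ψ y = ∑ y Λ

    ∑-ℓ : (F : ℕ → ℚ) → SupportedBy Z F → ∑ Z (λ k → ℓ k * F k) ≡ ∑ Z (λ m → Λ m * ∑ Z (λ j → F (m ℕ.* j)))
    ∑-ℓ F sF = trans (∑-cong Z (λ k 1≤k k≤Z → trans (cong (_* F k) (sym (∑-Λ k 1≤k k≤Z)))
      (sym (∑-*ʳ Z (F k) (λ m → 𝟙 (m ∣? k) * Λ m)))))
      (trans (∑-swap Z Z (λ k m → 𝟙 (m ∣? k) * Λ m * F k))
      (∑-cong Z (λ m 1≤m _ → trans (∑-ext Z (λ k → eq (𝟙 (m ∣? k)) (Λ m) (F k)))
        (trans (∑-*ˡ Z (Λ m) (λ k → 𝟙 (m ∣? k) * F k)) (cong (Λ m *_) (∑-multiples Z F 1≤m sF))))))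
      where
      eq : ∀ a b c → a * b * c ≡ b * (a * c)
      eq = solve-∀ ring

    cut : ℕ → (ℕ → ℚ) → ℕ → ℚ
    cut y f k = 𝟙 (k ℕ.≤? y) * f k

    cut-supported : ∀ {y} f → y ℕ.≤ Z → SupportedBy Z (cut y f)
    cut-supported {y} f y≤Z k h = zero-* (f k) (𝟙-no (k ℕ.≤? y) (ℕₚ.<⇒≱ (ℕₚ.≤-<-trans y≤Z h)))

    ∑-cut-multiples : ∀ {y} f m → y ℕ.≤ Z → 1 ℕ.≤ m → ∑ Z (λ j → cut y f (m ℕ.* j)) ≡ ∑ (quot y m) (λ j → f (m ℕ.* j))
    ∑-cut-multiples {y} f m y≤Z 1≤m = trans
      (∑-ext Z (λ j → cong (_* f (m ℕ.* j)) (𝟙-cong (m ℕ.* j ℕ.≤? y) (j ℕ.≤? quot y m) (*≤⇒≤quot y m j 1≤m)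
      (≤quot⇒*≤ y m j 1≤m))))
      (∑-cut Z (quot y m) (λ j → f (m ℕ.* j)) (ℕₚ.≤-trans (quot≤ y m) y≤Z))

    ∑-to-y : ∀ {y} (f : ℕ → ℚ) (T : ℕ → ℕ → ℚ) → y ℕ.≤ Z → (∀ m → T m 0 ≡ 0ℚ) →
      ∑ Z (λ m → f m * T m (quot y m)) ≡ ∑ y (λ m → f m * T m (quot y m))
    ∑-to-y {y} f T y≤Z T0 = ∑-extend _ y≤Z
      (λ m h → *-zero′ (f m) (trans (cong (T m) (quot-zero y m (ℕₚ.≤-trans (s≤s z≤n) h) h)) (T0 m)))

    ∑-ℓ-cut : ∀ {y} (f : ℕ → ℚ) → y ℕ.≤ Z → ∑ y (λ k → ℓ k * f k) ≡ ∑ y (λ m → Λ m * ∑ (quot y m) (λ j → f (m ℕ.* j)))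
    ∑-ℓ-cut {y} f y≤Z = trans (sym (trans (∑-ext Z (λ k → eq (ℓ k) (𝟙 (k ℕ.≤? y)) (f k)))
      (∑-cut Z y (λ k → ℓ k * f k) y≤Z)))
      (trans (∑-ℓ (cut y f) (cut-supported f y≤Z))
      (trans (∑-cong Z (λ m 1≤m _ → cong (Λ m *_) (∑-cut-multiples f m y≤Z 1≤m)))
             (∑-to-y Λ (λ m q → ∑ q (λ j → f (m ℕ.* j))) y≤Z (λ _ → refl))))
      where
      eq : ∀ a b c → a * (b * c) ≡ b * (a * c)
      eq = solve-∀ ring

    -- Legendre's formula for log y!.
    ∑-ℓ-floor : ∀ {y} → y ℕ.≤ Z → ∑ y ℓ ≡ ∑ y (λ m → Λ m * ι (quot y m))
    ∑-ℓ-floor {y} y≤Z = trans (∑-ext y (λ k → sym (*-identityʳ (ℓ k)))) (trans (∑-ℓ-cut (λ _ → 1ℚ) y≤Z)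
      (∑-ext y (λ m → cong (Λ m *_) (trans (∑-const (quot y m) 1ℚ) (*-identityʳ (ι (quot y m)))))))

    ∑-ℓ-gap : ∀ y → y ℕ.≤ Z → ∑ y (λ k → ∣ ℓ y - ℓ k ∣) ≤ ι 2 * ι y
    ∑-ℓ-gap zero    _ = const≥0 (ι 2) ⊠ ≤-refl
    ∑-ℓ-gap 1       _ = ≤-trans (≤-reflexive (cong (λ z → 0ℚ + ∣ z ∣) (+-inverseʳ (ℓ 1)))) (const≥0 (ι 2 * ι 1))
    ∑-ℓ-gap (suc y@(suc _)) h = ≤-trans
      (+-mono (≤-trans (∑-mono y (λ k _ _ → ≤-trans (≤-reflexive (cong ∣_∣ (split (ℓ (suc y)) (ℓ y) (ℓ k))))
        (triangle (ℓ y - ℓ k) (ℓ (suc y) - ℓ y) ≤-refl (ℓ-step y (s≤s z≤n) h))))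
        (≤-reflexive (trans (∑-+ y (λ k → ∣ ℓ y - ℓ k ∣) (λ _ → ι 2 * inv y))
          (cong (∑ y (λ k → ∣ ℓ y - ℓ k ∣) +_) (∑-const y (ι 2 * inv y))))))
        (≤-reflexive (cong ∣_∣ (+-inverseʳ (ℓ (suc y))))))
      (lem (∑ y (λ k → ∣ ℓ y - ℓ k ∣)) (ι y) (inv y) (∑-ℓ-gap y (ℕₚ.≤-trans (ℕₚ.n≤1+n y) h)) (ι-inv y (s≤s z≤n)))
      where
      split : ∀ a b c → a - c ≡ b - c + (a - b)
      split = solve-∀ ring

      lem : ∀ (s n v : ℚ) → s ≤ ι 2 * n → n * v ≡ 1ℚ → s + n * (ι 2 * v) + 0ℚ ≤ ι 2 * (1ℚ + n)
      lem s n v h e = ≤by (δ h ⊞ const≥0 (ι 2) ⊠ δ (≤-reflexive e)) (solve (s ∷ n ∷ v ∷ []) ring)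

    ∑-ℓ≈ : ∀ y → y ℕ.≤ Z → ∣ ι y * ℓ y - ∑ y ℓ ∣ ≤ ι 2 * ι y
    ∑-ℓ≈ y h = ≤-trans (≤-reflexive
      (cong ∣_∣ (sym (trans (∑-sub y (λ _ → ℓ y) ℓ) (cong (_- ∑ y ℓ) (∑-const y (ℓ y)))))))
      (≤-trans (∑-abs y (λ k → ℓ y - ℓ k)) (∑-ℓ-gap y h))

    -- Stands in for Stirling's formula: an even factor 2c of (2h)! contributes ℓ 2 + ℓ c, the odd
    -- factor before it at most 2 more, and ℓ 2 ≤ 2. Each step thus costs 2 · 2 + 2 = 6.
    ∑-ℓ-doubling : ∀ h → h ℕ.+ h ℕ.≤ Z → ∑ (h ℕ.+ h) ℓ ≤ ι 2 * ∑ h ℓ + ι 6 * ι h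
    ∑-ℓ-doubling zero    _ = const≥0 (ι 2 * 0ℚ + ι 6 * ι 0)
    ∑-ℓ-doubling (suc h) q = subst (λ z → ∑ z ℓ ≤ ι 2 * (∑ h ℓ + ℓ (suc h)) + ι 6 * (1ℚ + ι h)) (sym 2h)
        (lem (∑ (h ℕ.+ h) ℓ) (∑ h ℓ) (ℓ (suc (h ℕ.+ h))) (ℓ (suc (suc (h ℕ.+ h)))) (ℓ (suc h)) (ℓ 2) (ι h)
          (inv (suc (h ℕ.+ h)))
          (∑-ℓ-doubling h (ℕₚ.≤-trans (ℕₚ.≤-trans (ℕₚ.n≤1+n _) (ℕₚ.n≤1+n _)) q'))
          (trans (cong ℓ (sym double)) (ℓ-* 2 (suc h) (s≤s z≤n) (s≤s z≤n) (subst (ℕ._≤ Z) (sym double) q')))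
          (abs-lower (ℓ-step (suc (h ℕ.+ h)) (s≤s z≤n) q')) (inv≤1 (suc (h ℕ.+ h)))
          (abs-upper (ℓ-step 1 ℕₚ.≤-refl 2≤Z)) (ℓ1 (ℕₚ.≤-trans (s≤s z≤n) 2≤Z)))
      where
      2h : suc h ℕ.+ suc h ≡ suc (suc (h ℕ.+ h))
      2h = cong suc (ℕₚ.+-suc h h)
      double : 2 ℕ.* suc h ≡ suc (suc (h ℕ.+ h))
      double = trans (cong (suc h ℕ.+_) (ℕₚ.+-identityʳ (suc h))) 2h
      q' = subst (ℕ._≤ Z) 2h q
      2≤Z : 2 ℕ.≤ Z
      2≤Z = ℕₚ.≤-trans (s≤s (s≤s z≤n)) q'
      lem : ∀ S T a b c d n v → S ≤ ι 2 * T + ι 6 * n → b ≡ d + c → - (ι 2 * v) ≤ b - a → v ≤ 1ℚ →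
        d - ℓ 1 ≤ ι 2 * inv 1 → ℓ 1 ≡ 0ℚ →
        S + a + b ≤ ι 2 * (T + c) + ι 6 * (1ℚ + n)
      lem S T a b c d n v h₁ h₂ h₃ h₄ h₅ h₆ = lem' S T a b c d n v h₁ h₂ h₃ h₄
        (subst (λ z → d - z ≤ ι 2 * inv 1) h₆ h₅)
        where
        lem' : ∀ (S T a b c d n v : ℚ) → S ≤ ι 2 * T + ι 6 * n → b ≡ d + c → - (ι 2 * v) ≤ b - a → v ≤ 1ℚ →
          d - 0ℚ ≤ ι 2 * inv 1 → S + a + b ≤ ι 2 * (T + c) + ι 6 * (1ℚ + n)
        lem' S T a b c d n v h e k u w =
          ≤by (δ h ⊞ const≥0 (ι 2) ⊠ δ (≤-reflexive e) ⊞ δ k ⊞ const≥0 (ι 2) ⊠ δ u ⊞ const≥0 (ι 2) ⊠ δ w)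
            (solve (S ∷ T ∷ a ∷ b ∷ c ∷ d ∷ n ∷ v ∷ []) ring)

    -- Chebyshev's argument: ⌊2h/m⌋ - 2⌊h/m⌋ is never negative and is at least 1 for h < m ≤ 2h, so
    -- the sum of Λ over (h, 2h] is at most log (2h)! - 2 log h!.
    ψ-doubling : ∀ h → h ℕ.+ h ℕ.≤ Z → ψ (h ℕ.+ h) ≤ ψ h + ι 6 * ι h
    ψ-doubling h q = lem {b = ∑ h ℓ} (∑-ℓ-doubling h q)
      (subst₂ (λ a b → ψ (h ℕ.+ h) - ψ h ≤ a - b) (sym (∑-ℓ-floor q))
        (trans (∑-*ˡ (h ℕ.+ h) (ι 2) (λ m → Λ m * ι (quot h m)))
          (cong (ι 2 *_) (sym (trans (∑-ℓ-floor h≤Z) (sym (∑-extend _ (ℕₚ.m≤m+n h h)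
          (λ m r → *-zero′ (Λ m) (cong ι (quot-zero h m (ℕₚ.≤-trans (s≤s z≤n) r) r)))))))))
        (subst₂ _≤_ (trans (∑-sub (h ℕ.+ h) Λ (λ m → 𝟙 (m ℕ.≤? h) * Λ m))
          (cong (λ z → ψ (h ℕ.+ h) - z) (∑-cut (h ℕ.+ h) h Λ (ℕₚ.m≤m+n h h))))
          (∑-sub (h ℕ.+ h) (λ m → Λ m * ι (quot (h ℕ.+ h) m)) (λ m → ι 2 * (Λ m * ι (quot h m))))
          (∑-mono (h ℕ.+ h) term)))
      where
      h≤Z = ℕₚ.≤-trans (ℕₚ.m≤m+n h h) q
      lem : ∀ {a b c d n : ℚ} → a ≤ ι 2 * b + n → c - d ≤ a - ι 2 * b → c ≤ d + n
      lem {a} {b} {c} {d} {n} h k = ≤by (δ h ⊞ δ k) (solve (a ∷ b ∷ c ∷ d ∷ n ∷ []) ring)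

      lem₁ : ∀ (l a b : ℚ) → 0ℚ ≤ l → b + b ≤ a → l - 1ℚ * l ≤ l * a - ι 2 * (l * b)
      lem₁ l a b u h = ≤by (δ u ⊠ δ h) (solve (l ∷ a ∷ b ∷ []) ring)

      lem₂ : ∀ (l a b : ℚ) → 0ℚ ≤ l → 1ℚ ≤ a → b ≤ 0ℚ → l - 0ℚ * l ≤ l * a - ι 2 * (l * b)
      lem₂ l a b u h k = ≤by (δ u ⊠ δ h ⊞ const≥0 (ι 2) ⊠ δ u ⊠ δ k) (solve (l ∷ a ∷ b ∷ []) ring)

      term : ∀ m → 1 ℕ.≤ m → m ℕ.≤ h ℕ.+ h →
        Λ m - 𝟙 (m ℕ.≤? h) * Λ m ≤ Λ m * ι (quot (h ℕ.+ h) m) - ι 2 * (Λ m * ι (quot h m))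
      term m 1≤m m≤2h with m ℕ.≤? h
      ... | yes m≤h = lem₁ (Λ m) (ι (quot (h ℕ.+ h) m)) (ι (quot h m)) (Λ≥0 m)
        (subst (_≤ ι (quot (h ℕ.+ h) m)) (ι-+ (quot h m) (quot h m))
          (ι-mono (*≤⇒≤quot (h ℕ.+ h) m (quot h m ℕ.+ quot h m) 1≤m
            (ℕₚ.≤-trans (ℕₚ.≤-reflexive (ℕₚ.*-distribˡ-+ m (quot h m) (quot h m)))
            (ℕₚ.+-mono-≤ (≤quot⇒*≤ h m (quot h m) 1≤m ℕₚ.≤-refl) (≤quot⇒*≤ h m (quot h m) 1≤m ℕₚ.≤-refl))))))
      ... | no  m≰h = lem₂ (Λ m) (ι (quot (h ℕ.+ h) m)) (ι (quot h m)) (Λ≥0 m)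
          (ι-mono {1} (*≤⇒≤quot (h ℕ.+ h) m 1 1≤m (ℕₚ.≤-trans (ℕₚ.≤-reflexive (ℕₚ.*-identityʳ m)) m≤2h)))
          (≤-reflexive (cong ι (quot-zero h m 1≤m (ℕₚ.≰⇒> m≰h))))

    -- Rounding y/2 up to c gives y ≤ 2c ≤ y + 1, which is why y must stay strictly below Z. From y
    -- = 2 on, 4c ≤ 3y turns 18c + 6c into 18y.
    chebyshev : ∀ y → y ℕ.< Z → ψ y ≤ ι 18 * ι y
    chebyshev = <-rec (λ y → y ℕ.< Z → ψ y ≤ ι 18 * ι y) step
      where
      step : ∀ y → (∀ {z} → z ℕ.< y → z ℕ.< Z → ψ z ≤ ι 18 * ι z) → y ℕ.< Z → ψ y ≤ ι 18 * ι y
      step 0 _ _ = const≥0 (ι 18 * 0ℚ)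
      step 1 _ h = ≤-trans (≤-reflexive (+-identityˡ (Λ 1))) (≤-trans (≤-trans (≤-reflexive (sym (*-identityˡ (Λ 1))))
        (≤-trans (∑-term Z (λ m → 𝟙 (m ∣? 1) * Λ m) 1 ℕₚ.≤-refl 1≤Z (λ m → 𝟙≥0 (m ∣? 1) ⊠ Λ≥0 m))
        (≤-reflexive (trans (∑-Λ 1 ℕₚ.≤-refl 1≤Z) (ℓ1 1≤Z))))) (const≥0 (ι 18 * ι 1)))
        where 1≤Z = ℕₚ.≤-trans (s≤s z≤n) h
      step y@(suc (suc x)) ih y<Z = ≤-trans (∑-monoʳ Λ y≤2c Λ≥0)
        (lem {q = ψ c} {n = ι y} {c = ι c} (ψ-doubling c 2c≤Z) (ih c<y (ℕₚ.<-trans c<y y<Z)) bound)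
        where
        c = ⌈ y /2⌉
        c<y : c ℕ.< y
        c<y = ℕₚ.⌈n/2⌉<n x
        y≤2c : y ℕ.≤ c ℕ.+ c
        y≤2c = subst (ℕ._≤ c ℕ.+ c) (ℕₚ.⌊n/2⌋+⌈n/2⌉≡n y) (ℕₚ.+-monoˡ-≤ c (ℕₚ.⌊n/2⌋≤⌈n/2⌉ y))
        2c≤suc : c ℕ.+ c ℕ.≤ suc y
        2c≤suc = subst (c ℕ.+ c ℕ.≤_) (ℕₚ.⌊n/2⌋+⌈n/2⌉≡n (suc y)) (ℕₚ.+-monoʳ-≤ c (ℕₚ.⌊n/2⌋≤⌈n/2⌉ (suc y)))
        2c≤Z : c ℕ.+ c ℕ.≤ Z
        2c≤Z = ℕₚ.≤-trans 2c≤suc y<Z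
        bound : ι 4 * ι c ≤ ι 3 * ι y
        bound = lem₀ {a = ι c} {b = ι x}
          (subst (_≤ ι 3 + ι x) (ι-+ c c) (subst (ι (c ℕ.+ c) ≤_) (ι-+ 3 x) (ι-mono 2c≤suc))) (ι≥0 x)
          where
          lem₀ : ∀ {a b : ℚ} → a + a ≤ ι 3 + b → 0ℚ ≤ b → ι 4 * a ≤ ι 3 * (1ℚ + (1ℚ + b))
          lem₀ {a} {b} h k = ≤by (const≥0 (ι 2) ⊠ δ h ⊞ δ k) (solve (a ∷ b ∷ []) ring)

        lem : ∀ {p q n c : ℚ} → p ≤ q + ι 6 * c → q ≤ ι 18 * c → ι 4 * c ≤ ι 3 * n → p ≤ ι 18 * n
        lem {p} {q} {n} {c} h k u = ≤by (δ h ⊞ δ k ⊞ const≥0 (ι 6) ⊠ δ u) (solve (p ∷ q ∷ n ∷ c ∷ []) ring)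

    -- 20 = 18 + 2: replacing y/m by its integer part costs ψ y ≤ 18y, and log y! is within 2y of y
    -- log y.
    mertens-upper : ∀ y → 1 ℕ.≤ y → y ℕ.< Z → P y (λ _ → 1ℚ) ≤ ℓ y + ι 20
    mertens-upper y@(suc y') 1≤y h = *-cancelˡ (ι y) (ι-pos y') (lem (ι y) (P y (λ _ → 1ℚ)) (ℓ y) (∑ y ℓ) (ψ y)
        (subst₂ _≤_ (∑-*ˡ y (ι y) (λ m → Λ m * (inv m * 1ℚ)))
          (trans (∑-+ y (λ m → Λ m * ι (quot y m)) Λ) (cong (_+ ψ y) (sym (∑-ℓ-floor (ℕₚ.<⇒≤ h)))))
          (∑-mono y (λ m 1≤m _ → term m 1≤m)))
        (chebyshev y h) (abs-lower (∑-ℓ≈ y (ℕₚ.<⇒≤ h))))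
      where
      lem : ∀ (n p l s t : ℚ) → n * p ≤ s + t → t ≤ ι 18 * n → - (ι 2 * n) ≤ n * l - s → n * p ≤ n * (l + ι 20)
      lem n p l s t h k u = ≤by (δ h ⊞ δ k ⊞ δ u) (solve (n ∷ p ∷ l ∷ s ∷ t ∷ []) ring)

      lem₁ : ∀ (n l v m q : ℚ) → m * v ≡ 1ℚ → 0ℚ ≤ l → 0ℚ ≤ v → n ≤ m * (1ℚ + q) → n * (l * (v * 1ℚ)) ≤ l * q + l
      lem₁ n l v m q e a b h =
        ≤by (δ a ⊠ δ b ⊠ δ h ⊞ δ (≤-reflexive (cong (λ z → z * ((l * q + l))) e)))
          (solve (n ∷ l ∷ v ∷ m ∷ q ∷ []) ring)

      term : ∀ m → 1 ℕ.≤ m → ι y * (Λ m * (inv m * 1ℚ)) ≤ Λ m * ι (quot y m) + Λ m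
      term m 1≤m = lem₁ (ι y) (Λ m) (inv m) (ι m) (ι (quot y m)) (ι-inv m 1≤m) (Λ≥0 m) (inv≥0 m)
        (subst (ι y ≤_) (ι-* m (suc (quot y m))) (ι-mono (ℕₚ.<⇒≤ (<*suc-quot y m 1≤m))))

    mertens-lower : ∀ y → 1 ℕ.≤ y → y ℕ.≤ Z → ℓ y - ι 2 ≤ P y (λ _ → 1ℚ)
    mertens-lower y@(suc y') 1≤y h = *-cancelˡ (ι y) (ι-pos y') (lem (ι y) (P y (λ _ → 1ℚ)) (ℓ y) (∑ y ℓ)
        (subst₂ _≤_ (sym (∑-ℓ-floor h)) (∑-*ˡ y (ι y) (λ m → Λ m * (inv m * 1ℚ))) (∑-mono y (λ m 1≤m _ → term m 1≤m)))
        (abs-upper (∑-ℓ≈ y h)))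
      where
      lem : ∀ (n p l s : ℚ) → s ≤ n * p → n * l - s ≤ ι 2 * n → n * (l - ι 2) ≤ n * p
      lem n p l s h k = ≤by (δ h ⊞ δ k) (solve (n ∷ p ∷ l ∷ s ∷ []) ring)

      lem₁ : ∀ (n l v m q : ℚ) → m * v ≡ 1ℚ → 0ℚ ≤ l → 0ℚ ≤ v → m * q ≤ n → l * q ≤ n * (l * (v * 1ℚ))
      lem₁ n l v m q e a b h =
        ≤by (δ a ⊠ δ b ⊠ δ h ⊞ δ (≤-reflexive (cong (λ z → z * ((l * q))) (sym e))))
          (solve (n ∷ l ∷ v ∷ m ∷ q ∷ []) ring)

      term : ∀ m → 1 ℕ.≤ m → Λ m * ι (quot y m) ≤ ι y * (Λ m * (inv m * 1ℚ))
      term m 1≤m = lem₁ (ι y) (Λ m) (inv m) (ι m) (ι (quot y m)) (ι-inv m 1≤m) (Λ≥0 m) (inv≥0 m)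
        (subst (_≤ ι y) (ι-* m (quot y m)) (ι-mono (≤quot⇒*≤ y m (quot y m) 1≤m ℕₚ.≤-refl)))

    ∑-inv-consecutive : ∀ n → ∑ n (λ k → inv k * inv (suc k)) ≡ 1ℚ - inv (suc n)
    ∑-inv-consecutive zero    = refl
    ∑-inv-consecutive (suc n) = trans (cong₂ _+_ (∑-inv-consecutive n) (sym (inv-diff n)))
      (eq (inv (suc n)) (inv (suc (suc n))))
      where
      eq : ∀ a b → 1ℚ - a + (a - b) ≡ 1ℚ - b
      eq = solve-∀ ring

    ∑-ℓ-ratio : ∀ n → suc n ℕ.≤ Z →
      ∑ n (λ k → ℓ k * (inv k * inv (suc k))) + ℓ (suc n) * inv (suc n) ≤ ι 2 - ι 2 * inv (suc n)
    ∑-ℓ-ratio zero    h = ≤-reflexive (cong (λ z → 0ℚ + z * inv 1) (ℓ1 h))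
    ∑-ℓ-ratio (suc n) h = lem (∑ n (λ k → ℓ k * (inv k * inv (suc k)))) (inv (suc n)) (inv (suc (suc n))) (ℓ (suc n))
      (ℓ (suc (suc n)))
        (∑-ℓ-ratio n (ℕₚ.≤-trans (ℕₚ.n≤1+n (suc n)) h)) (inv≥0 (suc (suc n))) (inv-diff n)
          (abs-upper (ℓ-step (suc n) (s≤s z≤n) h))
      where
      lem : ∀ (s a b u v : ℚ) → s + u * a ≤ ι 2 - ι 2 * a → 0ℚ ≤ b → a - b ≡ a * b → v - u ≤ ι 2 * a →
        s + u * (a * b) + v * b ≤ ι 2 - ι 2 * b
      lem s a b u v h q e st =
        ≤by (δ h ⊞ const≥0 (ι 2) ⊠ δ (≤-reflexive (sym e)) ⊞ δ st ⊠ δ q ⊞ δ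
          (≤-reflexive (cong (λ z → z * u) (sym e))))
          (solve (s ∷ a ∷ b ∷ u ∷ v ∷ []) ring)

    -- Partial summation against ℓ k / k. Monotonicity of this quotient is not at hand, so its
    -- variation is bounded directly; together with the boundary term it is at most 4.
    ∑-ℓ-test : ∀ {C} φ → Test C φ → ∀ y → y ℕ.≤ Z → ∣ ∑ y (λ k → ℓ k * (φ k * inv k)) ∣ ≤ ι 4 * C
    ∑-ℓ-test {C} φ t zero    _ = const≥0 (ι 4) ⊠ test-C≥0 φ t
    ∑-ℓ-test {C} φ t (suc n) h = ≤-trans (≤-reflexive (cong ∣_∣ (∑-ext (suc n) (λ k → eq (ℓ k) (φ k) (inv k)))))
      (≤-trans (∑-by-parts C φ b (test-1 φ t) n)
        (≤-trans (*-monoˡ C total (test-C≥0 φ t)) (≤-reflexive (*-comm C (ι 4)))))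
      where
      eq : ∀ a b c → a * (b * c) ≡ b * (a * c)
      eq = solve-∀ ring

      b : ℕ → ℚ
      b k = ℓ k * inv k
      split : ∀ x y u v → x * u - y * v ≡ x * (u - v) - (y - x) * v
      split = solve-∀ ring

      shape : ∀ x u v → x * (u * v) + ι 2 * u * v ≡ x * (u * v) + ι 2 * (u * v)
      shape = solve-∀ ring

      jump : ∀ k → 1 ℕ.≤ k → k ℕ.≤ n → ∣ b k - b (suc k) ∣ ≤ ℓ k * (inv k * inv (suc k)) + ι 2 * (inv k * inv (suc k))
      jump k@(suc k') _ k≤n = ≤-trans (≤-reflexive (cong ∣_∣ (split (ℓ k) (ℓ (suc k)) (inv k) (inv (suc k)))))
        (≤-trans (triangle⁻ (ℓ k * (inv k - inv (suc k))) ((ℓ (suc k) - ℓ k) * inv (suc k))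
          (≤-reflexive (trans (abs-nonneg (ℓ≥0 k ⊠ subst (0ℚ ≤_) (sym (inv-diff k')) (inv≥0 k ⊠ inv≥0 (suc k))))
            (cong (ℓ k *_) (inv-diff k'))))
          (abs-* (ℓ (suc k) - ℓ k) (inv (suc k)) (ℓ-step k (s≤s z≤n) (ℕₚ.≤-trans (s≤s k≤n) h))
            (≤-reflexive (abs-nonneg (inv≥0 (suc k))))))
        (≤-reflexive (shape (ℓ k) (inv k) (inv (suc k)))))
      total : ∣ b (suc n) ∣ + ∑ n (λ k → ∣ b k - b (suc k) ∣) ≤ ι 4
      total = ≤-trans (+-mono (≤-reflexive (abs-nonneg (ℓ≥0 (suc n) ⊠ inv≥0 (suc n))))
          (≤-trans (∑-mono n jump) (≤-reflexive
            (trans (∑-+ n (λ k → ℓ k * (inv k * inv (suc k))) (λ k → ι 2 * (inv k * inv (suc k))))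
            (cong (∑ n (λ k → ℓ k * (inv k * inv (suc k))) +_)
              (trans (∑-*ˡ n (ι 2) (λ k → inv k * inv (suc k))) (cong (ι 2 *_) (∑-inv-consecutive n))))))))
        (lem (b (suc n)) (∑ n (λ k → ℓ k * (inv k * inv (suc k)))) (inv (suc n)) (∑-ℓ-ratio n h) (inv≥0 (suc n)))
        where
        lem : ∀ (x s a : ℚ) → s + x ≤ ι 2 - ι 2 * a → 0ℚ ≤ a → x + (s + ι 2 * (1ℚ - a)) ≤ ι 4
        lem x s a h k = ≤by (δ h ⊞ const≥0 (ι 4) ⊠ δ k) (solve (x ∷ s ∷ a ∷ []) ring)

    inv-quot : ∀ y m → 1 ℕ.≤ y → 1 ℕ.≤ m → inv m * inv (suc (quot y m)) ≤ inv y
    inv-quot y m 1≤y 1≤m = subst (_≤ inv y) (inv-* m (suc (quot y m)))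
      (inv-antitone 1≤y (ℕₚ.<⇒≤ (<*suc-quot y m 1≤m)))

    -- The tail beyond y/m is of order m/y, and the factor 1/m makes the error uniform in m.
    L-truncation : ∀ {C} φ → Test C φ → ∀ {y X} → 1 ℕ.≤ y → y ℕ.≤ X → ∀ m → 1 ℕ.≤ m →
      ∣ inv m * (L X (λ j → φ (m ℕ.* j)) - L (quot y m) (λ j → φ (m ℕ.* j))) ∣ ≤ ι 2 * C * inv y
    L-truncation {C} φ t {y} {X} 1≤y y≤X m 1≤m = ≤-trans
      (abs-* (inv m) (L X (λ j → φ (m ℕ.* j)) - L (quot y m) (λ j → φ (m ℕ.* j)))
        (≤-reflexive (abs-nonneg (inv≥0 m)))
        (L-tail (λ j → φ (m ℕ.* j)) (test-multiple φ m 1≤m t) (ℕₚ.≤-trans (quot≤ y m) y≤X)))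
      (≤-trans (≤-reflexive (eq (inv m) (ι 2 * C) (inv (suc (quot y m)))))
        (*-monoˡ (ι 2 * C) (inv-quot y m 1≤y 1≤m) (const≥0 (ι 2) ⊠ test-C≥0 φ t)))
      where
      eq : ∀ a b c → a * (b * c) ≡ b * (a * c)
      eq = solve-∀ ring

    -- Truncating the inner sum at y/m turns the average into Σ ℓ(k) φ(k)/k over k ≤ y, which is at
    -- most 4C. The truncation errors add up to ψ y · 2C/y ≤ 36C.
    Λ-L-bound : ∀ {C} φ → Test C φ → ∀ {y X} → 1 ℕ.≤ y → y ℕ.< Z → y ℕ.≤ X →
      ∣ P y (λ m → L X (λ j → φ (m ℕ.* j))) ∣ ≤ ι 40 * C
    Λ-L-bound {C} φ t {y} {X} 1≤y y<Z y≤X = ≤-trans (≤-reflexive (cong ∣_∣ decompose))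
      (≤-trans (triangle (∑ y (λ k → ℓ k * (φ k * inv k))) (∑ y (λ m → Λ m * D m)) (∑-ℓ-test φ t y (ℕₚ.<⇒≤ y<Z))
        (≤-trans (∑-abs y (λ m → Λ m * D m))
          (∑-mono y (λ m 1≤m _ → abs-* (Λ m) (D m) (≤-reflexive (abs-nonneg (Λ≥0 m)))
          (L-truncation φ t 1≤y y≤X m 1≤m)))))
      (lem C (ι y) (inv y) (∑ y (λ m → Λ m * (ι 2 * C * inv y))) (ψ y) (∑-*ʳ y (ι 2 * C * inv y) Λ) (chebyshev y y<Z)
        (ι-inv y 1≤y) (test-C≥0 φ t) (inv≥0 y)))
      where
      D : ℕ → ℚ
      D m = inv m * (L X (λ j → φ (m ℕ.* j)) - L (quot y m) (λ j → φ (m ℕ.* j)))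
      eq₁ : ∀ a v x y → a * (v * x) ≡ a * (v * y) + a * (v * (x - y))
      eq₁ = solve-∀ ring

      eq₂ : ∀ a b c → a * (b * c) ≡ b * (a * c)
      eq₂ = solve-∀ ring

      decompose : P y (λ m → L X (λ j → φ (m ℕ.* j))) ≡ ∑ y (λ k → ℓ k * (φ k * inv k)) + ∑ y (λ m → Λ m * D m)
      decompose = trans (∑-ext y (λ m → eq₁ (Λ m) (inv m) (L X (λ j → φ (m ℕ.* j)))
        (L (quot y m) (λ j → φ (m ℕ.* j)))))
        (trans (∑-+ y (λ m → Λ m * (inv m * L (quot y m) (λ j → φ (m ℕ.* j)))) (λ m → Λ m * D m))
          (cong (_+ ∑ y (λ m → Λ m * D m)) (sym (trans (∑-ℓ-cut (λ k → φ k * inv k) (ℕₚ.<⇒≤ y<Z))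
            (∑-ext y (λ m → cong (Λ m *_) (trans
              (∑-ext (quot y m) (λ j → trans (cong (φ (m ℕ.* j) *_) (inv-* m j)) (eq₂ (φ (m ℕ.* j)) (inv m) (inv j))))
              (∑-*ˡ (quot y m) (inv m) (λ j → φ (m ℕ.* j) * inv j)))))))))
      lem : ∀ (C n v s p : ℚ) → s ≡ p * (ι 2 * C * v) → p ≤ ι 18 * n → n * v ≡ 1ℚ → 0ℚ ≤ C → 0ℚ ≤ v →
        ι 4 * C + s ≤ ι 40 * C
      lem C n v s p e h u a b =
        ≤by (δ (≤-reflexive e) ⊞ const≥0 (ι 2) ⊠ δ h ⊠ δ a ⊠ δ b ⊞ const≥0 (ι 36) ⊠ δ
          (≤-reflexive (cong (λ z → z * C) u)))
          (solve (C ∷ n ∷ v ∷ s ∷ p ∷ []) ring)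

-- The correlation of prime sums at two scales.

module Correlation where

  open Rationals
  open Sums
  open Moebius
  open Logarithms using (Logarithm)
  open Mertens
  open import Data.Rational
  open import Data.Rational.Properties

  module _ (Z : ℕ) (log : Logarithm Z) where

    open Logarithm log

    -- Since ℓ(nj) = ℓ n + ℓ j and Σ_j ℓ(j) F(nj) = Σ_m Λ(m) Σ_j F(nmj), the function
    -- ℓ n Σ_j F(nj) is itself of the form Σ_j F'(nj), so Möbius inversion applies to it.
    moebius-log : 1 ℕ.≤ Z → (F : ℕ → ℚ) → SupportedBy Z F →
      ∑ Z (λ n → μ Z n * (ℓ n * ∑ Z (λ j → F (n ℕ.* j)))) ≡ - ∑ Z (λ m → Λ m * F m)
    moebius-log 1≤Z F sF = trans (∑-cong Z (λ n 1≤n _ → cong (μ Z n *_) (sym (shape n 1≤n))))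
      (trans (moebius-inversion Z 1≤Z F' sF')
      (trans (cong₂ (λ a b → a * F 1 - b) (ℓ1 Z log 1≤Z) (∑-ext Z (λ m → cong (λ z → Λ m * F z) (ℕₚ.*-identityˡ m))))
        (eq (F 1) (∑ Z (λ m → Λ m * F m)))))
      where
      eq : ∀ a b → 0ℚ * a - b ≡ - b
      eq = solve-∀ ring

      G F' : ℕ → ℚ
      G n = ∑ Z (λ m → Λ m * F (n ℕ.* m))
      F' n = ℓ n * F n - G n
      sF' : SupportedBy Z F'
      sF' n h = trans (cong₂ (λ a b → ℓ n * a - b) (sF n h)
        (∑-zero Z (λ m 1≤m _ → *-zero′ (Λ m)
          (sF (n ℕ.* m) (ℕₚ.≤-trans h (subst (ℕ._≤ n ℕ.* m) (ℕₚ.*-identityʳ n) (ℕₚ.*-monoʳ-≤ n 1≤m)))))))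
        (zero-eq (ℓ n))
        where
        zero-eq : ∀ a → a * 0ℚ - 0ℚ ≡ 0ℚ
        zero-eq = solve-∀ ring

      additive : ∀ n j → 1 ℕ.≤ n → 1 ℕ.≤ j → ℓ (n ℕ.* j) * F (n ℕ.* j) ≡ ℓ n * F (n ℕ.* j) + ℓ j * F (n ℕ.* j)
      additive n j 1≤n 1≤j with n ℕ.* j ℕ.≤? Z
      ... | yes h = trans (cong (_* F (n ℕ.* j)) (ℓ-* n j 1≤n 1≤j h)) (*-distribʳ-+ (F (n ℕ.* j)) (ℓ n) (ℓ j))
      ... | no  h = all-zero (ℓ (n ℕ.* j)) (ℓ n) (ℓ j) (sF (n ℕ.* j) (ℕₚ.≰⇒> h))
        where
        all-zero : ∀ a b c {x} → x ≡ 0ℚ → a * x ≡ b * x + c * x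
        all-zero a b c refl = eq' a b c
          where
          eq' : ∀ a b c → a * 0ℚ ≡ b * 0ℚ + c * 0ℚ
          eq' = solve-∀ ring

      shape : ∀ n → 1 ℕ.≤ n → ∑ Z (λ j → F' (n ℕ.* j)) ≡ ℓ n * ∑ Z (λ j → F (n ℕ.* j))
      shape n 1≤n = trans (∑-sub Z (λ j → ℓ (n ℕ.* j) * F (n ℕ.* j)) (λ j → G (n ℕ.* j)))
        (trans (cong₂ _-_ (trans (∑-cong Z (λ j 1≤j _ → additive n j 1≤n 1≤j))
          (∑-+ Z (λ j → ℓ n * F (n ℕ.* j)) (λ j → ℓ j * F (n ℕ.* j)))) swapped)
        (trans (cancel (∑ Z (λ j → ℓ n * F (n ℕ.* j))) (∑ Z (λ j → ℓ j * F (n ℕ.* j))))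
          (∑-*ˡ Z (ℓ n) (λ j → F (n ℕ.* j)))))
        where
        cancel : ∀ a b → a + b - b ≡ a
        cancel = solve-∀ ring

        swapped : ∑ Z (λ j → G (n ℕ.* j)) ≡ ∑ Z (λ j → ℓ j * F (n ℕ.* j))
        swapped = trans (∑-swap Z Z (λ j m → Λ m * F (n ℕ.* j ℕ.* m)))
          (trans (∑-ext Z (λ m → trans (∑-ext Z
            (λ j → cong (λ z → Λ m * F z) (trans (ℕₚ.*-assoc n j m) (cong (n ℕ.*_) (ℕₚ.*-comm j m)))))
            (∑-*ˡ Z (Λ m) (λ j → F (n ℕ.* (m ℕ.* j))))))
          (sym (∑-ℓ Z log (λ j → F (n ℕ.* j)) (supported-multiple n 1≤n sF))))

    -- μ(n) log (x/n): the combination in which log x times `moebius-inversion` minus `moebius-log`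
    -- arises.
    weight : ℕ → ℕ → ℚ
    weight x n = μ Z n * (ℓ x - ℓ n)

    weight-bound : ∀ x n → ∣ weight x n ∣ ≤ ∣ ℓ x - ℓ n ∣
    weight-bound x n = ≤-trans (abs-* (μ Z n) (ℓ x - ℓ n) (μ-bound Z n) ≤-refl)
      (≤-reflexive (*-identityˡ ∣ ℓ x - ℓ n ∣))

    inversion-exact : ∀ φ {x} → 1 ℕ.≤ x → x ℕ.≤ Z →
      ℓ x * φ 1 + P Z log x φ ≡ ∑ x (λ n → weight x n * (inv n * L (quot x n) (λ j → φ (n ℕ.* j))))
    inversion-exact φ {x} 1≤x x≤Z = trans
      (cong₂ _+_ (cong (ℓ x *_) (sym f1))
      (sym (trans (∑-ext Z (λ m → move (Λ m) (𝟙 (m ℕ.≤? x)) (φ m) (inv m)))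
      (∑-cut Z x (λ m → Λ m * (inv m * φ m)) x≤Z))))
      (trans (cong₂ _+_ (cong (ℓ x *_) (sym (moebius-inversion Z 1≤Z F sF))) (negate (moebius-log 1≤Z F sF)))
      (trans (cong (_- ∑ Z (λ n → μ Z n * (ℓ n * S n))) (sym (∑-*ˡ Z (ℓ x) (λ n → μ Z n * S n))))
      (trans (sym (∑-sub Z (λ n → ℓ x * (μ Z n * S n)) (λ n → μ Z n * (ℓ n * S n))))
      (trans (∑-cong Z (λ n 1≤n _ → trans (collect (ℓ x) (μ Z n) (S n) (ℓ n)) (cong (weight x n *_) (inner n 1≤n))))
             (∑-to-y Z log (weight x) (λ n q → inv n * L q (λ j → φ (n ℕ.* j))) x≤Z (λ n → *-zeroʳ (inv n)))))))
      where
      1≤Z = ℕₚ.≤-trans 1≤x x≤Z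
      f : ℕ → ℚ
      f k = φ k * inv k
      F = cut Z log x f
      sF = cut-supported Z log f x≤Z
      S : ℕ → ℚ
      S n = ∑ Z (λ j → F (n ℕ.* j))
      f1 : F 1 ≡ φ 1
      f1 = trans (cong (_* f 1) (𝟙-yes (1 ℕ.≤? x) 1≤x)) (one (φ 1))
        where
        one : ∀ a → 1ℚ * (a * inv 1) ≡ a
        one a = trans (*-identityˡ (a * inv 1)) (*-identityʳ a)
      move : ∀ a d p v → a * (d * (p * v)) ≡ d * (a * (v * p))
      move = solve-∀ ring

      negate : ∀ {a b} → a ≡ - b → b ≡ - a
      negate {a} {b} refl = neg² b
        where
        neg² : ∀ b → b ≡ - (- b)
        neg² = solve-∀ ring

      collect : ∀ l m s n → l * (m * s) - m * (n * s) ≡ m * (l - n) * s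
      collect = solve-∀ ring

      pull : ∀ p u v → p * (u * v) ≡ u * (p * v)
      pull = solve-∀ ring

      inner : ∀ n → 1 ℕ.≤ n → S n ≡ inv n * L (quot x n) (λ j → φ (n ℕ.* j))
      inner n 1≤n = trans (∑-cut-multiples Z log f n x≤Z 1≤n)
        (trans (∑-ext (quot x n) (λ j → trans (cong (φ (n ℕ.* j) *_) (inv-* n j))
          (pull (φ (n ℕ.* j)) (inv n) (inv j))))
               (∑-*ˡ (quot x n) (inv n) (λ j → φ (n ℕ.* j) * inv j)))

    module _ (X : ℕ) where

      Q : ℕ → (ℕ → ℚ) → ℚ
      Q x φ = ∑ x (λ n → weight x n * (inv n * L X (λ j → φ (n ℕ.* j))))

      -- The inner sums are lengthened from x/n to a common X, so that their range no longer depends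
      -- on x or n and `Λ-L-bound` can be applied to them. The cost is Σ |ℓ x - ℓ n| ≤ 2x times
      -- 2C/x.
      inversion : ∀ {C} φ → Test C φ → ∀ {x} → 1 ℕ.≤ x → x ℕ.≤ Z → x ℕ.≤ X →
        ∣ Q x φ - (ℓ x * φ 1 + P Z log x φ) ∣ ≤ ι 4 * C
      inversion {C} φ t {x} 1≤x x≤Z x≤X = ≤-trans
        (≤-reflexive (cong ∣_∣ (trans (cong (λ z → Q x φ - z) (inversion-exact φ 1≤x x≤Z))
          (trans (sym (∑-sub x _ _)) (∑-ext x (λ n → collect (weight x n) (inv n) (L X (λ j → φ (n ℕ.* j)))
            (L (quot x n) (λ j → φ (n ℕ.* j)))))))))
        (≤-trans (∑-abs x (λ n → weight x n * D n))
        (≤-trans (∑-mono x (λ n 1≤n _ → abs-* (weight x n) (D n) (weight-bound x n)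
          (L-truncation Z log φ t 1≤x x≤X n 1≤n)))
        (≤-trans (≤-reflexive (∑-*ʳ x (ι 2 * C * inv x) (λ n → ∣ ℓ x - ℓ n ∣)))
        (≤-trans (*-monoʳ (ι 2 * C * inv x) (∑-ℓ-gap Z log x x≤Z) ((const≥0 (ι 2) ⊠ test-C≥0 φ t) ⊠ inv≥0 x))
                 (≤-reflexive (trans (shape (ι x) C (inv x))
                   (trans (cong (λ z → ι 4 * C * z) (ι-inv x 1≤x)) (*-identityʳ (ι 4 * C)))))))))
        where
        D : ℕ → ℚ
        D n = inv n * (L X (λ j → φ (n ℕ.* j)) - L (quot x n) (λ j → φ (n ℕ.* j)))
        collect : ∀ w v a b → w * (v * a) - w * (v * b) ≡ w * (v * (a - b))
        collect = solve-∀ ring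

        shape : ∀ n c v → ι 2 * n * (ι 2 * c * v) ≡ ι 4 * c * (n * v)
        shape = solve-∀ ring

      -- After exchanging sums, `Λ-L-bound` applies to each n separately. The weights are then
      -- summed crudely, so the bound grows like x; this is harmless once log y ≥ x.
      Q-average : ∀ {C} φ → Test C φ → ∀ {x y} → x ℕ.≤ Z → 1 ℕ.≤ y → y ℕ.< Z → y ℕ.≤ X →
        ∣ P Z log y (λ m → Q x (λ j → φ (m ℕ.* j))) ∣ ≤ ι 80 * (C * ι x)
      Q-average {C} φ t {x} {y} x≤Z 1≤y y<Z y≤X = ≤-trans (≤-reflexive (cong ∣_∣ swapped))
        (≤-trans (∑-abs x (λ n → weight x n * (inv n * R n)))
        (≤-trans (∑-mono x (λ n 1≤n _ → abs-* (weight x n) (inv n * R n) (weight-bound x n)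
            (≤-trans (abs-* (inv n) (R n) (≤-reflexive (abs-nonneg (inv≥0 n)))
              (Λ-L-bound Z log (λ j → φ (n ℕ.* j)) (test-multiple φ n 1≤n t) 1≤y y<Z y≤X))
              (*-≤1 (inv≤1 n) (const≥0 (ι 40) ⊠ test-C≥0 φ t)))))
        (≤-trans (≤-reflexive (∑-*ʳ x (ι 40 * C) (λ n → ∣ ℓ x - ℓ n ∣)))
        (≤-trans (*-monoʳ (ι 40 * C) (∑-ℓ-gap Z log x x≤Z) (const≥0 (ι 40) ⊠ test-C≥0 φ t))
          (≤-reflexive (shape (ι x) C))))))
        where
        shape : ∀ n c → ι 2 * n * (ι 40 * c) ≡ ι 80 * (c * n)
        shape = solve-∀ ring

        move : ∀ a v w u l → a * (v * (w * (u * l))) ≡ w * (u * (a * (v * l)))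
        move = solve-∀ ring

        R : ℕ → ℚ
        R n = P Z log y (λ m → L X (λ j → φ (n ℕ.* (m ℕ.* j))))
        swapped : P Z log y (λ m → Q x (λ j → φ (m ℕ.* j))) ≡ ∑ x (λ n → weight x n * (inv n * R n))
        swapped = trans (∑-ext y (λ m → trans (cong (Λ m *_) (sym (∑-*ˡ x (inv m) _))) (sym (∑-*ˡ x (Λ m) _))))
          (trans (∑-swap y x (λ m n → Λ m * (inv m * (weight x n * (inv n * L X (λ j → φ (m ℕ.* (n ℕ.* j))))))))
          (∑-ext x (λ n → trans (∑-ext y (λ m → trans
            (move (Λ m) (inv m) (weight x n) (inv n) (L X (λ j → φ (m ℕ.* (n ℕ.* j)))))
              (cong (λ z → weight x n * (inv n * (Λ m * (inv m * z))))
                (∑-ext X (λ j → cong (λ z → φ z * inv j) (rearrange m n j))))))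
            (trans (∑-*ˡ y (weight x n) (λ m → inv n * (Λ m * (inv m * L X (λ j → φ (n ℕ.* (m ℕ.* j)))))))
              (cong (weight x n *_) (∑-*ˡ y (inv n) _))))))
          where
          rearrange : ∀ m n j → m ℕ.* (n ℕ.* j) ≡ n ℕ.* (m ℕ.* j)
          rearrange m n j = trans (sym (ℕₚ.*-assoc m n j)) (trans (cong (ℕ._* j) (ℕₚ.*-comm m n)) (ℕₚ.*-assoc n m j))

      -- `inversion` is averaged over φ (m ·), and its error 4C becomes 4C (log y + 20). The terms
      -- on the left have natural size log x log y, so the estimate has content only when x is large
      -- too and y is far larger than x.
      correlation : ∀ {C} φ → Test C φ → ∀ {x y} → 1 ℕ.≤ x → x ℕ.≤ Z → x ℕ.≤ X → 1 ℕ.≤ y → y ℕ.< Z → y ℕ.≤ X →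
        ∣ P Z log y (λ m → P Z log x (λ n → φ (m ℕ.* n))) + ℓ x * P Z log y φ ∣ ≤ ι 4 * (C * (ℓ y + ι 20)) + ι 80 *
          (C * ι x)
      correlation {C} φ t {x} {y} 1≤x x≤Z x≤X 1≤y y<Z y≤X = ≤-trans (≤-reflexive (cong ∣_∣ decompose))
        (≤-trans (triangle⁻ (P Z log y (λ m → Q x (φ' m))) (P Z log y (λ m → Q x (φ' m) - E m))
          (Q-average φ t x≤Z 1≤y y<Z y≤X)
          (≤-trans (∑-abs y (λ m → Λ m * (inv m * (Q x (φ' m) - E m))))
            (∑-mono y (λ m 1≤m _ → abs-* (Λ m) _ (≤-reflexive (abs-nonneg (Λ≥0 m)))
              (abs-* (inv m) _ (≤-reflexive (abs-nonneg (inv≥0 m)))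
                (inversion (φ' m) (test-multiple φ m 1≤m t) 1≤x x≤Z x≤X))))))
        (lem C (ℓ y) (ι x) (∑ y (λ m → Λ m * (inv m * (ι 4 * C)))) (P Z log y (λ _ → 1ℚ))
          (trans (∑-ext y (λ m → pull (Λ m) (inv m) C)) (∑-*ʳ y (ι 4 * C) (λ m → Λ m * (inv m * 1ℚ))))
            (mertens-upper Z log y 1≤y y<Z) (test-C≥0 φ t)))
        where
        φ' : ℕ → ℕ → ℚ
        φ' m j = φ (m ℕ.* j)
        E : ℕ → ℚ
        E m = ℓ x * φ (m ℕ.* 1) + P Z log x (φ' m)
        pull : ∀ a v c → a * (v * (ι 4 * c)) ≡ a * (v * 1ℚ) * (ι 4 * c)
        pull = solve-∀ ring

        lem : ∀ (C l n s p : ℚ) → s ≡ p * (ι 4 * C) → p ≤ l + ι 20 → 0ℚ ≤ C →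
          ι 80 * (C * n) + s ≤ ι 4 * (C * (l + ι 20)) + ι 80 * (C * n)
        lem C l n s p e h k = ≤by (δ (≤-reflexive e) ⊞ const≥0 (ι 4) ⊠ δ h ⊠ δ k)
          (solve (C ∷ l ∷ n ∷ s ∷ p ∷ []) ring)

        split : ∀ a v p f q l → a * (v * p) + l * (a * (v * f)) ≡ a * (v * q) - a * (v * (q - (l * f + p)))
        split = solve-∀ ring

        decompose : P Z log y (λ m → P Z log x (φ' m)) + ℓ x * P Z log y φ ≡ P Z log y (λ m → Q x (φ' m)) - P Z log y
          (λ m → Q x (φ' m) - E m)
        decompose = trans (cong (P Z log y (λ m → P Z log x (φ' m)) +_)
          (sym (∑-*ˡ y (ℓ x) (λ m → Λ m * (inv m * φ m)))))
          (trans (sym (∑-+ y (λ m → Λ m * (inv m * P Z log x (φ' m))) (λ m → ℓ x * (Λ m * (inv m * φ m)))))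
          (trans (∑-ext y (λ m → trans (split (Λ m) (inv m) (P Z log x (φ' m)) (φ m) (Q x (φ' m)) (ℓ x))
              (cong (λ z → Λ m * (inv m * Q x (φ' m)) - Λ m *
                (inv m * (Q x (φ' m) - (ℓ x * φ z + P Z log x (φ' m))))) (sym (ℕₚ.*-identityʳ m)))))
          (∑-sub y (λ m → Λ m * (inv m * Q x (φ' m))) (λ m → Λ m * (inv m * (Q x (φ' m) - E m))))))

-- An explicit lower bound for L(1,χ), χ a real character.

module Nonvanishing where

  open Rationals
  open Sums
  open Primes
  open Moebius
  open Mertens using (quot; quot≤; ≤quot⇒*≤; *≤⇒≤quot; <*suc-quot; Test; test-1; test-C≥0; L; L-tail)
  open import Data.Rational
  open import Data.Rational.Properties
  open import Data.Nat.Induction using (<-rec)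
  open import Data.Nat.Divisibility using (_∣_; _∣?_; divides; ∣-trans; ∣⇒≤; *-monoʳ-∣; *-cancelˡ-∣; n∣m*n; 1∣_; ∣1⇒≡1)
  open import Data.Nat.Coprimality using (coprime-divisor) renaming (sym to coprime-sym)
  open import Data.Nat.Primality using (Prime; prime⇒nonZero)

  record RealCharacter (χ : ℕ → ℚ) : Set where
    field
      χ-*      : ∀ m n → χ (m ℕ.* n) ≡ χ m * χ n
      χ1       : χ 1 ≡ 1ℚ
      χ-values : ∀ n → χ n ≡ 0ℚ ⊎ (χ n ≡ 1ℚ ⊎ χ n ≡ - 1ℚ)

  -- h = `side M` and D = `ratio M` · h, with h = 2 (48M)² so that D² = h³/2. At x = 4h² the other
  -- errors are 2Mh² ≤ h³/2 and 48Mh⁴/(D + 1) ≤ h³. Of the 3h³ from the squares, h³ remains to be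
  -- matched by the main term 8h⁴ L(1,χ).
  ratio side : ℕ → ℕ
  ratio M = 48 ℕ.* M
  side M = 2 ℕ.* (ratio M ℕ.* ratio M)

  module _ {χ : ℕ → ℚ} (character : RealCharacter χ) where

    open RealCharacter character

    ∣χ∣≤1 : ∀ n → ∣ χ n ∣ ≤ 1ℚ
    ∣χ∣≤1 n with χ-values n
    ... | inj₁ e        = ≤-trans (≤-reflexive (cong ∣_∣ e)) (const≥0 1ℚ)
    ... | inj₂ (inj₁ e) = ≤-reflexive (cong ∣_∣ e)
    ... | inj₂ (inj₂ e) = ≤-reflexive (cong ∣_∣ e)

    module _ (N : ℕ) where

      -- (1 * χ)(n) for 1 ≤ n ≤ N. A range of d independent of n allows the sums over d and n to be
      -- exchanged.
      c : ℕ → ℚ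
      c n = ∑ N (λ d → 𝟙 (d ∣? n) * χ d)

      c-free : ℕ → ℕ → ℚ
      c-free p n = ∑ N (λ d → (1ℚ - 𝟙 (p ∣? d)) * (𝟙 (d ∣? n) * χ d))

      c-split : ∀ p n → c n ≡ c-free p n + ∑ N (λ d → 𝟙 (p ∣? d) * (𝟙 (d ∣? n) * χ d))
      c-split p n = trans (∑-ext N (λ d → eq (𝟙 (p ∣? d)) (𝟙 (d ∣? n) * χ d))) (∑-+ N _ _)
        where
        eq : ∀ a b → b ≡ (1ℚ - a) * b + a * b
        eq = solve-∀ ring

      c-free-* : ∀ {p} n → Prime p → c-free p (p ℕ.* n) ≡ c-free p n
      c-free-* {p} n pp = ∑-ext N term
        where
        term : ∀ d → (1ℚ - 𝟙 (p ∣? d)) * (𝟙 (d ∣? p ℕ.* n) * χ d) ≡ (1ℚ - 𝟙 (p ∣? d)) * (𝟙 (d ∣? n) * χ d)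
        term d with p ∣? d
        ... | yes _  = trans (*-zeroˡ (𝟙 (d ∣? p ℕ.* n) * χ d)) (sym (*-zeroˡ (𝟙 (d ∣? n) * χ d)))
        ... | no p∤d = cong (λ z → (1ℚ - 0ℚ) * (z * χ d)) (𝟙-cong (d ∣? p ℕ.* n) (d ∣? n)
            (coprime-divisor (coprime-sym (prime-∤⇒coprime pp p∤d))) (λ e → ∣-trans e (n∣m*n p)))

      -- The divisors of pn prime to p are those of n prime to p, and the others are pd with d ∣ n.
      -- This recursion takes the place of the product formula for 1 * χ.
      c-* : ∀ {p} n → Prime p → 1 ℕ.≤ n → p ℕ.* n ℕ.≤ N → c (p ℕ.* n) ≡ c-free p n + χ p * c n
      c-* {p} n pp 1≤n h = trans (c-split p (p ℕ.* n)) (cong₂ _+_ (c-free-* n pp)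
        (trans (∑-multiples N F (prime≥1 pp) sF)
        (trans (∑-ext N (λ d → trans (cong₂ _*_
          (𝟙-cong (p ℕ.* d ∣? p ℕ.* n) (d ∣? n) (*-cancelˡ-∣ p {{prime⇒nonZero pp}}) (*-monoʳ-∣ p)) (χ-* p d))
          (eq (𝟙 (d ∣? n)) (χ p) (χ d))))
               (∑-*ˡ N (χ p) (λ d → 𝟙 (d ∣? n) * χ d)))))
        where
        F : ℕ → ℚ
        F d = 𝟙 (d ∣? p ℕ.* n) * χ d
        eq : ∀ a b c → a * (b * c) ≡ b * (a * c)
        eq = solve-∀ ring

        1≤pn : 1 ℕ.≤ p ℕ.* n
        1≤pn = ℕₚ.*-mono-≤ (prime≥1 pp) 1≤n
        sF : SupportedBy N F
        sF d q = zero-* (χ d) (𝟙-no (d ∣? p ℕ.* n) (λ e → ℕₚ.<⇒≱ q (ℕₚ.≤-trans (∣⇒≤ {{ℕ.>-nonZero 1≤pn}} e) h)))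

      c-∤ : ∀ {p} n → ¬ p ∣ n → c n ≡ c-free p n
      c-∤ {p} n p∤n = trans (c-split p n)
        (trans (cong (c-free p n +_) (∑-zero N (λ d _ _ → term d))) (+-identityʳ (c-free p n)))
        where
        term : ∀ d → 𝟙 (p ∣? d) * (𝟙 (d ∣? n) * χ d) ≡ 0ℚ
        term d with p ∣? d | d ∣? n
        ... | no _    | w     = *-zeroˡ (𝟙 w * χ d)
        ... | yes _   | no _  = *-zero′ 1ℚ (*-zeroˡ (χ d))
        ... | yes p∣d | yes e = ⊥-elim (p∤n (∣-trans p∣d e))

      c-χ0 : ∀ {p} n → χ p ≡ 0ℚ → c n ≡ c-free p n
      c-χ0 {p} n χp = trans (c-split p n)
        (trans (cong (c-free p n +_) (∑-zero N (λ d _ _ → term d))) (+-identityʳ (c-free p n)))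
        where
        term : ∀ d → 𝟙 (p ∣? d) * (𝟙 (d ∣? n) * χ d) ≡ 0ℚ
        term d with p ∣? d
        ... | no _                = *-zeroˡ (𝟙 (d ∣? n) * χ d)
        ... | yes (divides k refl) = *-zero′ 1ℚ (*-zero′ (𝟙 (d ∣? n)) (trans (χ-* k p) (*-zero′ (χ k) χp)))

      c-one : 1 ℕ.≤ N → c 1 ≡ 1ℚ
      c-one 1≤N = trans (∑-single N _ 1 ℕₚ.≤-refl 1≤N (λ d ne → zero-* (χ d) (𝟙-no (d ∣? 1) (ne ∘ ∣1⇒≡1))))
        (trans (cong (𝟙 (1 ∣? 1) *_) χ1) (cong (_* 1ℚ) (𝟙-yes (1 ∣? 1) (1∣ 1))))

      -- Nonnegativity alone is not inductive along powers of p: for χ p = -1 the next value is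
      -- `c-free` minus the present one. Hence the upper bound by `c-free` is carried along.
      Bounds : ℕ → ℕ → Set
      Bounds p n = 0ℚ ≤ c-free p n × 0ℚ ≤ c n × (χ p ≡ - 1ℚ → c n ≤ c-free p n)

      bounds : ∀ {p} → Prime p → ∀ n → 1 ℕ.≤ n → n ℕ.≤ N → (∀ k → 1 ℕ.≤ k → k ℕ.≤ n → ¬ p ∣ k → 0ℚ ≤ c k) → Bounds p n
      bounds {p} pp = <-rec (λ n → 1 ℕ.≤ n → n ℕ.≤ N → (∀ k → 1 ℕ.≤ k → k ℕ.≤ n → ¬ p ∣ k → 0ℚ ≤ c k) → Bounds p n)
        step
        where
        step : ∀ n → (∀ {k} → k ℕ.< n → 1 ℕ.≤ k → k ℕ.≤ N → (∀ j → 1 ℕ.≤ j → j ℕ.≤ k → ¬ p ∣ j → 0ℚ ≤ c j) → Bounds p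
          k) →
          1 ℕ.≤ n → n ℕ.≤ N → (∀ k → 1 ℕ.≤ k → k ℕ.≤ n → ¬ p ∣ k → 0ℚ ≤ c k) → Bounds p n
        step n ih 1≤n n≤N hyp with p ∣? n
        ... | no p∤n = subst (0ℚ ≤_) (c-∤ n p∤n) (hyp n 1≤n ℕₚ.≤-refl p∤n) , hyp n 1≤n ℕₚ.≤-refl p∤n , λ _ →
          ≤-reflexive (c-∤ n p∤n)
        step .(k ℕ.* p) ih 1≤n n≤N hyp | yes (divides k@(suc _) refl) = subst (Bounds p) (ℕₚ.*-comm p k)
          (finish (χ-values p) (ih k<kp (s≤s z≤n) (ℕₚ.≤-trans k≤kp n≤N)
          (λ j 1≤j j≤k → hyp j 1≤j (ℕₚ.≤-trans j≤k k≤kp))))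
          where
          k≤kp : k ℕ.≤ k ℕ.* p
          k≤kp = ℕₚ.m≤m*n k p {{prime⇒nonZero pp}}
          k<kp : k ℕ.< k ℕ.* p
          k<kp = ℕₚ.m<m*n k p (prime≥2 pp)
          e = c-* k pp (s≤s z≤n) (subst (ℕ._≤ N) (ℕₚ.*-comm k p) n≤N)
          lem₁ : ∀ {f c : ℚ} → 0ℚ ≤ f → 0ℚ ≤ c → 0ℚ ≤ f + 1ℚ * c
          lem₁ {f} {c} h k = ≤by (δ h ⊞ δ k) (solve (f ∷ c ∷ []) ring)

          lem₂ : ∀ {f c : ℚ} → c ≤ f → 0ℚ ≤ f + - 1ℚ * c
          lem₂ {f} {c} h = ≤by (δ h) (solve (f ∷ c ∷ []) ring)

          lem₃ : ∀ {f c : ℚ} → 0ℚ ≤ c → f + - 1ℚ * c ≤ f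
          lem₃ {f} {c} h = ≤by (δ h) (solve (f ∷ c ∷ []) ring)

          1≢-1 : ∀ {x} → x ≡ 1ℚ → ¬ (x ≡ - 1ℚ)
          1≢-1 refl ()
          0≢-1 : ∀ {x} → x ≡ 0ℚ → ¬ (x ≡ - 1ℚ)
          0≢-1 refl ()
          finish : χ p ≡ 0ℚ ⊎ (χ p ≡ 1ℚ ⊎ χ p ≡ - 1ℚ) → Bounds p k → Bounds p (p ℕ.* k)
          finish v (f≥0 , c≥0 , c≤f) = subst (0ℚ ≤_) (sym (c-free-* k pp)) f≥0 , rest v
            where
            rest : χ p ≡ 0ℚ ⊎ (χ p ≡ 1ℚ ⊎ χ p ≡ - 1ℚ) →
              0ℚ ≤ c (p ℕ.* k) × (χ p ≡ - 1ℚ → c (p ℕ.* k) ≤ c-free p (p ℕ.* k))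
            rest (inj₁ e0) = subst (0ℚ ≤_) (sym (trans (c-χ0 (p ℕ.* k) e0) (c-free-* k pp))) f≥0 , λ e' → ⊥-elim
              (0≢-1 e0 e')
            rest (inj₂ (inj₁ e1)) = subst (0ℚ ≤_) (sym (trans e (cong (λ z → c-free p k + z * c k) e1)))
              (lem₁ f≥0 c≥0) , λ e' → ⊥-elim (1≢-1 e1 e')
            rest (inj₂ (inj₂ e-)) = subst (0ℚ ≤_) (sym e″) (lem₂ (c≤f e-)) , λ _ → subst₂ _≤_ (sym e″)
              (sym (c-free-* k pp)) (lem₃ c≥0)
              where
              e″ = trans e (cong (λ z → c-free p k + z * c k) e-)

      c≥0 : ∀ n → 1 ℕ.≤ n → n ℕ.≤ N → 0ℚ ≤ c n
      c≥0 = <-rec (λ n → 1 ℕ.≤ n → n ℕ.≤ N → 0ℚ ≤ c n) step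
        where
        step : ∀ n → (∀ {k} → k ℕ.< n → 1 ℕ.≤ k → k ℕ.≤ N → 0ℚ ≤ c k) → 1 ℕ.≤ n → n ℕ.≤ N → 0ℚ ≤ c n
        step 1 ih _ h = subst (0ℚ ≤_) (sym (c-one h)) (const≥0 1ℚ)
        step n@(suc (suc _)) ih 1≤n n≤N with prime-divisor n (s≤s (s≤s z≤n))
        ... | p , pp , d = proj₁ (proj₂ (bounds pp n 1≤n n≤N (λ k 1≤k k≤n p∤k →
                ih (ℕₚ.≤∧≢⇒< k≤n (λ { refl → p∤k d })) 1≤k (ℕₚ.≤-trans k≤n n≤N))))

      -- Two factors p are inserted at once. For χ p = -1 the recursion gives f - (f - c n) = c n
      -- with f = `c-free p n`; for χ p = 0 the value is unchanged, and for χ p = 1 it grows by 2f ≥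
      -- 0.
      c-square : ∀ m → 1 ℕ.≤ m → m ℕ.* m ℕ.≤ N → 1ℚ ≤ c (m ℕ.* m)
      c-square = prime-induction (λ m → m ℕ.* m ℕ.≤ N → 1ℚ ≤ c (m ℕ.* m)) (λ h → ≤-reflexive (sym (c-one h))) step
        where
        step : ∀ p k → Prime p → 1 ℕ.≤ k → (k ℕ.* k ℕ.≤ N → 1ℚ ≤ c (k ℕ.* k)) → p ℕ.* k ℕ.* (p ℕ.* k) ℕ.≤ N →
          1ℚ ≤ c (p ℕ.* k ℕ.* (p ℕ.* k))
        step p k pp 1≤k ih h = subst (λ z → 1ℚ ≤ c z) (sym shape) (finish (χ-values p))
          where
          n = k ℕ.* k
          1≤n : 1 ℕ.≤ n
          1≤n = ℕₚ.*-mono-≤ 1≤k 1≤k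
          shape : p ℕ.* k ℕ.* (p ℕ.* k) ≡ p ℕ.* (p ℕ.* n)
          shape = trans (ℕₚ.*-assoc p k (p ℕ.* k))
            (cong (p ℕ.*_) (trans (sym (ℕₚ.*-assoc k p k))
            (trans (cong (ℕ._* k) (ℕₚ.*-comm k p)) (ℕₚ.*-assoc p k k))))
          h₂ : p ℕ.* (p ℕ.* n) ℕ.≤ N
          h₂ = subst (ℕ._≤ N) shape h
          h₁ : p ℕ.* n ℕ.≤ N
          h₁ = ℕₚ.≤-trans (ℕₚ.m≤n*m (p ℕ.* n) p {{prime⇒nonZero pp}}) h₂
          h₀ : n ℕ.≤ N
          h₀ = ℕₚ.≤-trans (ℕₚ.m≤n*m n p {{prime⇒nonZero pp}}) h₁
          b = bounds pp n 1≤n h₀ (λ j 1≤j j≤n _ → c≥0 j 1≤j (ℕₚ.≤-trans j≤n h₀))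
          e : c (p ℕ.* (p ℕ.* n)) ≡ c-free p n + χ p * (c-free p n + χ p * c n)
          e = trans (c-* (p ℕ.* n) pp (ℕₚ.*-mono-≤ (prime≥1 pp) 1≤n) h₂)
            (cong₂ (λ u v → u + χ p * v) (c-free-* n pp) (c-* n pp 1≤n h₁))
          lem₁ : ∀ {f c : ℚ} → 0ℚ ≤ f → 1ℚ ≤ c → 1ℚ ≤ f + 1ℚ * (f + 1ℚ * c)
          lem₁ {f} {c} h k = ≤by (const≥0 (ι 2) ⊠ δ h ⊞ δ k) (solve (f ∷ c ∷ []) ring)

          lem₂ : ∀ {f c : ℚ} → 1ℚ ≤ c → 1ℚ ≤ f + - 1ℚ * (f + - 1ℚ * c)
          lem₂ {f} {c} k = ≤by (δ k) (solve (f ∷ c ∷ []) ring)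

          finish : χ p ≡ 0ℚ ⊎ (χ p ≡ 1ℚ ⊎ χ p ≡ - 1ℚ) → 1ℚ ≤ c (p ℕ.* (p ℕ.* n))
          finish (inj₁ e0) = subst (1ℚ ≤_)
            (sym (trans (c-χ0 (p ℕ.* (p ℕ.* n)) e0)
            (trans (c-free-* (p ℕ.* n) pp) (trans (c-free-* n pp) (sym (c-χ0 n e0)))))) (ih h₀)
          finish (inj₂ (inj₁ e1)) = subst (1ℚ ≤_)
            (sym (trans e (cong (λ z → c-free p n + z * (c-free p n + z * c n)) e1))) (lem₁ (proj₁ b) (ih h₀))
          finish (inj₂ (inj₂ e-)) = subst (1ℚ ≤_)
            (sym (trans e (cong (λ z → c-free p n + z * (c-free p n + z * c n)) e-))) (lem₂ {f = c-free p n} (ih h₀))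

      c≥squares : ∀ h n → 1 ℕ.≤ n → n ℕ.≤ N → ∑ h (λ m → 𝟙 (m ℕ.* m ℕ.≟ n)) ≤ c n
      c≥squares zero    n 1≤n n≤N = c≥0 n 1≤n n≤N
      c≥squares (suc h) n 1≤n n≤N with suc h ℕ.* suc h ℕ.≟ n
      ... | no _ = subst (_≤ c n) (sym (+-identityʳ (∑ h (λ m → 𝟙 (m ℕ.* m ℕ.≟ n))))) (c≥squares h n 1≤n n≤N)
      ... | yes refl = ≤-trans (≤-reflexive
        (cong (_+ 1ℚ) (∑-zero h (λ m _ m≤h → 𝟙-no (m ℕ.* m ℕ.≟ n) (ℕₚ.<⇒≢ (ℕₚ.*-mono-< (s≤s m≤h) (s≤s m≤h)))))))
          (c-square (suc h) (s≤s z≤n) n≤N)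

    module _ (x : ℕ) where

      -- The weight (x - n)⁺. With weight 1, the head error D and the tail estimate C x / D could
      -- not both be made small against the √x squares. With the linear weight they become D² and C
      -- x² / D against x^(3/2), and D can be a large multiple of √x.
      ramp : ℕ → ℚ
      ramp n = 𝟙 (n ℕ.≤? x) * (ι x - ι n)

      ramp≥0 : ∀ n → 0ℚ ≤ ramp n
      ramp≥0 n with n ℕ.≤? x
      ... | yes h = const≥0 1ℚ ⊠ δ (ι-mono h)
      ... | no  _ = ≤-reflexive (sym (*-zeroˡ (ι x - ι n)))

      ramp-antitone : ∀ {m n} → m ℕ.≤ n → ramp n ≤ ramp m
      ramp-antitone {m} {n} h with n ℕ.≤? x
      ... | no  _ = ≤-trans (≤-reflexive (*-zeroˡ (ι x - ι n))) (ramp≥0 m)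
      ... | yes q = subst (1ℚ * (ι x - ι n) ≤_) (cong (_* (ι x - ι m)) (sym (𝟙-yes (m ℕ.≤? x) (ℕₚ.≤-trans h q))))
        (*-monoˡ 1ℚ (+-monoʳ-≤ (ι x) (≤-neg (ι-mono h))) (const≥0 1ℚ))

      ramp-supported : SupportedBy x ramp
      ramp-supported n h = zero-* (ι x - ι n) (𝟙-no (n ℕ.≤? x) (ℕₚ.<⇒≱ h))

      W : ℕ → ℚ
      W d = ∑ x (λ j → ramp (d ℕ.* j))

      W-quot : ∀ d → 1 ℕ.≤ d → W d ≡ ∑ (quot x d) (λ j → ι x - ι (d ℕ.* j))
      W-quot d 1≤d = trans (∑-ext x (λ j → cong (_* (ι x - ι (d ℕ.* j)))
        (𝟙-cong (d ℕ.* j ℕ.≤? x) (j ℕ.≤? quot x d) (*≤⇒≤quot x d j 1≤d) (≤quot⇒*≤ x d j 1≤d))))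
        (∑-cut x (quot x d) (λ j → ι x - ι (d ℕ.* j)) (quot≤ x d))

      ∑-arithmetic : ∀ d q → ι 2 * ∑ q (λ j → ι x - ι (d ℕ.* j)) ≡ ι 2 * (ι q * ι x) - ι d * (ι q * (1ℚ + ι q))
      ∑-arithmetic d zero    = eq (ι x) (ι d)
        where
        eq : ∀ x d → ι 2 * 0ℚ ≡ ι 2 * (0ℚ * x) - d * (0ℚ * (1ℚ + 0ℚ))
        eq = solve-∀ ring

      ∑-arithmetic d (suc q) = trans (cong (λ z → ι 2 * (∑ q (λ j → ι x - ι (d ℕ.* j)) + (ι x - z))) (ι-* d (suc q)))
        (trans (eq₁ (∑ q (λ j → ι x - ι (d ℕ.* j))) (ι x - ι d * (1ℚ + ι q)))
        (trans (cong (_+ ι 2 * (ι x - ι d * (1ℚ + ι q))) (∑-arithmetic d q)) (eq₂ (ι x) (ι d) (ι q))))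
        where
        eq₁ : ∀ a b → ι 2 * (a + b) ≡ ι 2 * a + ι 2 * b
        eq₁ = solve-∀ ring

        eq₂ : ∀ x d q → ι 2 * (q * x) - d * (q * (1ℚ + q)) + ι 2 * (x - d * (1ℚ + q)) ≡ ι 2 * ((1ℚ + q) * x) - d *
          ((1ℚ + q) * (1ℚ + (1ℚ + q)))
        eq₂ = solve-∀ ring

      remainder : ℕ → ℚ
      remainder d = W d - (½ * (ι x * ι x) * inv d - ½ * ι x)

      -- With x = dq + ρ one has 2d (remainder d) = ρ (d - ρ).
      remainder-bound : ∀ d → 1 ℕ.≤ d → ∣ remainder d ∣ ≤ ι d
      remainder-bound d@(suc d') 1≤d = abs≤
        (≤-trans (≤-neg (ι≥0 d)) (*-cancelˡ (ι d) (ι-pos d')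
        (lem₁ (ι d) (ι x) (inv d) (ι q) (∑ q (λ j → ι x - ι (d ℕ.* j))) (W d) (W-quot d 1≤d) (∑-arithmetic d q)
        (ι-inv d 1≤d) ρ≥0 ρ≤d)))
          (*-cancelˡ (ι d) (ι-pos d') (lem₂ (ι d) (ι x) (inv d) (ι q) (∑ q (λ j → ι x - ι (d ℕ.* j))) (W d)
            (W-quot d 1≤d) (∑-arithmetic d q) (ι-inv d 1≤d) ρ≥0 ρ≤d))
        where
        q = quot x d
        ρ≥0 : ι d * ι q ≤ ι x
        ρ≥0 = subst (_≤ ι x) (ι-* d q) (ι-mono (≤quot⇒*≤ x d q 1≤d ℕₚ.≤-refl))
        ρ≤d : ι x ≤ ι d * (1ℚ + ι q)
        ρ≤d = subst (ι x ≤_) (ι-* d (suc q)) (ι-mono (ℕₚ.<⇒≤ (<*suc-quot x d 1≤d)))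
        lem₁ : ∀ (d x v q s w : ℚ) → w ≡ s → ι 2 * s ≡ ι 2 * (q * x) - d * (q * (1ℚ + q)) → d * v ≡ 1ℚ → d * q ≤ x →
          x ≤ d * (1ℚ + q) → d * 0ℚ ≤ d * (w - (½ * (x * x) * v - ½ * x))
        lem₁ d x v q s w e₀ e₁ e₂ a b =
          ≤by (const≥0 (inv 2) ⊠ δ a ⊠ δ b ⊞ δ (≤-reflexive (cong (λ z → z * d) (sym e₀))) ⊞ const≥0 (inv 2) ⊠ δ
            (≤-reflexive (cong (λ z → z * d) (sym e₁))) ⊞ const≥0 (inv 2) ⊠ δ
            (≤-reflexive (cong (λ z → z * ((x * x))) e₂)))
            (solve (d ∷ x ∷ v ∷ q ∷ s ∷ w ∷ []) ring)

        lem₂ : ∀ (d x v q s w : ℚ) → w ≡ s → ι 2 * s ≡ ι 2 * (q * x) - d * (q * (1ℚ + q)) → d * v ≡ 1ℚ → d * q ≤ x →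
          x ≤ d * (1ℚ + q) → d * (w - (½ * (x * x) * v - ½ * x)) ≤ d * d
        lem₂ d x v q s w e₀ e₁ e₂ a b =
          ≤by (const≥0 (ι 3 * inv 2) ⊠ δ a ⊠ δ b ⊞ δ a ⊠ δ a ⊞ δ b ⊠ δ b ⊞ δ (≤-reflexive (cong (λ z → z * d) e₀)) ⊞
            const≥0 (inv 2) ⊠ δ (≤-reflexive (cong (λ z → z * d) e₁)) ⊞ const≥0 (inv 2) ⊠ δ
            (≤-reflexive (cong (λ z → z * ((x * x))) (sym e₂))))
            (solve (d ∷ x ∷ v ∷ q ∷ s ∷ w ∷ []) ring)

      W≥0 : ∀ d → 0ℚ ≤ W d
      W≥0 d = ∑≥0 x (λ j _ _ → ramp≥0 (d ℕ.* j))

      W-antitone : ∀ d → W (suc d) ≤ W d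
      W-antitone d = ∑-mono x (λ j _ _ → ramp-antitone (ℕₚ.*-monoˡ-≤ j (ℕₚ.n≤1+n d)))

      W-upper : ∀ d → 1 ℕ.≤ d → W d ≤ ι x * ι x * inv d
      W-upper d 1≤d = ≤-trans (≤-reflexive (W-quot d 1≤d))
        (≤-trans (∑-mono (quot x d) (λ j _ _ → lem {b = ι (d ℕ.* j)} (ι≥0 (d ℕ.* j))))
        (≤-trans (≤-reflexive (∑-const (quot x d) (ι x)))
        (lem₂ (ι d) (ι x) (inv d) (ι (quot x d))
          (subst (_≤ ι x) (ι-* d (quot x d)) (ι-mono (≤quot⇒*≤ x d (quot x d) 1≤d ℕₚ.≤-refl))) (ι-inv d 1≤d)
          (inv≥0 d) (ι≥0 x))))
        where
        lem : ∀ {a b : ℚ} → 0ℚ ≤ b → a - b ≤ a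
        lem {a} {b} h = ≤by (δ h) (solve (a ∷ b ∷ []) ring)

        lem₂ : ∀ (d x v q : ℚ) → d * q ≤ x → d * v ≡ 1ℚ → 0ℚ ≤ v → 0ℚ ≤ x → q * x ≤ x * x * v
        lem₂ d x v q h e a b =
          ≤by (δ h ⊠ δ a ⊠ δ b ⊞ δ (≤-reflexive (cong (λ z → z * ((q * x))) (sym e))))
            (solve (d ∷ x ∷ v ∷ q ∷ []) ring)

      ramp-χ : ∑ x (λ n → ramp n * c x n) ≡ ∑ x (λ d → χ d * W d)
      ramp-χ = trans (∑-ext x (λ n → sym (∑-*ˡ x (ramp n) (λ d → 𝟙 (d ∣? n) * χ d))))
        (trans (∑-swap x x (λ n d → ramp n * (𝟙 (d ∣? n) * χ d)))
        (∑-cong x (λ d 1≤d _ → trans (∑-ext x (λ n → eq (ramp n) (𝟙 (d ∣? n)) (χ d)))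
          (trans (∑-*ˡ x (χ d) (λ n → 𝟙 (d ∣? n) * ramp n))
            (cong (χ d *_) (∑-multiples x ramp 1≤d ramp-supported))))))
        where
        eq : ∀ a b c → a * (b * c) ≡ c * (b * a)
        eq = solve-∀ ring

      ramp-squares : ∀ h → h ℕ.* h ℕ.≤ x → ∑ h (λ m → ramp (m ℕ.* m)) ≤ ∑ x (λ n → ramp n * c x n)
      ramp-squares h h²≤x = ≤-trans (≤-reflexive (trans (∑-cong h (λ m 1≤m m≤h → sym (trans
          (∑-single x (λ n → ramp n * 𝟙 (m ℕ.* m ℕ.≟ n)) (m ℕ.* m) (ℕₚ.*-mono-≤ 1≤m 1≤m)
            (ℕₚ.≤-trans (ℕₚ.*-mono-≤ m≤h m≤h) h²≤x)
            (λ n ne → *-zero′ (ramp n) (𝟙-no (m ℕ.* m ℕ.≟ n) (ne ∘ sym))))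
          (trans (cong (ramp (m ℕ.* m) *_) (𝟙-yes (m ℕ.* m ℕ.≟ m ℕ.* m) refl)) (*-identityʳ (ramp (m ℕ.* m)))))))
        (trans (∑-swap h x (λ m n → ramp n * 𝟙 (m ℕ.* m ℕ.≟ n)))
          (∑-ext x (λ n → ∑-*ˡ h (ramp n) (λ m → 𝟙 (m ℕ.* m ℕ.≟ n)))))))
        (∑-mono x (λ n 1≤n n≤x → *-monoˡ (ramp n) (c≥squares x h n 1≤n n≤x) (ramp≥0 n)))

      head-bound : ∀ {C} → Test C χ → ∀ D → ∑ D (λ d → χ d * W d) ≤ ½ * (ι x * ι x) * L D χ + ½ * ι x * C + ι D * ι D
      head-bound {C} t D = ≤-trans (≤-reflexive
        (trans (∑-ext D (λ d → eq (χ d) (W d) (½ * (ι x * ι x)) (inv d) (½ * ι x)))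
          (trans (∑-+ D _ (λ d → χ d * remainder d)) (cong (_+ ∑ D (λ d → χ d * remainder d))
            (trans (∑-+ D _ _) (cong₂ _+_ (∑-*ˡ D (½ * (ι x * ι x)) (λ d → χ d * inv d))
              (∑-*ˡ D (- (½ * ι x)) χ)))))))
        (lem (½ * (ι x * ι x) * L D χ) (∑ D χ) (½ * ι x) C (∑ D (λ d → χ d * remainder d)) (ι D * ι D)
          (abs-lower (test-1 χ t D)) (const≥0 ½ ⊠ ι≥0 x)
          (abs-upper (≤-trans (∑-abs D (λ d → χ d * remainder d)) (≤-trans (∑-mono D (λ d 1≤d d≤D →
            ≤-trans (abs-* (χ d) (remainder d) (∣χ∣≤1 d) (≤-trans (remainder-bound d 1≤d) (ι-mono d≤D)))
              (≤-reflexive (*-identityˡ (ι D)))))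
            (≤-reflexive (∑-const D (ι D)))))))
        where
        eq : ∀ p w a v b → p * w ≡ a * (p * v) + - b * p + p * (w - (a * v - b))
        eq = solve-∀ ring

        lem : ∀ (l s x C r d : ℚ) → - C ≤ s → 0ℚ ≤ x → r ≤ d → l + - x * s + r ≤ l + x * C + d
        lem l s x C r d h k u = ≤by (δ u ⊞ δ h ⊠ δ k) (solve (l ∷ s ∷ x ∷ C ∷ r ∷ d ∷ []) ring)

      -- The sum of χ(d) W(d) is split at D: `head-bound` below, monotonicity of W above. The factor
      -- 3 is 2 from this tail plus 1 = ½ · 2 from replacing L D χ by L X χ.
      L-lower-raw : ∀ {C} → Test C χ → ∀ {D X} → D ℕ.≤ x → D ℕ.≤ X → ∀ h → h ℕ.* h ℕ.≤ x →
        ∑ h (λ m → ramp (m ℕ.* m)) ≤ ½ * (ι x * ι x) * L X χ + ½ * ι x * C + ι D * ι D + ι 3 *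
          (C * (ι x * ι x * inv (suc D)))
      L-lower-raw {C} t {D} {X} D≤x D≤X h h²≤x = lem (∑ h (λ m → ramp (m ℕ.* m))) (∑ x (λ d → χ d * W d))
        (∑ D (λ d → χ d * W d)) (ι x * ι x) (L X χ) (L D χ) (½ * ι x * C) (ι D * ι D) C (inv (suc D)) (W (suc D))
          (subst (∑ h (λ m → ramp (m ℕ.* m)) ≤_) ramp-χ (ramp-squares h h²≤x))
          (abs-upper (∑-tail C χ W (test-1 χ t) (λ k → W-antitone (suc k)) (λ k → W≥0 (suc k)) D≤x))
          (head-bound t D)
          (abs-lower (L-tail χ t D≤X)) (ι≥0 x ⊠ ι≥0 x) (W-upper (suc D) (s≤s z≤n)) (test-C≥0 χ t)
        where
        lem : ∀ (s a b x l k e f C v w : ℚ) → s ≤ a → a - b ≤ ι 2 * C * w → b ≤ ½ * x * k + e + f →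
          - (ι 2 * C * v) ≤ l - k → 0ℚ ≤ x → w ≤ x * v → 0ℚ ≤ C → s ≤ ½ * x * l + e + f + ι 3 * (C * (x * v))
        lem s a b x l k e f C v w h₁ h₂ h₃ h₄ p h₅ q =
          ≤by (δ h₁ ⊞ δ h₂ ⊞ δ h₃ ⊞ const≥0 (inv 2) ⊠ δ h₄ ⊠ δ p ⊞ const≥0 (ι 2) ⊠ δ h₅ ⊠ δ q)
            (solve (s ∷ a ∷ b ∷ x ∷ l ∷ k ∷ e ∷ f ∷ C ∷ v ∷ w ∷ []) ring)

    -- The choice x = (2h)², D = 48Mh makes the squares, contributing at least 3h³, dominate all errors.
    L-lower : ∀ M → 1 ℕ.≤ M → Test (ι M) χ → ∀ {X} → ratio M ℕ.* side M ℕ.≤ X → inv (8 ℕ.* side M) ≤ L X χ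
    L-lower M 1≤M t {X} D≤X = inv-≤ (8 ℕ.* h) 1≤8h (*-cancelˡ (ι h * ι h * ι h) h³>0
        (≤-trans (lem (ι h) (ι x) (ι M) (ι (ratio M)) (ι D) (inv (suc D)) (L X χ) (∑ h (λ m → ramp x (m ℕ.* m)))
          ιx ιT (ι-* (ratio M) h) (trans (ι-* 2 (ratio M ℕ.* ratio M)) (cong (ι 2 *_) (ι-* (ratio M) (ratio M))))
          (≤-trans (≤-reflexive (sym (ι-* 4 M))) (ι-mono 4M≤h))
          (≤-trans (*-monoʳ (inv (suc D)) (ι-mono (ℕₚ.n≤1+n D)) (inv≥0 (suc D)))
            (≤-reflexive (ι-inv (suc D) (s≤s z≤n))))
          (ι≥0 h) (inv≥0 (suc D)) (ι≥0 M)
          squares (L-lower-raw x t D≤x D≤X h h²≤x))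
        (≤-reflexive (cong (λ z → ι h * ι h * ι h * (z * L X χ)) (sym (ι-* 8 h))))))
      where
      h = side M
      D = ratio M ℕ.* h
      x = 4 ℕ.* (h ℕ.* h)
      ιx : ι x ≡ ι 4 * (ι h * ι h)
      ιx = trans (ι-* 4 (h ℕ.* h)) (cong (ι 4 *_) (ι-* h h))
      ιT : ι (ratio M) ≡ ι 48 * ι M
      ιT = ι-* 48 M
      T≥1 : 1 ℕ.≤ ratio M
      T≥1 = ℕₚ.*-mono-≤ {1} {48} (s≤s z≤n) 1≤M
      T≤h : ratio M ℕ.≤ h
      T≤h = ℕₚ.≤-trans (ℕₚ.m≤m*n (ratio M) (ratio M) {{ℕ.>-nonZero T≥1}}) (ℕₚ.m≤n*m (ratio M ℕ.* ratio M) 2)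
      1≤h : 1 ℕ.≤ h
      1≤h = ℕₚ.≤-trans T≥1 T≤h
      4M≤h : 4 ℕ.* M ℕ.≤ h
      4M≤h = ℕₚ.≤-trans (ℕₚ.*-monoˡ-≤ M {4} {48} (ℕₚ.m≤m+n 4 44)) T≤h
      1≤8h : 1 ℕ.≤ 8 ℕ.* h
      1≤8h = ℕₚ.*-mono-≤ {1} {8} (s≤s z≤n) 1≤h
      h²≤x : h ℕ.* h ℕ.≤ x
      h²≤x = ℕₚ.m≤n*m (h ℕ.* h) 4
      D≤x : D ℕ.≤ x
      D≤x = ℕₚ.≤-trans (ℕₚ.*-monoˡ-≤ h T≤h) h²≤x
      ιh>0 : 0ℚ < ι h
      ιh>0 = subst (λ z → 0ℚ < ι z) (ℕₚ.suc-pred h {{ℕ.>-nonZero 1≤h}}) (ι-pos (ℕ.pred h))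
      h³>0 : 0ℚ < ι h * ι h * ι h
      h³>0 = *-pos (*-pos ιh>0 ιh>0) ιh>0
      squares : ι 3 * (ι h * ι h * ι h) ≤ ∑ h (λ m → ramp x (m ℕ.* m))
      squares = ≤-trans (≤-reflexive (trans (shape (ι h)) (sym (∑-const h (ι 3 * (ι h * ι h))))))
        (∑-mono h (λ m _ m≤h →
          ≤-trans (lem₀ (ι h) (ι x) (ι (m ℕ.* m)) ιx (≤-trans (ι-mono (ℕₚ.*-mono-≤ m≤h m≤h)) (≤-reflexive (ι-* h h))))
            (≤-reflexive (sym (trans (cong (_* (ι x - ι (m ℕ.* m)))
              (𝟙-yes (m ℕ.* m ℕ.≤? x) (ℕₚ.≤-trans (ℕₚ.*-mono-≤ m≤h m≤h) h²≤x))) (*-identityˡ (ι x - ι (m ℕ.* m))))))))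
        where
        shape : ∀ h → ι 3 * (h * h * h) ≡ h * (ι 3 * (h * h))
        shape = solve-∀ ring

        lem₀ : ∀ (h x m : ℚ) → x ≡ ι 4 * (h * h) → m ≤ h * h → ι 3 * (h * h) ≤ x - m
        lem₀ h x m e k = ≤by (δ (≤-reflexive (sym e)) ⊞ δ k) (solve (h ∷ x ∷ m ∷ []) ring)

      lem : ∀ h x M T D v l s → x ≡ ι 4 * (h * h) → T ≡ ι 48 * M → D ≡ T * h → h ≡ ι 2 * (T * T) → ι 4 * M ≤ h →
        D * v ≤ 1ℚ →
        0ℚ ≤ h → 0ℚ ≤ v → 0ℚ ≤ M → ι 3 * (h * h * h) ≤ s → s ≤ ½ * (x * x) * l + ½ * x * M + D * D + ι 3 *
          (M * (x * x * v)) →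
        h * h * h * 1ℚ ≤ h * h * h * (ι 8 * h * l)
      lem h .(ι 4 * (h * h)) M .(ι 48 * M) .(ι 48 * M * h) v l s refl refl refl e = lem' h M v l s e
        where
        lem' : ∀ (h M v l s : ℚ) → h ≡ ι 2 * (ι 48 * M * (ι 48 * M)) → ι 4 * M ≤ h → ι 48 * M * h * v ≤ 1ℚ → 0ℚ ≤ h →
          0ℚ ≤ v → 0ℚ ≤ M → ι 3 * (h * h * h) ≤ s →
          s ≤ ½ * (ι 4 * (h * h) * (ι 4 * (h * h))) * l + ½ * (ι 4 * (h * h)) * M + ι 48 * M * h * (ι 48 * M * h) + ι
          3 * (M * (ι 4 * (h * h) * (ι 4 * (h * h)) * v)) → h * h * h * 1ℚ ≤ h * h * h * (ι 8 * h * l)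
        lem' h M v l s e a b h≥0 v≥0 M≥0 k u =
          ≤by (δ k ⊞ δ u ⊞ δ b ⊠ δ h≥0 ⊠ δ h≥0 ⊠ δ h≥0 ⊞ const≥0 (inv 2) ⊠ δ a ⊠ δ h≥0 ⊠ δ h≥0 ⊞ const≥0 (inv 2) ⊠ δ
            (≤-reflexive (cong (λ z → z * ((h * h))) (sym e))))
            (solve (h ∷ M ∷ v ∷ l ∷ s ∷ []) ring)

-- Residue classes modulo M and periodic functions.

module Residues (M : ℕ) {{M≢0 : ℕ.NonZero M}} where

  open Rationals
  open Sums
  open Mertens using (Test)
  open import Data.Rational
  open import Data.Rational.Properties
  open import Data.Nat.DivMod using (%-distribˡ-*; [m+kn]%n≡m%n; m%n<n; m<n⇒m%n≡m; n%n≡0; m≡m%n+[m/n]*n)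
  open import Data.Nat.Divisibility using (_∣_; ∣-trans; ∣n∣m%n⇒∣m; %-presˡ-∣; m∣m*n; n∣m*n)
  open import Data.Nat.Coprimality using (Coprime; coprime?; coprime-Bézout; coprime-divisor; 1-coprimeTo)
  open import Data.Nat.GCD using (module Bézout)
  import Data.Nat.Tactic.RingSolver as ℕ-solver

  infix 4 _≈_ _≈?_

  _≈_ : ℕ → ℕ → Set
  m ≈ n = m ℕ.% M ≡ n ℕ.% M

  _≈?_ : ∀ m n → Dec (m ≈ n)
  m ≈? n = m ℕ.% M ℕ.≟ n ℕ.% M

  ≈-* : ∀ {a b c d} → a ≈ b → c ≈ d → a ℕ.* c ≈ b ℕ.* d
  ≈-* {a} {b} {c} {d} p q = trans (%-distribˡ-* a c M)
    (trans (cong₂ (λ u v → (u ℕ.* v) ℕ.% M) p q) (sym (%-distribˡ-* b d M)))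

  ≈-*ˡ : ∀ a {b c} → b ≈ c → a ℕ.* b ≈ a ℕ.* c
  ≈-*ˡ a {b} {c} = ≈-* {a} {a} {b} {c} refl

  ≈-*ʳ : ∀ a {b c} → b ≈ c → b ℕ.* a ≈ c ℕ.* a
  ≈-*ʳ a {b} {c} p = ≈-* {b} {c} {a} {a} p refl

  ≈-≡ : ∀ {a b} → a ≡ b → a ≈ b
  ≈-≡ = cong (ℕ._% M)

  Unit : ℕ → Set
  Unit b = Coprime b M

  unit? : ∀ b → Dec (Unit b)
  unit? b = coprime? b M

  unit-≈ : ∀ {b c} → b ≈ c → Unit b → Unit c
  unit-≈ {b} {c} e u (d∣c , d∣M) = u (∣n∣m%n⇒∣m d∣M (subst (_ ∣_) (sym e) (%-presˡ-∣ d∣c d∣M)) , d∣M)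

  unit-* : ∀ {m n} → Unit m → Unit n → Unit (m ℕ.* n)
  unit-* {m} {n} um un (d∣mn , d∣M) = un (coprime-divisor (λ { (e∣d , e∣m) → um (e∣m , ∣-trans e∣d d∣M) }) d∣mn , d∣M)

  unit-*⁻ˡ : ∀ m n → Unit (m ℕ.* n) → Unit m
  unit-*⁻ˡ m n u (d∣m , d∣M) = u (∣-trans d∣m (m∣m*n n) , d∣M)

  unit-*⁻ʳ : ∀ m n → Unit (m ℕ.* n) → Unit n
  unit-*⁻ʳ m n u (d∣n , d∣M) = u (∣-trans d∣n (n∣m*n m) , d∣M)

  unit-1 : Unit 1
  unit-1 = 1-coprimeTo M

  inverse : ∀ b → Unit b → Σ ℕ λ x → x ℕ.* b ≈ 1
  inverse b u with coprime-Bézout u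
  ... | Bézout.+- x y eq = x , trans (≈-≡ (sym eq)) ([m+kn]%n≡m%n 1 y M)
  ... | Bézout.-+ x y eq = x ℕ.* ℕ.pred M , trans (sym ([m+kn]%n≡m%n (x ℕ.* ℕ.pred M ℕ.* b) y M))
      (trans (≈-≡ (trans (cong (x ℕ.* ℕ.pred M ℕ.* b ℕ.+_) (sym eq))
        (trans (rearrange x (ℕ.pred M) b) (cong (λ z → 1 ℕ.+ x ℕ.* b ℕ.* z) (ℕₚ.suc-pred M)))))
        ([m+kn]%n≡m%n 1 (x ℕ.* b) M))
    where
    rearrange : ∀ x k b → x ℕ.* k ℕ.* b ℕ.+ (1 ℕ.+ x ℕ.* b) ≡ 1 ℕ.+ x ℕ.* b ℕ.* suc k
    rearrange = ℕ-solver.solve-∀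

  ≈-cancelʳ : ∀ {m g} n → Unit n → m ℕ.* n ≈ g ℕ.* n → m ≈ g
  ≈-cancelʳ {m} {g} n un e with inverse n un
  ... | x , xn = trans (sym (undo m)) (trans (≈-*ˡ x {m ℕ.* n} {g ℕ.* n} e) (undo g))
    where
    rearrange : ∀ x m n → x ℕ.* (m ℕ.* n) ≡ m ℕ.* (x ℕ.* n)
    rearrange = ℕ-solver.solve-∀
    undo : ∀ m → x ℕ.* (m ℕ.* n) ≈ m
    undo m = trans (≈-≡ (rearrange x m n)) (trans (≈-*ˡ m {x ℕ.* n} {1} xn) (≈-≡ (ℕₚ.*-identityʳ m)))

  quotient : ∀ c n → Unit n → Σ ℕ λ g → g ℕ.* n ≈ c
  quotient c n un with inverse n un
  ... | x , xn = c ℕ.* x , trans (≈-≡ (ℕₚ.*-assoc c x n)) (trans (≈-*ˡ c {x ℕ.* n} {1} xn) (≈-≡ (ℕₚ.*-identityʳ c)))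

  1≤M : 1 ℕ.≤ M
  1≤M = ℕ.>-nonZero⁻¹ M

  -- Representatives are taken from 1 to M, the range of `∑ M`; the class of 0 is represented by M.
  representative : ∀ k → Σ ℕ λ j → 1 ℕ.≤ j × j ℕ.≤ M × j ≈ k
  representative k with k ℕ.% M in eq
  ... | zero  = M , 1≤M , ℕₚ.≤-refl , n%n≡0 M
  ... | suc r = suc r , s≤s z≤n , ℕₚ.<⇒≤ r<M , m<n⇒m%n≡m r<M
    where
    r<M : suc r ℕ.< M
    r<M = subst (ℕ._< M) eq (m%n<n k M)

  representative-unique : ∀ {a b} → 1 ℕ.≤ a → a ℕ.≤ M → 1 ℕ.≤ b → b ℕ.≤ M → a ≈ b → a ≡ b
  representative-unique {a} {b} 1≤a a≤M 1≤b b≤M e with a ℕ.≟ M | b ℕ.≟ M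
  ... | yes refl | yes refl = refl
  ... | yes refl | no b≢    = ⊥-elim (ℕₚ.<⇒≢ 1≤b (trans (sym (n%n≡0 M)) (trans e (m<n⇒m%n≡m (ℕₚ.≤∧≢⇒< b≤M b≢)))))
  ... | no a≢    | yes refl = ⊥-elim
    (ℕₚ.<⇒≢ 1≤a (trans (sym (n%n≡0 M)) (trans (sym e) (m<n⇒m%n≡m (ℕₚ.≤∧≢⇒< a≤M a≢)))))
  ... | no a≢    | no b≢    = trans (sym (m<n⇒m%n≡m (ℕₚ.≤∧≢⇒< a≤M a≢))) (trans e (m<n⇒m%n≡m (ℕₚ.≤∧≢⇒< b≤M b≢)))

  Periodic : (ℕ → ℚ) → Set
  Periodic f = ∀ {a b} → a ≈ b → f a ≡ f b

  class : ℕ → ℕ → ℚ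
  class b n = 𝟙 (n ≈? b)

  class-periodic : ∀ b → Periodic (class b)
  class-periodic b {m} {n} e = 𝟙-cong (m ≈? b) (n ≈? b) (trans (sym e)) (trans e)

  unit : ℕ → ℚ
  unit n = 𝟙 (unit? n)

  unit-periodic : Periodic unit
  unit-periodic {m} {n} e = 𝟙-cong (unit? m) (unit? n) (unit-≈ {m} {n} e) (unit-≈ {n} {m} (sym e))

  class-decomposition : ∀ f → Periodic f → ∀ k → ∑ M (λ b → f b * class b k) ≡ f k
  class-decomposition f pf k with representative k
  ... | j , 1≤j , j≤M , e = trans
    (∑-single-range M _ j 1≤j j≤M (λ b 1≤b b≤M ne → *-zero′ (f b)
    (𝟙-no (k ≈? b) (λ e' → ne (representative-unique 1≤b b≤M 1≤j j≤M (trans (sym e') (sym e)))))))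
    (trans (cong₂ _*_ (pf {j} {k} e) (𝟙-yes (k ≈? j) (sym e))) (*-identityʳ (f k)))

  ∑-class : ∀ s b → Unit s → ∑ M (λ n → class b (s ℕ.* n)) ≡ 1ℚ
  ∑-class s b us with quotient b s us
  ... | g , gs with representative g
  ...   | j , 1≤j , j≤M , e = trans (∑-single-range M _ j 1≤j j≤M (λ n 1≤n n≤M ne → 𝟙-no (s ℕ.* n ≈? b) (λ e' → ne
          (representative-unique 1≤n n≤M 1≤j j≤M
            (≈-cancelʳ {n} {j} s us (trans (≈-≡ (ℕₚ.*-comm n s)) (trans e' (sym js))))))))
        (𝟙-yes (s ℕ.* j ≈? b) (trans (≈-≡ (ℕₚ.*-comm s j)) js))
    where
    js : j ℕ.* s ≈ b
    js = trans (≈-*ʳ s {j} {g} e) gs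

  -- Expanding f over the residue classes reduces this to `∑-class`, so no permutation has to be
  -- constructed.
  ∑-permute : ∀ f → Periodic f → ∀ s → Unit s → ∑ M (λ n → f (s ℕ.* n)) ≡ ∑ M f
  ∑-permute f pf s us = trans (∑-ext M (λ n → sym (class-decomposition f pf (s ℕ.* n))))
    (trans (∑-swap M M (λ n b → f b * class b (s ℕ.* n)))
    (∑-ext M (λ b → trans (∑-*ˡ M (f b) (λ n → class b (s ℕ.* n)))
      (trans (cong (f b *_) (∑-class s b us)) (*-identityʳ (f b))))))

  ∑-period : ∀ f → Periodic f → ∑ M f ≡ 0ℚ → ∀ k → ∑ (k ℕ.* M) f ≡ 0ℚ
  ∑-period f pf z zero    = refl
  ∑-period f pf z (suc k) = trans (cong (λ w → ∑ w f) (ℕₚ.+-comm M (k ℕ.* M))) (trans (∑-shift (k ℕ.* M) M f)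
    (trans (cong₂ _+_ (∑-period f pf z k)
      (trans (∑-ext M (λ i → pf {k ℕ.* M ℕ.+ i} {i} (trans (≈-≡ (ℕₚ.+-comm (k ℕ.* M) i)) ([m+kn]%n≡m%n i k M)))) z))
      (+-identityˡ 0ℚ)))

  ∑-periodic-bound : ∀ f → Periodic f → (∀ n → ∣ f n ∣ ≤ 1ℚ) → ∑ M f ≡ 0ℚ → ∀ w → ∣ ∑ w f ∣ ≤ ι M
  ∑-periodic-bound f pf f≤1 z w = ≤-trans (≤-reflexive (cong ∣_∣ split))
    (≤-trans (∑-abs (w ℕ.% M) _) (≤-trans (∑-mono (w ℕ.% M) (λ i _ _ → f≤1 (w ℕ./ M ℕ.* M ℕ.+ i)))
    (≤-trans (≤-reflexive (trans (∑-const (w ℕ.% M) 1ℚ) (*-identityʳ (ι (w ℕ.% M))))) (ι-mono (ℕₚ.<⇒≤ (m%n<n w M))))))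
    where
    split : ∑ w f ≡ ∑ (w ℕ.% M) (λ i → f (w ℕ./ M ℕ.* M ℕ.+ i))
    split = trans (cong (λ v → ∑ v f) (trans (m≡m%n+[m/n]*n w M) (ℕₚ.+-comm (w ℕ.% M) (w ℕ./ M ℕ.* M))))
      (trans (∑-shift (w ℕ./ M ℕ.* M) (w ℕ.% M) f)
        (trans (cong (_+ ∑ (w ℕ.% M) (λ i → f (w ℕ./ M ℕ.* M ℕ.+ i))) (∑-period f pf z (w ℕ./ M))) (+-identityˡ _)))

  class-difference : ℕ → ℕ → ℕ → ℚ
  class-difference b c n = class b n - class c n

  -- Multiples of a unit m meet both classes once per period. Multiples of a nonunit meet neither,
  -- because b and c are units. In both cases a period sums to 0.
  class-difference-test : ∀ {b c} → Unit b → Unit c → Test (ι M) (class-difference b c)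
  class-difference-test {b} {c} ub uc m _ = ∑-periodic-bound f pf f≤1 zero-sum
    where
    f : ℕ → ℚ
    f n = class-difference b c (m ℕ.* n)
    pf : Periodic f
    pf {x} {y} e = cong₂ _-_ (class-periodic b {m ℕ.* x} {m ℕ.* y} (≈-*ˡ m {x} {y} e))
      (class-periodic c {m ℕ.* x} {m ℕ.* y} (≈-*ˡ m {x} {y} e))
    f≤1 : ∀ n → ∣ f n ∣ ≤ 1ℚ
    f≤1 n with m ℕ.* n ≈? b | m ℕ.* n ≈? c
    ... | yes _ | yes _ = const≥0 1ℚ
    ... | yes _ | no  _ = ≤-refl
    ... | no  _ | yes _ = ≤-refl
    ... | no  _ | no  _ = const≥0 1ℚ
    never : ¬ Unit m → ∀ d → Unit d → ∑ M (λ n → class d (m ℕ.* n)) ≡ 0ℚ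
    never ¬um d ud = ∑-zero M (λ n _ _ → 𝟙-no (m ℕ.* n ≈? d)
      (λ e → ¬um (unit-*⁻ˡ m n (unit-≈ {d} {m ℕ.* n} (sym e) ud))))
    zero-sum : ∑ M f ≡ 0ℚ
    zero-sum with unit? m
    ... | yes um = trans (∑-sub M (λ n → class b (m ℕ.* n)) (λ n → class c (m ℕ.* n)))
      (cong₂ _-_ (∑-class m b um) (∑-class m c um))
    ... | no ¬um = trans (∑-sub M (λ n → class b (m ℕ.* n)) (λ n → class c (m ℕ.* n)))
      (cong₂ _-_ (never ¬um b ub) (never ¬um c uc))

-- Shares of the residue classes among the primes, at several scales.

open Logarithms using (Logarithm)
module Distribution (M : ℕ) {{M≢0 : ℕ.NonZero M}} (Z : ℕ) (log : Logarithm Z) (X : ℕ) where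

  open Rationals
  open Sums
  open Primes
  open Correlation using (correlation)
  open Residues M
  open import Data.Rational
  open import Data.Rational.Properties
  open import Data.Nat.Divisibility using (∣⇒≤)
  open import Data.Nat.Primality using (Prime)

  open Logarithm log

  P : ℕ → (ℕ → ℚ) → ℚ
  P = Mertens.P Z log

  P-mono : ∀ y {φ ψ : ℕ → ℚ} → (∀ n → φ n ≤ ψ n) → P y φ ≤ P y ψ
  P-mono y h = ∑-mono y (λ m _ _ → *-monoˡ (Λ m) (*-monoˡ (inv m) (h m) (inv≥0 m)) (Λ≥0 m))

  P-sub : ∀ y φ ψ → P y (λ n → φ n - ψ n) ≡ P y φ - P y ψ
  P-sub y φ ψ = trans (∑-ext y (λ m → eq (Λ m) (inv m) (φ m) (ψ m)))
    (∑-sub y (λ m → Λ m * (inv m * φ m)) (λ m → Λ m * (inv m * ψ m)))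
    where
    eq : ∀ a b c d → a * (b * (c - d)) ≡ a * (b * c) - a * (b * d)
    eq = solve-∀ ring

  P-*ˡ : ∀ y k φ → P y (λ n → k * φ n) ≡ k * P y φ
  P-*ˡ y k φ = trans (∑-ext y (λ m → eq (Λ m) (inv m) k (φ m))) (∑-*ˡ y k (λ m → Λ m * (inv m * φ m)))
    where
    eq : ∀ a b c d → a * (b * (c * d)) ≡ c * (a * (b * d))
    eq = solve-∀ ring

  P-*ʳ : ∀ y k φ → P y (λ n → φ n * k) ≡ P y φ * k
  P-*ʳ y k φ = trans (∑-ext y (λ m → cong (λ z → Λ m * (inv m * z)) (*-comm (φ m) k)))
    (trans (P-*ˡ y k φ) (*-comm k (P y φ)))

  P≥0 : ∀ y {φ : ℕ → ℚ} → (∀ n → 0ℚ ≤ φ n) → 0ℚ ≤ P y φ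
  P≥0 y h = ∑≥0 y (λ m _ _ → Λ≥0 m ⊠ (inv≥0 m ⊠ h m))

  P-∑ : ∀ y n (φ : ℕ → ℕ → ℚ) → P y (λ m → ∑ n (λ b → φ b m)) ≡ ∑ n (λ b → P y (φ b))
  P-∑ y n φ = trans (∑-ext y (λ m → trans (cong (Λ m *_) (sym (∑-*ˡ n (inv m) (λ b → φ b m))))
    (sym (∑-*ˡ n (Λ m) (λ b → inv m * φ b m)))))
    (∑-swap y n (λ m b → Λ m * (inv m * φ b m)))

  P-swap : ∀ y z (φ : ℕ → ℕ → ℚ) → P y (λ m → P z (φ m)) ≡ P z (λ n → P y (λ m → φ m n))
  P-swap y z φ = trans (∑-ext y (λ m → trans (cong (Λ m *_) (sym (∑-*ˡ z (inv m) _))) (sym (∑-*ˡ z (Λ m) _))))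
    (trans (∑-swap y z (λ m n → Λ m * (inv m * (Λ n * (inv n * φ m n)))))
    (∑-ext z (λ n → trans (∑-ext y (λ m → eq (Λ m) (inv m) (Λ n) (inv n) (φ m n)))
      (trans (∑-*ˡ y (Λ n) (λ m → inv n * (Λ m * (inv m * φ m n))))
        (cong (Λ n *_) (∑-*ˡ y (inv n) (λ m → Λ m * (inv m * φ m n))))))))
    where
    eq : ∀ a b c d f → a * (b * (c * (d * f))) ≡ c * (d * (a * (b * f)))
    eq = solve-∀ ring

  P-ext : ∀ y {φ ψ : ℕ → ℚ} → (∀ k → φ k ≡ ψ k) → P y φ ≡ P y ψ
  P-ext = Mertens.P-ext Z log

  #units : ℚ
  #units = ∑ M unit

  #units≥1 : 1ℚ ≤ #units
  #units≥1 = subst (_≤ #units) (𝟙-yes (unit? 1) unit-1) (∑-term M unit 1 ℕₚ.≤-refl 1≤M (λ b → 𝟙≥0 (unit? b)))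

  module _ (η : ℚ) where

    -- ρ is 1/log y, given as a datum with its defining equation; η is one bound for it at all
    -- scales, and all errors are expressed through η.
    record Scale : Set where
      field
        y    : ℕ
        1≤y  : 1 ℕ.≤ y
        y<Z  : y ℕ.< Z
        y≤X  : y ℕ.≤ X
        ρ    : ℚ
        ρ≥0  : 0ℚ ≤ ρ
        ρ*ℓ  : ρ * ℓ y ≡ 1ℚ
        ρ≤η  : ρ ≤ η

    open Scale

    -- The normalised logarithmic density of the primes up to y in the class of b.
    u : Scale → ℕ → ℚ
    u s b = ρ s * P (y s) (class b)

    mass unit-mass : Scale → ℚ
    mass s = ρ s * P (y s) (λ _ → 1ℚ)
    unit-mass s = ρ s * P (y s) unit

    -- The multiplicative convolution of `u t` and `u s` at the class of c. For a unit c only units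
    -- m and n contribute.
    conv : Scale → Scale → ℕ → ℚ
    conv t s c = ρ t * ρ s * P (y t) (λ m → P (y s) (λ n → class c (m ℕ.* n)))

    u≥0 : ∀ s b → 0ℚ ≤ u s b
    u≥0 s b = ρ≥0 s ⊠ P≥0 (y s) (λ n → 𝟙≥0 (n ≈? b))

    conv≥0 : ∀ t s c → 0ℚ ≤ conv t s c
    conv≥0 t s c = (ρ≥0 t ⊠ ρ≥0 s) ⊠ P≥0 (y t) (λ m → P≥0 (y s) (λ n → 𝟙≥0 (m ℕ.* n ≈? c)))

    η≥0 : Scale → 0ℚ ≤ η
    η≥0 s = ≤-trans (ρ≥0 s) (ρ≤η s)

    mass-upper : ∀ s → mass s ≤ 1ℚ + ι 20 * η
    mass-upper s = lem (ρ s) (ℓ (y s)) (P (y s) (λ _ → 1ℚ)) η (ρ*ℓ s)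
      (Mertens.mertens-upper Z log (y s) (1≤y s) (y<Z s)) (ρ≥0 s) (ρ≤η s)
      where
      lem : ∀ (r l p n : ℚ) → r * l ≡ 1ℚ → p ≤ l + ι 20 → 0ℚ ≤ r → r ≤ n → r * p ≤ 1ℚ + ι 20 * n
      lem r l p n e h k b = ≤by (δ (≤-reflexive e) ⊞ const≥0 (ι 20) ⊠ δ b ⊞ δ h ⊠ δ k)
        (solve (r ∷ l ∷ p ∷ n ∷ []) ring)

    sparse-density : ∀ s B (e : ℕ → ℚ) → (∀ m → 0ℚ ≤ e m) → (∀ m → e m ≤ 1ℚ) →
      (∀ p → Prime p → B ℕ.< p → p ℕ.≤ Z → e p ≡ 0ℚ) → ρ s * P (y s) e ≤ (ι B + ι 4) * η
    sparse-density s B e e≥0 e≤1 sp = lem (ρ s) η (P (y s) e) (ι B)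
      (≤-trans (∑-monoʳ (λ m → Λ m * (inv m * e m)) (ℕₚ.<⇒≤ (y<Z s)) (λ m → Λ≥0 m ⊠ (inv≥0 m ⊠ e≥0 m)))
      (Λ-sparse B e e≥0 e≤1 sp))
        (ρ≥0 s) (ρ≤η s) (ι≥0 B)
      where
      lem : ∀ (r n p b : ℚ) → p ≤ b + ι 4 → 0ℚ ≤ r → r ≤ n → 0ℚ ≤ b → r * p ≤ (b + ι 4) * n
      lem r n p b h k q v = ≤by (const≥0 (ι 4) ⊠ δ q ⊞ δ h ⊠ δ k ⊞ δ q ⊠ δ v) (solve (r ∷ n ∷ p ∷ b ∷ []) ring)

    -- Primes above M are units, so nonunits weigh at most (M + 4) η by `sparse-density`; the lower
    -- Mertens bound costs another 2η.
    unit-mass-lower : ∀ s → 1ℚ - (ι M + ι 6) * η ≤ unit-mass s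
    unit-mass-lower s = lem (ρ s) (ℓ (y s)) (P (y s) (λ _ → 1ℚ)) (P (y s) unit) (P (y s) (λ n → 1ℚ - unit n)) η (ι M)
        (ρ*ℓ s) (Mertens.mertens-lower Z log (y s) (1≤y s) (ℕₚ.<⇒≤ (y<Z s))) (P-sub (y s) (λ _ → 1ℚ) unit)
        (sparse-density s M (λ n → 1ℚ - unit n) (λ n → δ (𝟙≤1 (unit? n))) (λ n → bound (𝟙≥0 (unit? n)))
          (λ p pp M<p _ → cong (λ z → 1ℚ - z) (𝟙-yes (unit? p) (prime-∤⇒coprime pp (λ d → ℕₚ.<⇒≱ M<p (∣⇒≤ d))))))
        (ρ≥0 s) (ρ≤η s)
      where
      bound : ∀ {a : ℚ} → 0ℚ ≤ a → 1ℚ - a ≤ 1ℚ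
      bound {a} h = ≤by (δ h) (solve (a ∷ []) ring)

      lem : ∀ (r l p q t n M : ℚ) → r * l ≡ 1ℚ → l - ι 2 ≤ p → t ≡ p - q → r * t ≤ (M + ι 4) * n → 0ℚ ≤ r → r ≤ n →
        1ℚ - (M + ι 6) * n ≤ r * q
      lem r l p q t n M e h s k a b =
        ≤by (δ (≤-reflexive (sym e)) ⊞ δ k ⊞ const≥0 (ι 2) ⊠ δ b ⊞ δ h ⊠ δ a ⊞ δ
          (≤-reflexive (cong (λ z → z * r) (sym s))))
          (solve (r ∷ l ∷ p ∷ q ∷ t ∷ n ∷ M ∷ []) ring)

    unit-mass-upper : ∀ s → unit-mass s ≤ 1ℚ + ι 20 * η
    unit-mass-upper s = ≤-trans (*-monoˡ (ρ s) (P-mono (y s) (λ n → 𝟙≤1 (unit? n))) (ρ≥0 s)) (mass-upper s)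

    conv-sym : ∀ t s c → conv t s c ≡ conv s t c
    conv-sym t s c = cong₂ _*_ (*-comm (ρ t) (ρ s)) (trans (P-swap (y t) (y s) (λ m n → class c (m ℕ.* n)))
      (P-ext (y s) (λ n → P-ext (y t) (λ m → class-arg c (ℕₚ.*-comm m n)))))
      where
      class-arg : ∀ c {a b} → a ≡ b → class c a ≡ class c b
      class-arg c = cong (class c)

    conv-lower : ∀ t s g h → u t g * u s h ≤ conv t s (g ℕ.* h)
    conv-lower t s g h = ≤-trans (≤-reflexive (trans (eq (ρ t) (P (y t) (class g)) (ρ s) (P (y s) (class h)))
        (cong (ρ t * ρ s *_) (sym (trans (P-ext (y t) (λ m → P-*ˡ (y s) (class g m) (class h)))
          (P-*ʳ (y t) (P (y s) (class h)) (class g)))))))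
      (*-monoˡ (ρ t * ρ s) (P-mono (y t) (λ m → P-mono (y s) (λ n → below m n))) (ρ≥0 t ⊠ ρ≥0 s))
      where
      eq : ∀ a b c d → a * b * (c * d) ≡ a * c * (b * d)
      eq = solve-∀ ring

      below : ∀ m n → class g m * class h n ≤ class (g ℕ.* h) (m ℕ.* n)
      below m n with m ≈? g | n ≈? h
      ... | yes p | yes q = ≤-reflexive (sym (𝟙-yes (m ℕ.* n ≈? g ℕ.* h) (≈-* {m} {g} {n} {h} p q)))
      ... | yes _ | no _  = 𝟙≥0 (m ℕ.* n ≈? g ℕ.* h)
      ... | no _  | yes _ = 𝟙≥0 (m ℕ.* n ≈? g ℕ.* h)
      ... | no _  | no _  = 𝟙≥0 (m ℕ.* n ≈? g ℕ.* h)

    ∑-unit-class : ∀ k → ∑ M (λ b → unit b * class b k) ≡ unit k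
    ∑-unit-class = class-decomposition unit (λ {a} {b} → unit-periodic {a} {b})

    ∑-u : ∀ f → Periodic f → ∀ s → ∑ M (λ b → f b * u s b) ≡ ρ s * P (y s) f
    ∑-u f pf s = trans (∑-ext M (λ b → trans (eq (f b) (ρ s) (P (y s) (class b)))
      (cong (ρ s *_) (sym (P-*ˡ (y s) (f b) (class b))))))
      (trans (∑-*ˡ M (ρ s) (λ b → P (y s) (λ n → f b * class b n)))
        (cong (ρ s *_) (trans (sym (P-∑ (y s) M (λ b n → f b * class b n)))
          (P-ext (y s) (class-decomposition f pf)))))
      where
      eq : ∀ a b c → a * (b * c) ≡ b * (a * c)
      eq = solve-∀ ring

    ∑-unit-u : ∀ s → ∑ M (λ b → unit b * u s b) ≡ unit-mass s
    ∑-unit-u = ∑-u unit (λ {a} {b} → unit-periodic {a} {b})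

    unit-multiplicative : ∀ m n → unit (m ℕ.* n) ≡ unit m * unit n
    unit-multiplicative m n with unit? m | unit? n
    ... | yes um | yes un = 𝟙-yes (unit? (m ℕ.* n)) (unit-* um un)
    ... | yes _  | no ¬un = 𝟙-no (unit? (m ℕ.* n)) (λ z → ¬un (unit-*⁻ʳ m n z))
    ... | no ¬um | yes _  = 𝟙-no (unit? (m ℕ.* n)) (λ z → ¬um (unit-*⁻ˡ m n z))
    ... | no ¬um | no _   = 𝟙-no (unit? (m ℕ.* n)) (λ z → ¬um (unit-*⁻ˡ m n z))

    ∑-unit-conv : ∀ t s → ∑ M (λ c → unit c * conv t s c) ≡ unit-mass t * unit-mass s
    ∑-unit-conv t s = trans (∑-ext M
      (λ c → trans (eq (unit c) (ρ t * ρ s) (P (y t) (λ m → P (y s) (λ n → class c (m ℕ.* n)))))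
          (cong (ρ t * ρ s *_) (trans (sym (P-*ˡ (y t) (unit c) (λ m → P (y s) (λ n → class c (m ℕ.* n)))))
            (P-ext (y t) (λ m → sym (P-*ˡ (y s) (unit c) (λ n → class c (m ℕ.* n)))))))))
      (trans (∑-*ˡ M (ρ t * ρ s) (λ c → P (y t) (λ m → P (y s) (λ n → unit c * class c (m ℕ.* n)))))
      (trans (cong (ρ t * ρ s *_) (trans (sym (P-∑ (y t) M (λ c m → P (y s) (λ n → unit c * class c (m ℕ.* n)))))
        (trans (P-ext (y t) (λ m → trans (sym (P-∑ (y s) M (λ c n → unit c * class c (m ℕ.* n))))
            (trans (P-ext (y s) (λ n → trans (∑-unit-class (m ℕ.* n)) (unit-multiplicative m n)))
              (P-*ˡ (y s) (unit m) unit))))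
          (P-*ʳ (y t) (P (y s) unit) unit))))
        (eq₂ (ρ t) (ρ s) (P (y t) unit) (P (y s) unit))))
      where
      eq : ∀ a b c → a * (b * c) ≡ b * (a * c)
      eq = solve-∀ ring

      eq₂ : ∀ a b c d → a * b * (c * d) ≡ a * c * (b * d)
      eq₂ = solve-∀ ring

    R : Scale → Scale → ℕ → ℚ
    R t s c = u t c + conv t s c

    -- The difference of two unit classes is a test function, so `correlation` applies and is
    -- divided by log y log x. The constant is 164 = 4 + 4 · 20 + 80, as both 1 and `y s` are at
    -- most `ℓ (y t)`.
    R-near-constant : ∀ t s → ι (y s) ≤ ℓ (y t) → 1ℚ ≤ ℓ (y t) → ∀ {c c'} → Unit c → Unit c' →
      ∣ R t s c - R t s c' ∣ ≤ ι 164 * (ι M * η)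
    R-near-constant t s yℓ 1≤ℓ {c} {c'} uc uc' = ≤-trans
      (≤-reflexive (trans (cong ∣_∣ shape) (∣p*q∣≡∣p∣*∣q∣ (ρ t * ρ s) W)))
      (≤-trans (*-mono (≤-reflexive (abs-nonneg (ρ≥0 t ⊠ ρ≥0 s)))
        (correlation Z log X φ (class-difference-test {c} {c'} uc uc') (1≤y s) (ℕₚ.<⇒≤ (y<Z s)) (y≤X s) (1≤y t)
        (y<Z t) (y≤X t)) (0≤∣p∣ (ρ t * ρ s)) (0≤∣p∣ W))
      (lem (ρ t) (ρ s) (ℓ (y t)) (ι (y s)) (ι M) η (ρ*ℓ t) yℓ 1≤ℓ (ρ≥0 t) (ρ≥0 s) (ρ≤η s) (ι≥0 M)))
      where
      φ = class-difference c c'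
      A = λ c → P (y t) (λ m → P (y s) (λ n → class c (m ℕ.* n)))
      W = P (y t) (λ m → P (y s) (λ n → φ (m ℕ.* n))) + ℓ (y s) * P (y t) φ
      lem₀ : ∀ r q a a' p p' l → q * l ≡ 1ℚ →
        (r * p + r * q * a) - (r * p' + r * q * a') ≡ r * q * ((a - a') + l * (p - p'))
      lem₀ r q a a' p p' l e = trans (cong₂ (λ x z → (r * x + r * q * a) - (r * z + r * q * a')) (one p) (one p'))
        (eq r q a a' p p' l)
        where
        one : ∀ p → p ≡ q * l * p
        one p = trans (sym (*-identityˡ p)) (cong (_* p) (sym e))
        eq : ∀ r q a a' p p' l → (r * (q * l * p) + r * q * a) - (r * (q * l * p') + r * q * a') ≡ r * q *
          ((a - a') + l * (p - p'))
        eq = solve-∀ ring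

      shape : R t s c - R t s c' ≡ ρ t * ρ s * W
      shape = trans (lem₀ (ρ t) (ρ s) (A c) (A c') (P (y t) (class c)) (P (y t) (class c')) (ℓ (y s)) (ρ*ℓ s))
        (cong (ρ t * ρ s *_) (sym (cong₂ (λ a b → a + ℓ (y s) * b)
          (trans (P-ext (y t) (λ m → P-sub (y s) (λ n → class c (m ℕ.* n)) (λ n → class c' (m ℕ.* n))))
            (P-sub (y t) (λ m → P (y s) (λ n → class c (m ℕ.* n))) (λ m → P (y s) (λ n → class c' (m ℕ.* n)))))
          (P-sub (y t) (class c) (class c')))))
      mid : ∀ (l n M : ℚ) → n ≤ l → 1ℚ ≤ l → 0ℚ ≤ M → ι 4 * (M * (l + ι 20)) + ι 80 * (M * n) ≤ ι 164 * (M * l)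
      mid l n M h k m = ≤by (const≥0 (ι 80) ⊠ δ h ⊠ δ m ⊞ const≥0 (ι 80) ⊠ δ k ⊠ δ m) (solve (l ∷ n ∷ M ∷ []) ring)

      lem : ∀ r q l n M e → r * l ≡ 1ℚ → n ≤ l → 1ℚ ≤ l → 0ℚ ≤ r → 0ℚ ≤ q → q ≤ e → 0ℚ ≤ M →
        r * q * (ι 4 * (M * (l + ι 20)) + ι 80 * (M * n)) ≤ ι 164 * (M * e)
      lem r q l n M e rl nl 1l r0 q0 qe M0 = ≤-trans (*-monoˡ (r * q) (mid l n M nl 1l M0) (r0 ⊠ q0))
        (≤-trans (≤-reflexive (trans (eq r q l M)
          (trans (cong (λ z → ι 164 * (M * q) * z) rl) (*-identityʳ (ι 164 * (M * q))))))
          (*-monoˡ (ι 164) (*-monoˡ M qe M0) (ι≥0 164)))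
        where
        eq : ∀ r q l M → r * q * (ι 164 * (M * l)) ≡ ι 164 * (M * q) * (r * l)
        eq = solve-∀ ring

    -- Summing over the units identifies the constant: the total is about 1 + 1 · 1 = 2. The masses
    -- contribute an error of at most 4 (M + 26) η ≤ 108Mη, and 164 + 108 = 272.
    R-constant : ∀ κ → κ * #units ≡ ι 2 → (ι M + ι 26) * η ≤ 1ℚ → ∀ t s → ι (y s) ≤ ℓ (y t) → 1ℚ ≤ ℓ (y t) → ∀ {c} →
      Unit c → ∣ R t s c - κ ∣ ≤ ι 272 * (ι M * η)
    R-constant κ κ#≡2 small t s yℓ 1≤ℓ {c} uc = abs≤
        (*-cancelˡ #units (<-≤-trans (ι-pos 0) (≤-trans (≤-reflexive (+-identityʳ 1ℚ)) #units≥1))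
          (lower (R t s c) κ #units (∑ M (λ c' → unit c' * R t s c')) (unit-mass t) (unit-mass s) (ι M) η κ#≡2 total
          (abs-lower gap) (unit-mass-lower t) (unit-mass-lower s) (unit-mass-upper t) (unit-mass-upper s) small
          (η≥0 s) #units≥1 (ι-mono {1} 1≤M)))
        (*-cancelˡ #units (<-≤-trans (ι-pos 0) (≤-trans (≤-reflexive (+-identityʳ 1ℚ)) #units≥1))
          (upper (R t s c) κ #units (∑ M (λ c' → unit c' * R t s c')) (unit-mass t) (unit-mass s) (ι M) η κ#≡2 total
          (abs-upper gap) (unit-mass-lower t) (unit-mass-lower s) (unit-mass-upper t) (unit-mass-upper s) small
          (η≥0 s) #units≥1 (ι-mono {1} 1≤M)))
      where
      total : ∑ M (λ c' → unit c' * R t s c') ≡ unit-mass t + unit-mass t * unit-mass s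
      total = trans (∑-ext M (λ c' → *-distribˡ-+ (unit c') (u t c') (conv t s c')))
        (trans (∑-+ M (λ c' → unit c' * u t c') (λ c' → unit c' * conv t s c'))
        (cong₂ _+_ (∑-unit-u t) (∑-unit-conv t s)))
      pointwise : ∀ c' → ∣ unit c' * (R t s c - R t s c') ∣ ≤ unit c' * (ι 164 * (ι M * η))
      pointwise c' with unit? c'
      ... | yes uc' = ≤-trans (≤-reflexive (cong ∣_∣ (*-identityˡ (R t s c - R t s c'))))
        (≤-trans (R-near-constant t s yℓ 1≤ℓ uc uc') (≤-reflexive (sym (*-identityˡ (ι 164 * (ι M * η))))))
      ... | no _    = ≤-reflexive (trans (cong ∣_∣ (*-zeroˡ (R t s c - R t s c')))
        (sym (*-zeroˡ (ι 164 * (ι M * η)))))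
      eq : ∀ a b c → a * (b - c) ≡ a * b - a * c
      eq = solve-∀ ring

      gap : ∣ #units * R t s c - ∑ M (λ c' → unit c' * R t s c') ∣ ≤ #units * (ι 164 * (ι M * η))
      gap = ≤-trans (≤-reflexive (cong ∣_∣
        (sym (trans (∑-ext M (λ c' → eq (unit c') (R t s c) (R t s c')))
        (trans (∑-sub M (λ c' → unit c' * R t s c) (λ c' → unit c' * R t s c'))
        (cong (_- ∑ M (λ c' → unit c' * R t s c')) (∑-*ʳ M (R t s c) unit)))))))
        (≤-trans (∑-abs M (λ c' → unit c' * (R t s c - R t s c')))
          (≤-trans (∑-mono M (λ c' _ _ → pointwise c')) (≤-reflexive (∑-*ʳ M (ι 164 * (ι M * η)) unit))))
      upper₁ : ∀ (a b M n : ℚ) → a ≤ 1ℚ + ι 20 * n → b ≤ 1ℚ + ι 20 * n → 1ℚ - (M + ι 6) * n ≤ a →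
        1ℚ - (M + ι 6) * n ≤ b → (M + ι 26) * n ≤ 1ℚ → 0ℚ ≤ n → 1ℚ ≤ M → a + a * b ≤ ι 2 + ι 4 * ((M + ι 26) * n)
      upper₁ a b M n a₁ b₁ a₂ b₂ q p m =
        ≤by (const≥0 (ι 1625 * inv 729) ⊠ δ a₁ ⊞ δ b₁ ⊞ const≥0 (ι 896 * inv 729) ⊠ δ a₂ ⊞ δ a₁ ⊠ δ b₂ ⊞ const≥0
          (ι 20) ⊠ δ a₁ ⊠ δ p ⊞ const≥0 (ι 20) ⊠ δ b₁ ⊠ δ p ⊞ const≥0 (ι 400 * inv 27) ⊠ δ q ⊠ δ p ⊞ const≥0
          (ι 2020 * inv 729) ⊠ δ p ⊠ δ m ⊞ δ a₁ ⊠ δ q ⊞ const≥0 (ι 400 * inv 27) ⊠ δ p ⊠ δ p ⊠ δ m)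
          (solve (a ∷ b ∷ M ∷ n ∷ []) ring)

      lower₁ : ∀ (a b M n : ℚ) → a ≤ 1ℚ + ι 20 * n → b ≤ 1ℚ + ι 20 * n → 1ℚ - (M + ι 6) * n ≤ a →
        1ℚ - (M + ι 6) * n ≤ b → (M + ι 26) * n ≤ 1ℚ → 0ℚ ≤ n → 1ℚ ≤ M → ι 2 - ι 4 * ((M + ι 26) * n) ≤ a + a * b
      lower₁ a b M n a₁ b₁ a₂ b₂ q p m =
        ≤by (δ a₁ ⊞ const≥0 (ι 2) ⊠ δ a₂ ⊞ const≥0 (ι 60) ⊠ δ p ⊞ δ a₂ ⊠ δ b₂ ⊞ const≥0 (ι 49 * inv 27) ⊠ δ a₁ ⊠ δ p
          ⊞ const≥0 (ι 589 * inv 27) ⊠ δ a₂ ⊠ δ p ⊞ const≥0 (ι 20) ⊠ δ b₂ ⊠ δ p ⊞ δ a₂ ⊠ δ q ⊞ δ b₂ ⊠ δ q ⊞ const≥0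
          (ι 329 * inv 27) ⊠ δ p ⊠ δ p ⊠ δ m ⊞ δ p ⊠ δ p ⊠ δ m ⊠ δ m)
          (solve (a ∷ b ∷ M ∷ n ∷ []) ring)

      upper₂ : ∀ (r k N S M n : ℚ) → k * N ≡ ι 2 → N * r - S ≤ N * (ι 164 * (M * n)) →
        S ≤ ι 2 + ι 4 * ((M + ι 26) * n) → 0ℚ ≤ n → 1ℚ ≤ N → 1ℚ ≤ M → N * (r - k) ≤ N * (ι 272 * (M * n))
      upper₂ r k N S M n e g w p h m =
        ≤by (δ (≤-reflexive (sym e)) ⊞ δ g ⊞ δ w ⊞ const≥0 (ι 108) ⊠ δ p ⊠ δ h ⊠ δ m ⊞ const≥0 (ι 104) ⊠ δ p ⊠ δ m ⊞
          const≥0 (ι 108) ⊠ δ p ⊠ δ h)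
          (solve (r ∷ k ∷ N ∷ S ∷ M ∷ n ∷ []) ring)

      lower₂ : ∀ (r k N S M n : ℚ) → k * N ≡ ι 2 → - (N * (ι 164 * (M * n))) ≤ N * r - S →
        ι 2 - ι 4 * ((M + ι 26) * n) ≤ S → 0ℚ ≤ n → 1ℚ ≤ N → 1ℚ ≤ M → N * (- (ι 272 * (M * n))) ≤ N * (r - k)
      lower₂ r k N S M n e g w p h m =
        ≤by (δ (≤-reflexive e) ⊞ δ g ⊞ δ w ⊞ const≥0 (ι 108) ⊠ δ p ⊠ δ h ⊠ δ m ⊞ const≥0 (ι 104) ⊠ δ p ⊠ δ m ⊞
          const≥0 (ι 108) ⊠ δ p ⊠ δ h)
          (solve (r ∷ k ∷ N ∷ S ∷ M ∷ n ∷ []) ring)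

      upper : ∀ r k N S a b M n → k * N ≡ ι 2 → S ≡ a + a * b → N * r - S ≤ N * (ι 164 * (M * n)) →
        1ℚ - (M + ι 6) * n ≤ a → 1ℚ - (M + ι 6) * n ≤ b → a ≤ 1ℚ + ι 20 * n → b ≤ 1ℚ + ι 20 * n →
        (M + ι 26) * n ≤ 1ℚ → 0ℚ ≤ n → 1ℚ ≤ N → ι 1 ≤ M → N * (r - k) ≤ N * (ι 272 * (M * n))
      upper r k N S a b M n e refl g a₂ b₂ a₁ b₁ q p h m = upper₂ r k N S M n e g (upper₁ a b M n a₁ b₁ a₂ b₂ q p m)
        p h m
      lower : ∀ r k N S a b M n → k * N ≡ ι 2 → S ≡ a + a * b → - (N * (ι 164 * (M * n))) ≤ N * r - S →
        1ℚ - (M + ι 6) * n ≤ a → 1ℚ - (M + ι 6) * n ≤ b → a ≤ 1ℚ + ι 20 * n → b ≤ 1ℚ + ι 20 * n →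
        (M + ι 26) * n ≤ 1ℚ → 0ℚ ≤ n → 1ℚ ≤ N → ι 1 ≤ M → N * (- (ι 272 * (M * n))) ≤ N * (r - k)
      lower r k N S a b M n e refl g a₂ b₂ a₁ b₁ q p h m = lower₂ r k N S M n e g (lower₁ a b M n a₁ b₁ a₂ b₂ q p m)
        p h m

    -- Since c is a sum over the classes g h = c, a defect K - u t g can only be afforded where u s h is small.
    defect : ∀ K → 0ℚ ≤ K → ∀ t s → (∀ {g} → Unit g → u t g ≤ K) → ∀ {c g h} → Unit c → g ℕ.* h ≈ c →
      u s h * (K - u t g) ≤ K * mass s - conv t s c
    defect K K≥0 t s u≤K {c} {g} {h} uc gh≈c = ≤-trans
      (≤-reflexive (trans (assoc (ρ s) (P (y s) (class h)) (K - u t g))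
      (cong (ρ s *_) (sym (P-*ʳ (y s) (K - u t g) (class h))))))
      (≤-trans (*-monoˡ (ρ s) (P-mono (y s) term) (ρ≥0 s)) (≤-reflexive total))
      where
      assoc : ∀ a b c → a * b * c ≡ a * (b * c)
      assoc = solve-∀ ring

      V : ℕ → ℚ
      V n = ρ t * P (y t) (λ m → class c (m ℕ.* n))
      V-unit : ∀ {n k} → Unit n → k ℕ.* n ≈ c → V n ≡ u t k
      V-unit {n} {k} un kn≈c = cong (ρ t *_) (P-ext (y t) (λ m → 𝟙-cong (m ℕ.* n ≈? c) (m ≈? k)
        (λ e → ≈-cancelʳ {m} {k} n un (trans e (sym kn≈c))) (λ e → trans (≈-*ʳ n {m} {k} e) kn≈c)))
      V≤K : ∀ n → V n ≤ K
      V≤K n with unit? n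
      ... | yes un = let (k , kn≈c) = quotient c n un in subst (_≤ K) (sym (V-unit {n} {k} un kn≈c)) (u≤K (unit-*⁻ˡ k n (unit-≈ {c} {k ℕ.* n} (sym kn≈c) uc)))
      ... | no ¬un = ≤-trans (≤-reflexive
        (trans (cong (ρ t *_) (∑-zero (y t) (λ m _ _ → *-zero′ (Λ m) (*-zero′ (inv m)
            (𝟙-no (m ℕ.* n ≈? c) (λ e → ¬un (unit-*⁻ʳ m n (unit-≈ {c} {m ℕ.* n} (sym e) uc)))))))) (*-zeroʳ (ρ t))))
              K≥0
      uh : Unit h
      uh = unit-*⁻ʳ g h (unit-≈ {c} {g ℕ.* h} (sym gh≈c) uc)
      term : ∀ n → class h n * (K - u t g) ≤ K - V n
      term n with n ≈? h
      ... | yes e = ≤-reflexive (trans (*-identityˡ (K - u t g))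
        (cong (λ z → K - z) (sym (V-unit {n} {g} (unit-≈ {h} {n} (sym e) uh) (trans (≈-*ˡ g {n} {h} e) gh≈c)))))
      ... | no _  = ≤-trans (≤-reflexive (*-zeroˡ (K - u t g))) (δ (V≤K n))
      total : ρ s * P (y s) (λ n → K - V n) ≡ K * mass s - conv t s c
      total = trans (cong (ρ s *_) (trans (P-sub (y s) (λ _ → K) V)
        (cong₂ _-_ (trans (P-ext (y s) (λ _ → sym (*-identityʳ K))) (P-*ˡ (y s) K (λ _ → 1ℚ)))
        (P-*ˡ (y s) (ρ t) (λ n → P (y t) (λ m → class c (m ℕ.* n)))))))
        (trans (eq (ρ s) K (P (y s) (λ _ → 1ℚ)) (ρ t) (P (y s) (λ n → P (y t) (λ m → class c (m ℕ.* n)))))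
          (cong (λ z → K * mass s - ρ t * ρ s * z) (sym (P-swap (y t) (y s) (λ m n → class c (m ℕ.* n))))))
        where
        eq : ∀ a b c d e → a * (b * c - d * e) ≡ b * (a * c) - d * a * e
        eq = solve-∀ ring

-- A nearly empty class forces a real character χ with P χ close to - log.

module Dichotomy (M : ℕ) {{M≢0 : ℕ.NonZero M}} (Z : ℕ) (log : Logarithm Z) (X : ℕ) where

  open Rationals
  open Sums
  open Mertens using (Test; L)
  open Residues M
  open Distribution M Z log X
  open Nonvanishing using (RealCharacter; ∣χ∣≤1; L-lower; ratio; side)
  open import Data.Rational
  open import Data.Rational.Properties
  open import Relation.Nullary.Decidable using (_×-dec_; toWitness)

  open Logarithm log

  ¬≤-fraction : ∀ {x} c → c < 1ℚ → 0ℚ < x → ¬ (x ≤ c * x)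
  ¬≤-fraction {x} c c<1 x>0 h = <⇒≱ c<1
    (*-cancelˡ x x>0 (≤-trans (≤-reflexive (*-identityʳ x)) (≤-trans h (≤-reflexive (*-comm c x)))))

  -- At s₂ and s₃ the class a is nearly empty, and the convolution of these two scales carries the
  -- argument. s₁ mediates the comparison of `u` at s₂ and s₃, and s₀ lies below the others to bound
  -- `u` by K at each of them.
  module _ {η : ℚ} (s₀ s₁ s₂ s₃ : Scale η) where

    open Scale

    module _ (κ δ₀ : ℚ) (κ>0 : 0ℚ < κ) (κ# : κ * #units ≡ ι 2)
      (δ-small : ι 1000 * δ₀ ≤ κ * κ * κ)
      (272Mη≤δ : ι 272 * (ι M * η) ≤ δ₀) (mass-δ : (ι M + ι 26) * η ≤ δ₀)
      (1≤ℓ : ∀ s → 1ℚ ≤ ℓ (y {η} s))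
      (y₀₁ : ι (y s₀) ≤ ℓ (y s₁)) (y₀₂ : ι (y s₀) ≤ ℓ (y s₂)) (y₀₃ : ι (y s₀) ≤ ℓ (y s₃))
      (y₁₂ : ι (y s₁) ≤ ℓ (y s₂)) (y₁₃ : ι (y s₁) ≤ ℓ (y s₃)) (y₂₃ : ι (y s₂) ≤ ℓ (y s₃))
      {a : ℕ} (ua : Unit a) (a₂ : u η s₂ a ≤ δ₀) (a₃ : u η s₃ a ≤ δ₀)
      where

      K : ℚ
      K = κ + δ₀

      η0 : 0ℚ ≤ η
      η0 = η≥0 η s₀

      κ≥0 : 0ℚ ≤ κ
      κ≥0 = <⇒≤ κ>0

      δ≥0 : 0ℚ ≤ δ₀
      δ≥0 = ≤-trans (const≥0 (ι 272) ⊠ (ι≥0 M ⊠ η0)) 272Mη≤δ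

      κ≤2 : κ ≤ ι 2
      κ≤2 = lem κ #units κ# #units≥1 κ≥0
        where
        lem : ∀ (k n : ℚ) → k * n ≡ ι 2 → 1ℚ ≤ n → 0ℚ ≤ k → k ≤ ι 2
        lem k n e h p = ≤by (δ (≤-reflexive e) ⊞ δ h ⊠ δ p) (solve (k ∷ n ∷ []) ring)

      κ≤K : κ ≤ K
      κ≤K = lem κ δ≥0
        where
        lem : ∀ (k : ℚ) {d : ℚ} → 0ℚ ≤ d → k ≤ k + d
        lem k {d} h = ≤by (δ h) (solve (k ∷ d ∷ []) ring)

      K>0 : 0ℚ < K
      K>0 = <-≤-trans κ>0 κ≤K

      K≥0 : 0ℚ ≤ K
      K≥0 = <⇒≤ K>0

      δ≤K³ : ι 1000 * δ₀ ≤ K * K * K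
      δ≤K³ = ≤-trans δ-small (*-mono (*-mono κ≤K κ≤K κ≥0 κ≥0) κ≤K (κ≥0 ⊠ κ≥0) κ≥0)

      κ³≤2κ² : κ * κ * κ ≤ κ * κ * ι 2
      κ³≤2κ² = *-monoˡ (κ * κ) κ≤2 (κ≥0 ⊠ κ≥0)

      κ²≤4 : κ * κ ≤ ι 4
      κ²≤4 = *-mono κ≤2 κ≤2 κ≥0 κ≥0

      δ-tiny : ι 100 * δ₀ ≤ 1ℚ
      δ-tiny = lem {d = δ₀} {q = κ * κ} δ-small κ³≤2κ² κ²≤4
        where
        lem : ∀ {d c q : ℚ} → ι 1000 * d ≤ c → c ≤ q * ι 2 → q ≤ ι 4 → ι 100 * d ≤ 1ℚ
        lem {d} {c} {q} h k l =
          ≤by (const≥0 (inv 10) ⊠ δ h ⊞ const≥0 (inv 10) ⊠ δ k ⊞ const≥0 (inv 5) ⊠ δ l ⊞ const≥0 (inv 5))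
            (solve (d ∷ c ∷ q ∷ []) ring)

      δ≤K² : ι 200 * δ₀ ≤ K * K
      δ≤K² = ≤-trans (lem {d = δ₀} {q = κ * κ} δ-small κ³≤2κ² δ≥0) (*-mono κ≤K κ≤K κ≥0 κ≥0)
        where
        lem : ∀ {d c q : ℚ} → ι 1000 * d ≤ c → c ≤ q * ι 2 → 0ℚ ≤ d → ι 200 * d ≤ q
        lem {d} {c} {q} h k p =
          ≤by (const≥0 (inv 2) ⊠ δ h ⊞ const≥0 (inv 2) ⊠ δ k ⊞ const≥0 (ι 300) ⊠ δ p)
            (solve (d ∷ c ∷ q ∷ []) ring)

      K≤3 : K ≤ ι 3
      K≤3 = lem {d = δ₀} κ≤2 δ-tiny δ≥0
        where
        lem : ∀ {k d : ℚ} → k ≤ ι 2 → ι 100 * d ≤ 1ℚ → 0ℚ ≤ d → k + d ≤ ι 3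
        lem {k} {d} h e p = ≤by (δ h ⊞ δ e ⊞ const≥0 (ι 99) ⊠ δ p) (solve (k ∷ d ∷ []) ring)

      mass≤ : ∀ s → mass η s ≤ 1ℚ + δ₀
      mass≤ s = lem (ι M) η (mass-upper η s) mass-δ (ι≥0 M) η0
        where
        lem : ∀ (M n : ℚ) {m d : ℚ} → m ≤ 1ℚ + ι 20 * n → (M + ι 26) * n ≤ d → 0ℚ ≤ M → 0ℚ ≤ n → m ≤ 1ℚ + d
        lem M n {m} {d} h k p q = ≤by (δ h ⊞ δ k ⊞ const≥0 (ι 6) ⊠ δ q ⊞ δ p ⊠ δ q) (solve (M ∷ n ∷ m ∷ d ∷ []) ring)

      Near : Scale η → Scale η → Set
      Near t s = ∀ {c} → Unit c → (u η t c + conv η t s c ≤ K) × (κ - δ₀ ≤ u η t c + conv η t s c)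

      near : ∀ {t s} → ι (y s) ≤ ℓ (y t) → Near t s
      near {t} {s} h {c} uc = up (abs-upper bound) , down (abs-lower bound)
        where
        bound = ≤-trans (R-constant η κ κ# (≤-trans mass-δ (tiny {d = δ₀} δ-tiny δ≥0)) t s h (1≤ℓ t) uc) 272Mη≤δ
          where
          tiny : ∀ {d : ℚ} → ι 100 * d ≤ 1ℚ → 0ℚ ≤ d → d ≤ 1ℚ
          tiny {d} h p = ≤by (δ h ⊞ const≥0 (ι 99) ⊠ δ p) (solve (d ∷ []) ring)

        up : ∀ {r k d : ℚ} → r - k ≤ d → r ≤ k + d
        up {r} {k} {d} h = ≤by (δ h) (solve (r ∷ k ∷ d ∷ []) ring)

        down : ∀ {r k d : ℚ} → - d ≤ r - k → k - d ≤ r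
        down {r} {k} {d} h = ≤by (δ h) (solve (r ∷ k ∷ d ∷ []) ring)

      Bounded : Scale η → Set
      Bounded t = ∀ {g} → Unit g → u η t g ≤ K

      bounded : ∀ {t s} → Near t s → Bounded t
      bounded {t} {s} n {g} ug = lem {b = conv η t s g} (proj₁ (n ug)) (conv≥0 η t s g)
        where
        lem : ∀ {x b k : ℚ} → x + b ≤ k → 0ℚ ≤ b → x ≤ k
        lem {x} {b} {k} h p = ≤by (δ h ⊞ δ p) (solve (x ∷ b ∷ k ∷ []) ring)

      b₁ : Bounded s₁
      b₁ = bounded {s₁} {s₀} (near {s₁} {s₀} y₀₁)

      b₂ : Bounded s₂
      b₂ = bounded {s₂} {s₀} (near {s₂} {s₀} y₀₂)

      b₃ : Bounded s₃
      b₃ = bounded {s₃} {s₀} (near {s₃} {s₀} y₀₃)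

      -- As `u η t a` is at most δ₀, the convolution at a is at least κ - 2δ₀, while K (1 + δ₀) is
      -- all that the mass allows. `defect` passes this near-equality on to every factorisation gh =
      -- a. With K ≤ 3 the gap is δ₀ + 3δ₀ + 2δ₀.
      pair : ∀ {t s} → Near t s → Bounded t → Bounded s → u η t a ≤ δ₀ → ∀ {g h} → g ℕ.* h ≈ a →
        (u η s h * (K - u η t g) ≤ ι 6 * δ₀) × (u η t g * (K - u η s h) ≤ ι 6 * δ₀)
      pair {t} {s} n bt bs at {g} {h} gh≈a =
          ≤-trans (defect η K K≥0 t s bt {a} {g} {h} ua gh≈a)
            (lem K κ δ₀ (mass η s) (conv η t s a) (u η t a) refl (mass≤ s) (proj₂ (n ua)) at K≥0 K≤3 δ≥0)
        , ≤-trans (defect η K K≥0 s t bs {a} {h} {g} ua (trans (≈-≡ (ℕₚ.*-comm h g)) gh≈a))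
          (lem K κ δ₀ (mass η t) (conv η s t a) (u η t a) refl (mass≤ t)
          (subst (λ z → κ - δ₀ ≤ u η t a + z) (conv-sym η t s a) (proj₂ (n ua))) at K≥0 K≤3 δ≥0)
        where
        lem : ∀ (K k d m c x : ℚ) → K ≡ k + d → m ≤ 1ℚ + d → k - d ≤ x + c → x ≤ d → 0ℚ ≤ K → K ≤ ι 3 → 0ℚ ≤ d →
          K * m - c ≤ ι 6 * d
        lem K k d m c x e h l v p q r =
          ≤by (δ (≤-reflexive e) ⊞ δ l ⊞ δ v ⊞ δ p ⊠ δ h ⊞ δ q ⊠ δ r)
            (solve (K ∷ k ∷ d ∷ m ∷ c ∷ x ∷ []) ring)

      compare : ∀ {K p q d} → p * (K - q) ≤ d → q * (K - p) ≤ d → 0ℚ ≤ p → 0ℚ ≤ q → p ≤ K → q ≤ K →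
        (K * (p - q) ≤ d) × (K * (q - p) ≤ d)
      compare {K} {p} {q} {d} h k p0 q0 pK qK = lem K p q d h q0 pK , lem K q p d k p0 qK
        where
        lem : ∀ (K p q d : ℚ) → p * (K - q) ≤ d → 0ℚ ≤ q → p ≤ K → K * (p - q) ≤ d
        lem K p q d h q0 pK = ≤by (δ h ⊞ δ q0 ⊠ δ pK) (solve (K ∷ p ∷ q ∷ d ∷ []) ring)

      -- Both values are compared, by way of a, with the value at s₁ of the complementary class h =
      -- a/g.
      u₂≈u₃ : ∀ {g} → Unit g → (K * (u η s₃ g - u η s₂ g) ≤ ι 12 * δ₀) × (K * (u η s₂ g - u η s₃ g) ≤ ι 12 * δ₀)
      u₂≈u₃ {g} ug = join K q r p {δ₀} (proj₂ c₃) (proj₁ c₂) , join K r q p {δ₀} (proj₂ c₂) (proj₁ c₃)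
        where
        h = proj₁ (quotient a g ug)
        gh≈a : g ℕ.* h ≈ a
        gh≈a = trans (≈-≡ (ℕₚ.*-comm g h)) (proj₂ (quotient a g ug))
        uh : Unit h
        uh = unit-*⁻ʳ g h (unit-≈ {a} {g ℕ.* h} (sym gh≈a) ua)
        p = u η s₁ h
        q = u η s₃ g
        r = u η s₂ g
        π₃ = pair {s₃} {s₁} (near {s₃} {s₁} y₁₃) b₃ b₁ a₃ {g} {h} gh≈a
        π₂ = pair {s₂} {s₁} (near {s₂} {s₁} y₁₂) b₂ b₁ a₂ {g} {h} gh≈a
        c₃ = compare {K} {p} {q} (proj₁ π₃) (proj₂ π₃) (u≥0 η s₁ h) (u≥0 η s₃ g) (b₁ uh) (b₃ ug)
        c₂ = compare {K} {p} {r} (proj₁ π₂) (proj₂ π₂) (u≥0 η s₁ h) (u≥0 η s₂ g) (b₁ uh) (b₂ ug)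
        join : ∀ (K x z w : ℚ) {d : ℚ} → K * (x - w) ≤ ι 6 * d → K * (w - z) ≤ ι 6 * d → K * (x - z) ≤ ι 12 * d
        join K x z w {d} h k = ≤by (δ h ⊞ δ k) (solve (K ∷ x ∷ z ∷ w ∷ d ∷ []) ring)

      -- `pair` bounds q (K - p), where q is the value of g at s₃ and p that of a/g at s₂; `compare`
      -- allows p to be replaced by q. Both factors then refer to one class at one scale.
      concentrated : ∀ {g} → Unit g → u η s₃ g * (K - u η s₃ g) ≤ ι 12 * δ₀
      concentrated {g} ug = *-cancelˡ K K>0 (lem K p q δ₀ (proj₂ π) (proj₁ c) (u≥0 η s₃ g) (b₃ ug) K≥0 δ≥0)
        where
        h = proj₁ (quotient a g ug)
        gh≈a : g ℕ.* h ≈ a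
        gh≈a = trans (≈-≡ (ℕₚ.*-comm g h)) (proj₂ (quotient a g ug))
        uh : Unit h
        uh = unit-*⁻ʳ g h (unit-≈ {a} {g ℕ.* h} (sym gh≈a) ua)
        p = u η s₂ h
        q = u η s₃ g
        π = pair {s₃} {s₂} (near {s₃} {s₂} y₂₃) b₃ b₂ a₃ {g} {h} gh≈a
        c = compare {K} {p} {q} (proj₁ π) (proj₂ π) (u≥0 η s₂ h) (u≥0 η s₃ g) (b₂ uh) (b₃ ug)
        lem : ∀ (K p q d : ℚ) → q * (K - p) ≤ ι 6 * d → K * (p - q) ≤ ι 6 * d → 0ℚ ≤ q → q ≤ K → 0ℚ ≤ K → 0ℚ ≤ d →
          K * (q * (K - q)) ≤ K * (ι 12 * d)
        lem K p q d h k q0 qK K0 d0 =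
          ≤by (δ K0 ⊠ δ h ⊞ δ q0 ⊠ δ k ⊞ const≥0 (ι 6) ⊠ δ qK ⊠ δ d0)
            (solve (K ∷ p ∷ q ∷ d ∷ []) ring)

      -- On the units u η s₃ is close to 0 or to K; the charged classes are those of the second kind.
      Charged : ℕ → Set
      Charged c = K * inv 4 ≤ u η s₃ c

      charged? : ∀ c → Dec (Charged c)
      charged? c = K * inv 4 ≤? u η s₃ c

      charged-high : ∀ {g} → Unit g → Charged g → K * (K - u η s₃ g) ≤ ι 48 * δ₀
      charged-high {g} ug cg = lem K (u η s₃ g) δ₀ (concentrated ug) cg (b₃ ug)
        where
        lem : ∀ (K q d : ℚ) → q * (K - q) ≤ ι 12 * d → K * inv 4 ≤ q → q ≤ K → K * (K - q) ≤ ι 48 * d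
        lem K q d h k l = ≤by (const≥0 (ι 4) ⊠ δ h ⊞ const≥0 (ι 4) ⊠ δ k ⊠ δ l) (solve (K ∷ q ∷ d ∷ []) ring)

      uncharged-low : ∀ {g} → Unit g → ¬ Charged g → K * u η s₃ g ≤ ι 16 * δ₀
      uncharged-low {g} ug ¬cg = lem K (u η s₃ g) δ₀ (concentrated ug) (<⇒≤ (≰⇒> ¬cg)) (u≥0 η s₃ g)
        where
        lem : ∀ (K q d : ℚ) → q * (K - q) ≤ ι 12 * d → q ≤ K * inv 4 → 0ℚ ≤ q → K * q ≤ ι 16 * d
        lem K q d h k l =
          ≤by (const≥0 (ι 4 * inv 3) ⊠ δ h ⊞ const≥0 (ι 4 * inv 3) ⊠ δ k ⊠ δ l)
            (solve (K ∷ q ∷ d ∷ []) ring)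

      half₃ : ∀ {s} → Unit s → Charged s → K * K * ½ ≤ K * u η s₃ s
      half₃ {s} us cs = lem K (u η s₃ s) δ₀ (charged-high us cs) δ≤K² δ≥0
        where
        lem : ∀ (K q d : ℚ) → K * (K - q) ≤ ι 48 * d → ι 200 * d ≤ K * K → 0ℚ ≤ d → K * K * ½ ≤ K * q
        lem K q d h k p = ≤by (δ h ⊞ const≥0 (inv 2) ⊠ δ k ⊞ const≥0 (ι 52) ⊠ δ p) (solve (K ∷ q ∷ d ∷ []) ring)

      half₂ : ∀ {s} → Unit s → Charged s → K * K * ½ ≤ K * u η s₂ s
      half₂ {s} us cs = lem K (u η s₃ s) (u η s₂ s) δ₀ (charged-high us cs) (proj₁ (u₂≈u₃ us)) δ≤K² δ≥0
        where
        lem : ∀ (K q r d : ℚ) → K * (K - q) ≤ ι 48 * d → K * (q - r) ≤ ι 12 * d → ι 200 * d ≤ K * K → 0ℚ ≤ d →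
          K * K * ½ ≤ K * r
        lem K q r d h l k p =
          ≤by (δ h ⊞ δ l ⊞ const≥0 (inv 2) ⊠ δ k ⊞ const≥0 (ι 40) ⊠ δ p)
            (solve (K ∷ q ∷ r ∷ d ∷ []) ring)

      -- If st were charged, its value near K would leave almost no room under `u` + `conv` ≤ K; yet
      -- the single factorisation into s and t already contributes (K/2)² to the convolution.
      charged-charged : ∀ {s t} → Unit s → Unit t → Charged s → Charged t → ¬ Charged (s ℕ.* t)
      charged-charged {s} {t} us ut cs ct cc = ¬≤-fraction ½ (toWitness {a? = ½ <? 1ℚ} _)
        (*-pos (*-pos (*-pos K>0 K>0) K>0) K>0)
          (lem K δ₀ (u η s₃ s) (u η s₂ t) (u η s₃ (s ℕ.* t)) (conv η s₃ s₂ (s ℕ.* t)) (half₃ us cs) (half₂ ut ct)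
            (conv-lower η s₃ s₂ s t)
            (proj₁ (near {s₃} {s₂} y₂₃ (unit-* us ut))) (charged-high (unit-* us ut) cc) δ≤K³ K≥0 (K≥0 ⊠ K≥0)
              (K≥0 ⊠ u≥0 η s₃ s))
        where
        half-product : ∀ K A B → K * K * ½ ≤ A → K * K * ½ ≤ B → 0ℚ ≤ K * K → 0ℚ ≤ A → K * K * ½ * (K * K * ½) ≤ A * B
        half-product K A B h k p q = *-mono h k (p ⊠ const≥0 ½) (p ⊠ const≥0 ½)
        lem₁ : ∀ (K d q r w c : ℚ) → K * K * ½ * (K * K * ½) ≤ K * q * (K * r) → q * r ≤ c → w + c ≤ K →
          K * (K - w) ≤ ι 48 * d → ι 1000 * d ≤ K * K * K → 0ℚ ≤ K → 0ℚ ≤ K * K → 0ℚ ≤ K * K * K * K →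
          K * K * K * K ≤ ½ * (K * K * K * K)
        lem₁ K d q r w c h l n v D p pp p⁴ =
          ≤by (const≥0 (ι 250 * inv 101) ⊠ δ h ⊞ const≥0 (ι 250 * inv 101) ⊠ δ l ⊠ δ pp ⊞ const≥0 (ι 250 * inv 101) ⊠
            δ n ⊠ δ pp ⊞ const≥0 (ι 250 * inv 101) ⊠ δ v ⊠ δ p ⊞ const≥0 (ι 12 * inv 101) ⊠ δ D ⊠ δ p)
            (solve (K ∷ d ∷ q ∷ r ∷ w ∷ c ∷ []) ring)

        lem : ∀ K d q r w c → K * K * ½ ≤ K * q → K * K * ½ ≤ K * r → q * r ≤ c → w + c ≤ K →
          K * (K - w) ≤ ι 48 * d → ι 1000 * d ≤ K * K * K →
          0ℚ ≤ K → 0ℚ ≤ K * K → 0ℚ ≤ K * q → K * K * K * K ≤ ½ * (K * K * K * K)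
        lem K d q r w c h k l n v D p pp kq = lem₁ K d q r w c (half-product K (K * q) (K * r) h k pp kq) l n v D p
          pp (pp ⊠ p ⊠ p)

      -- An uncharged c is nearly empty and so plays the role of a: the convolution is almost
      -- maximal at c, and `defect` drives the value of g towards K because that of t is large.
      uncharged-quotient : ∀ {c g t} → Unit c → Unit t → ¬ Charged c → Charged t → g ℕ.* t ≈ c → Charged g
      uncharged-quotient {c} {g} {t} uc ut ¬cc ct gt≈c = conclude (charged? g)
        where
        lem₁ : ∀ (K k d p q x m c : ℚ) → K ≡ k + d → p * (K - q) ≤ K * m - c → m ≤ 1ℚ + d → k - d ≤ x + c → 0ℚ ≤ K →
          p * (K - q) ≤ ι 2 * d + K * d + x
        lem₁ K k d p q x m c e h h₁ h₂ K0 =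
          ≤by (δ (≤-reflexive e) ⊞ δ h ⊞ δ h₂ ⊞ δ h₁ ⊠ δ K0)
            (solve (K ∷ k ∷ d ∷ p ∷ q ∷ x ∷ m ∷ c ∷ []) ring)

        lem₂ : ∀ (K d p q x : ℚ) → p * (K - q) ≤ ι 2 * d + K * d + x → K * K * ½ ≤ K * p → K * x ≤ ι 16 * d →
          q ≤ K * inv 4 → ι 1000 * d ≤ K * K * K → 0ℚ ≤ K → K ≤ ι 3 → 0ℚ ≤ d → 0ℚ ≤ p → K * K * K ≤ ½ * (K * K * K)
        lem₂ K d p q x h h₃ h₄ h₅ D K0 K3 d0 p0 =
          ≤by (const≥0 (ι 125 * inv 86) ⊠ δ h₄ ⊞ const≥0 (ι 31 * inv 688) ⊠ δ D ⊞ const≥0 (ι 125 * inv 86) ⊠ δ h ⊠ δ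
            K0 ⊞ const≥0 (ι 375 * inv 344) ⊠ δ h₃ ⊠ δ K0 ⊞ const≥0 (ι 125 * inv 86) ⊠ δ h₅ ⊠ δ p0 ⊠ δ K0 ⊞ const≥0
            (ι 625 * inv 86) ⊠ δ K3 ⊠ δ d0 ⊞ const≥0 (ι 125 * inv 86) ⊠ δ K3 ⊠ δ d0 ⊠ δ K0)
            (solve (K ∷ d ∷ p ∷ q ∷ x ∷ []) ring)

        lem : ∀ K k d p q x m c → K ≡ k + d → p * (K - q) ≤ K * m - c → m ≤ 1ℚ + d → k - d ≤ x + c →
          K * K * ½ ≤ K * p → K * x ≤ ι 16 * d → q ≤ K * inv 4 →
          ι 1000 * d ≤ K * K * K → 0ℚ ≤ K → K ≤ ι 3 → 0ℚ ≤ d → 0ℚ ≤ p → K * K * K ≤ ½ * (K * K * K)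
        lem K k d p q x m c e h h₁ h₂ h₃ h₄ h₅ D K0 K3 d0 p0 = lem₂ K d p q x (lem₁ K k d p q x m c e h h₁ h₂ K0) h₃
          h₄ h₅ D K0 K3 d0 p0
        conclude : Dec (Charged g) → Charged g
        conclude (yes cg) = cg
        conclude (no ¬cg) = ⊥-elim (¬≤-fraction ½ (toWitness {a? = ½ <? 1ℚ} _) (*-pos (*-pos K>0 K>0) K>0)
          (lem K κ δ₀ (u η s₂ t) (u η s₃ g) (u η s₃ c) (mass η s₂) (conv η s₃ s₂ c) refl
            (defect η K K≥0 s₃ s₂ b₃ {c} {g} {t} uc gt≈c) (mass≤ s₂) (proj₂ (near {s₃} {s₂} y₂₃ uc))
            (half₂ ut ct) (uncharged-low uc ¬cc) (<⇒≤ (≰⇒> ¬cg)) δ≤K³ K≥0 K≤3 δ≥0 (u≥0 η s₂ t)))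

      #δ-bound : ι 1000 * (δ₀ * #units) ≤ κ * κ * ι 2
      #δ-bound = lem κ #units δ₀ δ-small κ# (≤-trans (const≥0 1ℚ) #units≥1)
        where
        lem : ∀ (k n d : ℚ) → ι 1000 * d ≤ k * k * k → k * n ≡ ι 2 → 0ℚ ≤ n → ι 1000 * (d * n) ≤ k * k * ι 2
        lem k n d h e p = ≤by (δ h ⊠ δ p ⊞ δ (≤-reflexive (cong (λ z → z * ((k * k))) e)))
          (solve (k ∷ n ∷ d ∷ []) ring)

      unit-mass≥ : 1ℚ - δ₀ ≤ unit-mass η s₃
      unit-mass≥ = ≤-trans (lem (ι M) η mass-δ η0) (unit-mass-lower η s₃)
        where
        lem : ∀ (M n : ℚ) {d : ℚ} → (M + ι 26) * n ≤ d → 0ℚ ≤ n → 1ℚ - d ≤ 1ℚ - (M + ι 6) * n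
        lem M n {d} h q = ≤by (δ h ⊞ const≥0 (ι 20) ⊠ δ q) (solve (M ∷ n ∷ d ∷ []) ring)

      low-sum : ∀ b → ¬ Charged b → unit b * (K * u η s₃ b) ≤ unit b * (ι 16 * δ₀)
      low-sum b ¬cb = cases (unit? b)
        where
        cases : Dec (Unit b) → unit b * (K * u η s₃ b) ≤ unit b * (ι 16 * δ₀)
        cases (yes ub) = *-monoˡ (unit b) (uncharged-low ub ¬cb) (𝟙≥0 (unit? b))
        cases (no ¬ub) = ≤-reflexive (trans (zero-* (K * u η s₃ b) (𝟙-no (unit? b) ¬ub))
          (sym (zero-* (ι 16 * δ₀) (𝟙-no (unit? b) ¬ub))))

      -- Otherwise every unit class would have a share of at most 16δ₀/K, and the sum over the units
      -- could not come near 1.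
      charged-exists : Σ ℕ λ s → Unit s × Charged s
      charged-exists = conclude (search (λ b → unit? b ×-dec charged? b) M)
        where
        lem : ∀ (k d n m K : ℚ) → K * m ≤ n * (ι 16 * d) → ι 1000 * (d * n) ≤ k * k * ι 2 → k ≤ K → k ≤ ι 2 →
          0ℚ ≤ k → 1ℚ - d ≤ m → ι 100 * d ≤ 1ℚ → 0ℚ ≤ K → k ≤ ½ * k
        lem k d n m K t b h k2 k0 um dt K0 =
          ≤by (const≥0 (ι 250 * inv 463) ⊠ δ t ⊞ const≥0 (ι 4 * inv 463) ⊠ δ b ⊞ const≥0 (ι 495 * inv 926) ⊠ δ h ⊞
            const≥0 (ι 250 * inv 463) ⊠ δ um ⊠ δ K0 ⊞ const≥0 (ι 5 * inv 926) ⊠ δ dt ⊠ δ K0 ⊞ const≥0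
            (ι 8 * inv 463) ⊠ δ k2 ⊠ δ k0)
            (solve (k ∷ d ∷ n ∷ m ∷ K ∷ []) ring)

        total : (∀ b → 1 ℕ.≤ b → b ℕ.≤ M → ¬ (Unit b × Charged b)) → K * unit-mass η s₃ ≤ #units * (ι 16 * δ₀)
        total none = subst₂ _≤_ (trans (∑-ext M (λ b → swap (unit b) K (u η s₃ b)))
          (trans (∑-*ˡ M K (λ b → unit b * u η s₃ b)) (cong (K *_) (∑-unit-u η s₃)))) (∑-*ʳ M (ι 16 * δ₀) unit)
          (∑-mono M (λ b 1≤b b≤M → term b 1≤b b≤M (unit? b)))
          where
          swap : ∀ a b c → a * (b * c) ≡ b * (a * c)
          swap = solve-∀ ring

          term : ∀ b → 1 ℕ.≤ b → b ℕ.≤ M → Dec (Unit b) → unit b * (K * u η s₃ b) ≤ unit b * (ι 16 * δ₀)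
          term b 1≤b b≤M (yes ub) = low-sum b (λ cb → none b 1≤b b≤M (ub , cb))
          term b 1≤b b≤M (no ¬ub) = ≤-reflexive
            (trans (zero-* (K * u η s₃ b) (𝟙-no (unit? b) ¬ub)) (sym (zero-* (ι 16 * δ₀) (𝟙-no (unit? b) ¬ub))))
        conclude : (Σ ℕ λ b → 1 ℕ.≤ b × b ℕ.≤ M × Unit b × Charged b) ⊎
          (∀ b → 1 ℕ.≤ b → b ℕ.≤ M → ¬ (Unit b × Charged b)) → Σ ℕ λ s → Unit s × Charged s
        conclude (inj₁ (s , _ , _ , us , cs)) = s , us , cs
        conclude (inj₂ none) = ⊥-elim (¬≤-fraction ½ (toWitness {a? = ½ <? 1ℚ} _) κ>0
          (lem κ δ₀ #units (unit-mass η s₃) K (total none) #δ-bound κ≤K κ≤2 κ≥0 unit-mass≥ δ-tiny K≥0))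

      χ : ℕ → ℚ
      χ n = unit n * (1ℚ - ι 2 * 𝟙 (charged? n))

      u-periodic : ∀ {b c} → b ≈ c → u η s₃ b ≡ u η s₃ c
      u-periodic {b} {c} e = cong (ρ s₃ *_)
        (P-ext (y s₃) (λ n → 𝟙-cong (n ≈? b) (n ≈? c) (λ p → trans p e) (λ p → trans p (sym e))))

      χ-periodic : Periodic χ
      χ-periodic {b} {c} e = cong₂ (λ p q → p * (1ℚ - ι 2 * q)) (unit-periodic {b} {c} e)
        (𝟙-cong (charged? b) (charged? c) (subst (K * inv 4 ≤_) (u-periodic {b} {c} e))
          (subst (K * inv 4 ≤_) (sym (u-periodic {b} {c} e))))

      χ-nonunit : ∀ {n} → ¬ Unit n → χ n ≡ 0ℚ
      χ-nonunit {n} ¬un = zero-* (1ℚ - ι 2 * 𝟙 (charged? n)) (𝟙-no (unit? n) ¬un)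

      χ-charged : ∀ {n} → Unit n → Charged n → χ n ≡ - 1ℚ
      χ-charged {n} un cn = cong₂ (λ p q → p * (1ℚ - ι 2 * q)) (𝟙-yes (unit? n) un) (𝟙-yes (charged? n) cn)

      χ-uncharged : ∀ {n} → Unit n → ¬ Charged n → χ n ≡ 1ℚ
      χ-uncharged {n} un ¬cn = cong₂ (λ p q → p * (1ℚ - ι 2 * q)) (𝟙-yes (unit? n) un) (𝟙-no (charged? n) ¬cn)

      uncharged-charged : ∀ {g t} → Unit g → Unit t → ¬ Charged g → Charged t → Charged (g ℕ.* t)
      uncharged-charged {g} {t} ug ut ¬cg ct = conclude (charged? (g ℕ.* t))
        where
        conclude : Dec (Charged (g ℕ.* t)) → Charged (g ℕ.* t)
        conclude (yes c) = c
        conclude (no ¬c) = ⊥-elim (¬cg (uncharged-quotient {g ℕ.* t} {g} {t} (unit-* ug ut) ut ¬c ct refl))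

      -- For a charged s, two applications of `uncharged-charged` make ghs charged, whereas a
      -- charged gh would make it uncharged.
      uncharged-uncharged : ∀ {g h} → Unit g → Unit h → ¬ Charged g → ¬ Charged h → ¬ Charged (g ℕ.* h)
      uncharged-uncharged {g} {h} ug uh ¬cg ¬ch c with charged-exists
      ... | s , us , cs = charged-charged (unit-* ug uh) us c cs (subst Charged (sym (ℕₚ.*-assoc g h s))
              (uncharged-charged ug (unit-* uh us) ¬cg (uncharged-charged uh us ¬ch cs)))

      χ-* : ∀ m n → χ (m ℕ.* n) ≡ χ m * χ n
      χ-* m n = cases (unit? m) (unit? n)
        where
        both : Unit m → Unit n → Dec (Charged m) → Dec (Charged n) → χ (m ℕ.* n) ≡ χ m * χ n
        both um un (yes cm) (yes cn) = trans (χ-uncharged (unit-* um un) (charged-charged um un cm cn))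
          (sym (cong₂ _*_ (χ-charged um cm) (χ-charged un cn)))
        both um un (yes cm) (no ¬cn) = trans
          (χ-charged (unit-* um un) (subst Charged (ℕₚ.*-comm n m) (uncharged-charged un um ¬cn cm)))
          (sym (cong₂ _*_ (χ-charged um cm) (χ-uncharged un ¬cn)))
        both um un (no ¬cm) (yes cn) = trans (χ-charged (unit-* um un) (uncharged-charged um un ¬cm cn))
          (sym (cong₂ _*_ (χ-uncharged um ¬cm) (χ-charged un cn)))
        both um un (no ¬cm) (no ¬cn) = trans (χ-uncharged (unit-* um un) (uncharged-uncharged um un ¬cm ¬cn))
          (sym (cong₂ _*_ (χ-uncharged um ¬cm) (χ-uncharged un ¬cn)))
        cases : Dec (Unit m) → Dec (Unit n) → χ (m ℕ.* n) ≡ χ m * χ n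
        cases (no ¬um) _ = trans (χ-nonunit (λ z → ¬um (unit-*⁻ˡ m n z))) (sym (zero-* (χ n) (χ-nonunit ¬um)))
        cases (yes _) (no ¬un) = trans (χ-nonunit (λ z → ¬un (unit-*⁻ʳ m n z))) (sym (*-zero′ (χ m) (χ-nonunit ¬un)))
        cases (yes um) (yes un) = both um un (charged? m) (charged? n)

      χ-values : ∀ n → χ n ≡ 0ℚ ⊎ (χ n ≡ 1ℚ ⊎ χ n ≡ - 1ℚ)
      χ-values n = cases (unit? n) (charged? n)
        where
        cases : Dec (Unit n) → Dec (Charged n) → χ n ≡ 0ℚ ⊎ (χ n ≡ 1ℚ ⊎ χ n ≡ - 1ℚ)
        cases (no ¬un) _        = inj₁ (χ-nonunit ¬un)
        cases (yes un) (yes cn) = inj₂ (inj₂ (χ-charged un cn))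
        cases (yes un) (no ¬cn) = inj₂ (inj₁ (χ-uncharged un ¬cn))

      uncharged-1 : ¬ Charged 1
      uncharged-1 c = charged-charged unit-1 unit-1 c c c

      character : RealCharacter χ
      character = record { χ-* = χ-* ; χ1 = χ-uncharged unit-1 uncharged-1 ; χ-values = χ-values }

      -- Multiplication by a charged s permutes the classes and changes the sign.
      ∑-χ : ∑ M χ ≡ 0ℚ
      ∑-χ with charged-exists
      ... | s , us , cs = vanish (∑ M χ) (trans (sym (∑-permute χ (λ {b} {c} → χ-periodic {b} {c}) s us))
        (trans (∑-ext M (λ n → χ-* s n)) (trans (∑-*ˡ M (χ s) χ) (cong (_* ∑ M χ) (χ-charged us cs)))))
        where
        vanish : ∀ x → x ≡ - 1ℚ * x → x ≡ 0ℚ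
        vanish x e = ≤-antisym (up x e) (down x e)
          where
          up : ∀ (x : ℚ) → x ≡ - 1ℚ * x → x ≤ 0ℚ
          up x e = ≤by (const≥0 (inv 2) ⊠ δ (≤-reflexive e)) (solve (x ∷ []) ring)

          down : ∀ (x : ℚ) → x ≡ - 1ℚ * x → 0ℚ ≤ x
          down x e = ≤by (const≥0 (inv 2) ⊠ δ (≤-reflexive (sym e))) (solve (x ∷ []) ring)

      χ-test : Test (ι M) χ
      χ-test m _ = ∑-periodic-bound (λ n → χ (m ℕ.* n))
        (λ {b} {c} e → χ-periodic {m ℕ.* b} {m ℕ.* c} (≈-*ˡ m {b} {c} e)) (λ n → ∣χ∣≤1 character (m ℕ.* n))
        (trans (∑-ext M (λ n → χ-* m n)) (trans (∑-*ˡ M (χ m) χ) (*-zero′ (χ m) ∑-χ)))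

      -- Charged classes enter with -1 and uncharged ones have almost no mass, so the mean is close
      -- to - `unit-mass`, that is, to -1; -½ leaves ample room.
      χ-mean : ρ s₃ * P (y s₃) χ ≤ - ½
      χ-mean = subst (_≤ - ½) (∑-u η χ (λ {b} {c} → χ-periodic {b} {c}) s₃)
        (*-cancelˡ K K>0 (≤-trans scaled
          (lem κ δ₀ (unit-mass η s₃) #units K κ≤K #δ-bound κ≤2 κ≥0 unit-mass≥ δ-tiny K≥0)))
        where
        lem : ∀ (k d m n K : ℚ) → k ≤ K → ι 1000 * (d * n) ≤ k * k * ι 2 → k ≤ ι 2 → 0ℚ ≤ k → 1ℚ - d ≤ m →
          ι 100 * d ≤ 1ℚ → 0ℚ ≤ K → ι 2 * (n * (ι 16 * d)) - K * m ≤ K * (- ½)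
        lem k d m n K h b k2 k0 um dt K0 =
          ≤by (const≥0 (ι 49 * inv 100) ⊠ δ h ⊞ const≥0 (ι 4 * inv 125) ⊠ δ b ⊞ const≥0 (ι 181 * inv 500) ⊠ δ k0 ⊞ δ
            um ⊠ δ K0 ⊞ const≥0 (inv 100) ⊠ δ dt ⊠ δ K0 ⊞ const≥0 (ι 8 * inv 125) ⊠ δ k2 ⊠ δ k0)
            (solve (k ∷ d ∷ m ∷ n ∷ K ∷ []) ring)

        term : ∀ b → K * (χ b * u η s₃ b) ≤ ι 2 * (unit b * (ι 16 * δ₀)) - K * (unit b * u η s₃ b)
        term b = cases (unit? b) (charged? b)
          where
          v = u η s₃ b
          charged-case : ∀ (K v d : ℚ) → 0ℚ ≤ d → K * (- 1ℚ * v) ≤ ι 2 * (1ℚ * (ι 16 * d)) - K * (1ℚ * v)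
          charged-case K v d h = ≤by (const≥0 (ι 32) ⊠ δ h) (solve (K ∷ v ∷ d ∷ []) ring)

          uncharged-case : ∀ (K v d : ℚ) → K * v ≤ ι 16 * d → K * (1ℚ * v) ≤ ι 2 * (1ℚ * (ι 16 * d)) - K * (1ℚ * v)
          uncharged-case K v d h = ≤by (const≥0 (ι 2) ⊠ δ h) (solve (K ∷ v ∷ d ∷ []) ring)

          nonunit-case : ∀ (K v d : ℚ) → 0ℚ ≤ d → K * (0ℚ * v) ≤ ι 2 * (0ℚ * (ι 16 * d)) - K * (0ℚ * v)
          nonunit-case K v d h = ≤by (≤-refl) (solve (K ∷ v ∷ d ∷ []) ring)

          at : ∀ {x w} → χ b ≡ x → unit b ≡ w → K * (x * v) ≤ ι 2 * (w * (ι 16 * δ₀)) - K * (w * v) →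
            K * (χ b * v) ≤ ι 2 * (unit b * (ι 16 * δ₀)) - K * (unit b * v)
          at ex ew h = subst₂ (λ x w → K * (x * v) ≤ ι 2 * (w * (ι 16 * δ₀)) - K * (w * v)) (sym ex) (sym ew) h
          cases : Dec (Unit b) → Dec (Charged b) → K * (χ b * v) ≤ ι 2 * (unit b * (ι 16 * δ₀)) - K * (unit b * v)
          cases (no ¬ub) _ = at (χ-nonunit ¬ub) (𝟙-no (unit? b) ¬ub) (nonunit-case K v δ₀ δ≥0)
          cases (yes ub) (yes cb) = at (χ-charged ub cb) (𝟙-yes (unit? b) ub) (charged-case K v δ₀ δ≥0)
          cases (yes ub) (no ¬cb) = at (χ-uncharged ub ¬cb) (𝟙-yes (unit? b) ub)
            (uncharged-case K v δ₀ (uncharged-low ub ¬cb))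
        scaled : K * ∑ M (λ b → χ b * u η s₃ b) ≤ ι 2 * (#units * (ι 16 * δ₀)) - K * unit-mass η s₃
        scaled = subst₂ _≤_ (∑-*ˡ M K (λ b → χ b * u η s₃ b))
          (trans (∑-sub M (λ b → ι 2 * (unit b * (ι 16 * δ₀))) (λ b → K * (unit b * u η s₃ b)))
            (cong₂ _-_ (trans (∑-*ˡ M (ι 2) (λ b → unit b * (ι 16 * δ₀))) (cong (ι 2 *_) (∑-*ʳ M (ι 16 * δ₀) unit)))
              (trans (∑-*ˡ M K (λ b → unit b * u η s₃ b)) (cong (K *_) (∑-unit-u η s₃)))))
          (∑-mono M (λ b _ _ → term b))

      -- Multiplicativity splits the average in `Λ-L-bound` into P χ times L χ, of absolute value at
      -- most 40M. Since P χ ≤ - ½ log y and L χ ≥ `inv (8 * side M)`, their product would force log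
      -- y times this inverse to be at most 80M.
      contradiction : ratio M ℕ.* side M ℕ.≤ X → ι 81 * ι M ≤ ℓ (y s₃) * inv (8 ℕ.* side M) → ⊥
      contradiction X-large ℓ-large = ¬≤-fraction (ι 80 * inv 81) (toWitness {a? = ι 80 * inv 81 <? 1ℚ} _)
          (<-≤-trans (ι-pos 0) (ι-mono {1} 1≤M))
          (lem (P (y s₃) χ) (L X χ) (ρ s₃) (ℓ (y s₃)) (inv (8 ℕ.* side M)) (ι M) ℓ-large χ-mean (ρ*ℓ s₃) (ℓ≥0 (y s₃))
            (L-lower character M 1≤M χ-test X-large) (inv≥0 (8 ℕ.* side M))
            (abs-lower (≤-trans (≤-reflexive (cong ∣_∣ (sym factor)))
              (Mertens.Λ-L-bound Z log χ χ-test (1≤y s₃) (y<Z s₃) (y≤X s₃)))))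
        where
        factor : P (y s₃) (λ m → L X (λ j → χ (m ℕ.* j))) ≡ P (y s₃) χ * L X χ
        factor = trans (P-ext (y s₃) (λ m → trans
          (∑-ext X (λ j → trans (cong (_* inv j) (χ-* m j)) (*-assoc (χ m) (χ j) (inv j))))
          (∑-*ˡ X (χ m) (λ j → χ j * inv j)))) (P-*ʳ (y s₃) (L X χ) χ)
        unscale : ∀ (p r l : ℚ) → r * p ≤ - ½ → r * l ≡ 1ℚ → 0ℚ ≤ l → p ≤ - ½ * l
        unscale p r l h e l0 =
          ≤by (δ h ⊠ δ l0 ⊞ δ (≤-reflexive (cong (λ z → z * p) (sym e))))
            (solve (p ∷ r ∷ l ∷ []) ring)

        lem₁ : ∀ (p k l v M : ℚ) → ι 81 * M ≤ l * v → p ≤ - ½ * l → 0ℚ ≤ l → v ≤ k → 0ℚ ≤ v → - (ι 40 * M) ≤ p * k →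
          M ≤ ι 80 * inv 81 * M
        lem₁ p k l v M b h l0 kv v0 c =
          ≤by (const≥0 (inv 81) ⊠ δ b ⊞ const≥0 (ι 2 * inv 81) ⊠ δ c ⊞ const≥0 (ι 2 * inv 81) ⊠ δ h ⊠ δ kv ⊞ const≥0
            (ι 2 * inv 81) ⊠ δ h ⊠ δ v0 ⊞ const≥0 (inv 81) ⊠ δ l0 ⊠ δ kv)
            (solve (p ∷ k ∷ l ∷ v ∷ M ∷ []) ring)

        lem : ∀ p k r l v M → ι 81 * M ≤ l * v → r * p ≤ - ½ → r * l ≡ 1ℚ → 0ℚ ≤ l → v ≤ k → 0ℚ ≤ v →
          - (ι 40 * M) ≤ p * k → M ≤ ι 80 * inv 81 * M
        lem p k r l v M b h e l0 kv v0 c = lem₁ p k l v M b (unscale p r l h e l0) l0 kv v0 c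

-- Primes above any bound in a reduced residue class.

module Dirichlet where

  open Rationals
  open Sums
  open Primes
  open Logarithms using (Logarithm; logarithm)
  open Nonvanishing using (ratio; side)
  open import Data.Rational
  open import Data.Rational.Properties
  open import Data.Nat.Coprimality using (Coprime)
  open import Data.Nat.Primality using (Prime; prime?)
  open import Relation.Nullary.Decidable using (_×-dec_)

  reciprocal : ∀ {a} → 0ℚ < a → Σ ℚ λ r → 0ℚ < r × r * a ≡ 1ℚ
  reciprocal {a} a>0 = (1/ a) {{a≢0}} , positive⁻¹ ((1/ a) {{a≢0}}) {{1/pos⇒pos a {{positive a>0}}}} , *-inverseˡ a
    {{a≢0}}
    where
    a≢0 : NonZero a
    a≢0 = pos⇒nonZero a {{positive a>0}}

  inv-scaled : ∀ k E {T} → 1 ℕ.≤ k → 1 ℕ.≤ E → k ℕ.* E ℕ.≤ T → ι k * inv T ≤ inv E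
  inv-scaled k E {T} 1≤k 1≤E h = ≤-trans (*-monoˡ (ι k) (inv-antitone (ℕₚ.*-mono-≤ 1≤k 1≤E) h) (ι≥0 k))
    (≤-reflexive (trans (cong (ι k *_) (inv-* k E))
      (trans (sym (*-assoc (ι k) (inv k) (inv E))) (trans (cong (_* inv E) (ι-inv k 1≤k)) (*-identityˡ (inv E))))))

  module _ (M : ℕ) {{M≢0 : ℕ.NonZero M}} (a B : ℕ) (ua : Coprime a M) where

    open Residues M using (_≈_; _≈?_; 1≤M; unit?)

    -- T is chosen so that at every scale tower (suc i) the errors of Distribution are at most 1/E, and the
    -- exponents in tower so that ℓ (tower (suc i)) ≥ tower i.
    E T : ℕ
    E = 125 ℕ.* (M ℕ.* M ℕ.* M)
    T = (272 ℕ.* M ℕ.+ (B ℕ.+ 4)) ℕ.* E ℕ.+ 81 ℕ.* M ℕ.* (8 ℕ.* side M)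

    tower : ℕ → ℕ
    tower zero    = T
    tower (suc i) = 2 ℕ.^ (4 ℕ.* tower i)

    tower-suc : ∀ i → tower i ℕ.≤ tower (suc i)
    tower-suc i = ℕₚ.≤-trans (ℕₚ.m≤n*m (tower i) 4) (ℕₚ.<⇒≤ (n<m^n 2 (4 ℕ.* tower i) ℕₚ.≤-refl))

    tower-mono : ∀ {i j} → i ℕ.≤′ j → tower i ℕ.≤ tower j
    tower-mono ℕ.≤′-refl     = ℕₚ.≤-refl
    tower-mono {i} (ℕ.≤′-step {j} h) = ℕₚ.≤-trans (tower-mono h) (tower-suc j)

    top : ℕ
    top = tower 4

    -- Z lies strictly above the largest scale, as `chebyshev` demands. X covers both that scale and
    -- the length from which `L-lower` holds.
    Z X : ℕ
    Z = 2 ℕ.+ top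
    X = top ℕ.+ ratio M ℕ.* side M

    M³≥1 : 1 ℕ.≤ M ℕ.* M ℕ.* M
    M³≥1 = ℕₚ.*-mono-≤ (ℕₚ.*-mono-≤ 1≤M 1≤M) 1≤M

    E≥1 : 1 ℕ.≤ E
    E≥1 = ℕₚ.*-mono-≤ {1} {125} (s≤s z≤n) M³≥1

    T-bound : ∀ k → k ℕ.≤ 272 ℕ.* M ℕ.+ (B ℕ.+ 4) → k ℕ.* E ℕ.≤ T
    T-bound k h = ℕₚ.≤-trans (ℕₚ.*-monoˡ-≤ E h) (ℕₚ.m≤m+n _ (81 ℕ.* M ℕ.* (8 ℕ.* side M)))

    T≥1 : 1 ℕ.≤ T
    T≥1 = ℕₚ.≤-trans (ℕₚ.*-mono-≤ {1} {1} ℕₚ.≤-refl E≥1)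
      (T-bound 1 (ℕₚ.≤-trans (s≤s z≤n) (ℕₚ.≤-trans (ℕₚ.m≤n+m 4 B) (ℕₚ.m≤n+m (B ℕ.+ 4) (272 ℕ.* M)))))

    η δ₀ : ℚ
    η  = inv T
    δ₀ = inv E

    module _ (log : Logarithm Z) where

      open Logarithm log
      open Distribution M Z log X using (Scale; u; sparse-density; #units; #units≥1)
      open Dichotomy M Z log X using (contradiction)

      ℓ-power : ∀ k → 2 ℕ.^ k ℕ.≤ Z → ℓ (2 ℕ.^ k) ≡ ι k * ℓ 2
      ℓ-power zero    h = trans (Mertens.ℓ1 Z log h) (sym (*-zeroˡ (ℓ 2)))
      ℓ-power (suc k) h = trans (ℓ-* 2 (2 ℕ.^ k) (s≤s z≤n) (1≤^ k (s≤s z≤n)) h)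
        (trans (cong (ℓ 2 +_) (ℓ-power k (ℕₚ.≤-trans (ℕₚ.m≤m+n (2 ℕ.^ k) (1 ℕ.* 2 ℕ.^ k)) h))) (eq (ℓ 2) (ι k)))
        where
        eq : ∀ l k → l + k * l ≡ (1ℚ + k) * l
        eq = solve-∀ ring

      growth : ∀ i → suc i ℕ.≤′ 4 → ι (tower i) ≤ ℓ (tower (suc i))
      growth i h = ≤-trans (lem (ι (tower i)) (ℓ 2) (ι≥0 (tower i)) ℓ2)
        (≤-reflexive (sym (trans (ℓ-power (4 ℕ.* tower i) (ℕₚ.≤-trans (tower-mono h) (ℕₚ.m≤n+m top 2)))
          (cong (_* ℓ 2) (ι-* 4 (tower i))))))
        where
        lem : ∀ (n l : ℚ) → 0ℚ ≤ n → inv 4 ≤ l → n ≤ ι 4 * n * l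
        lem n l p h = ≤by (const≥0 (ι 4) ⊠ δ p ⊠ δ h) (solve (n ∷ l ∷ []) ring)

      T≤tower : ∀ i → T ℕ.≤ tower i
      T≤tower zero    = ℕₚ.≤-refl
      T≤tower (suc i) = ℕₚ.≤-trans (T≤tower i) (tower-suc i)

      T≤ℓ : ∀ i → suc i ℕ.≤′ 4 → ι T ≤ ℓ (tower (suc i))
      T≤ℓ i h = ≤-trans (ι-mono (T≤tower i)) (growth i h)

      scale : ∀ i → suc i ℕ.≤′ 4 → Scale η
      scale i h = record
        { y = tower (suc i) ; 1≤y = ℕₚ.≤-trans T≥1 (T≤tower (suc i))
        ; y<Z = ℕₚ.≤-trans (s≤s (tower-mono h)) (ℕₚ.n≤1+n (suc top)) ; y≤X = ℕₚ.≤-trans (tower-mono h)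
          (ℕₚ.m≤m+n top (ratio M ℕ.* side M))
        ; ρ = proj₁ r ; ρ≥0 = <⇒≤ (proj₁ (proj₂ r)) ; ρ*ℓ = proj₂ (proj₂ r)
        ; ρ≤η = lem (proj₁ r) (ℓ (tower (suc i))) (ι T) η (proj₂ (proj₂ r)) (T≤ℓ i h) (ι-inv T T≥1)
          (<⇒≤ (proj₁ (proj₂ r))) (inv≥0 T) }
        where
        r = reciprocal (<-≤-trans (<-≤-trans (ι-pos 0) (ι-mono {1} T≥1)) (T≤ℓ i h))
        lem : ∀ (r l t v : ℚ) → r * l ≡ 1ℚ → t ≤ l → t * v ≡ 1ℚ → 0ℚ ≤ r → 0ℚ ≤ v → r ≤ v
        lem r l t v e h f p q =
          ≤by (δ h ⊠ δ p ⊠ δ q ⊞ δ (≤-reflexive (cong (λ z → z * v) e)) ⊞ δ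
            (≤-reflexive (cong (λ z → z * r) (sym f))))
            (solve (r ∷ l ∷ t ∷ v ∷ []) ring)

      1≤ℓ : (s : Scale η) → 1ℚ ≤ ℓ (Scale.y s)
      1≤ℓ s = lem ρ (ℓ y) η ρ*ℓ (≤-trans ρ≤η (inv≤1 T)) (ℓ≥0 y)
        where
        open Scale s
        lem : ∀ (r l n : ℚ) → r * l ≡ 1ℚ → r ≤ 1ℚ → 0ℚ ≤ l → 1ℚ ≤ l
        lem r l n e h p = ≤by (δ (≤-reflexive (sym e)) ⊞ δ h ⊠ δ p) (solve (r ∷ l ∷ n ∷ []) ring)

      budget : ∀ k {x} → k ℕ.≤ 272 ℕ.* M ℕ.+ (B ℕ.+ 4) → 1 ℕ.≤ k → ι k * η ≡ x → x ≤ δ₀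
      budget k h 1≤k refl = inv-scaled k E 1≤k E≥1 (T-bound k h)

      no-prime-absurd : (∀ p → 1 ℕ.≤ p → p ℕ.≤ Z → ¬ (B ℕ.< p × Prime p × p ≈ a)) → ⊥
      no-prime-absurd none = contradiction s₀ s₁ s₂ s₃ κ δ₀ κ>0 κ# δ-small
          (budget (272 ℕ.* M) (ℕₚ.m≤m+n (272 ℕ.* M) (B ℕ.+ 4)) (ℕₚ.*-mono-≤ {1} {272} (s≤s z≤n) 1≤M)
            (trans (cong (_* η) (ι-* 272 M)) (*-assoc (ι 272) (ι M) η)))
          (budget (M ℕ.+ 26) M+26≤ (ℕₚ.≤-trans 1≤M (ℕₚ.m≤m+n M 26)) (cong (_* η) (ι-+ M 26)))
          1≤ℓ
          (growth 1 h₂) (≤-trans (ι-mono (tower-suc 1)) (growth 2 h₃))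
            (≤-trans (ι-mono (ℕₚ.≤-trans (tower-suc 1) (tower-suc 2))) (growth 3 h₄))
          (growth 2 h₃) (≤-trans (ι-mono (tower-suc 2)) (growth 3 h₄)) (growth 3 h₄)
          ua (sparse s₂) (sparse s₃)
          (ℕₚ.m≤n+m (ratio M ℕ.* side M) top) ℓ-large
        where
        h₄ : 4 ℕ.≤′ 4
        h₄ = ℕ.≤′-refl
        h₃ : 3 ℕ.≤′ 4
        h₃ = ℕ.≤′-step ℕ.≤′-refl
        h₂ : 2 ℕ.≤′ 4
        h₂ = ℕₚ.≤⇒≤′ (s≤s (s≤s z≤n))
        h₁ : 1 ℕ.≤′ 4
        h₁ = ℕₚ.≤⇒≤′ (s≤s z≤n)
        s₀ = scale 0 h₁
        s₁ = scale 1 h₂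
        s₂ = scale 2 h₃
        s₃ = scale 3 h₄
        #r = reciprocal (<-≤-trans (ι-pos 0) (≤-trans (≤-reflexive (+-identityʳ 1ℚ)) #units≥1))
        κ : ℚ
        κ = ι 2 * proj₁ #r
        κ>0 : 0ℚ < κ
        κ>0 = *-pos (ι-pos 1) (proj₁ (proj₂ #r))
        κ# : κ * #units ≡ ι 2
        κ# = trans (*-assoc (ι 2) (proj₁ #r) #units) (trans (cong (ι 2 *_) (proj₂ (proj₂ #r))) (*-identityʳ (ι 2)))
        #units≤M : #units ≤ ι M
        #units≤M = ≤-trans (∑-mono M (λ b _ _ → 𝟙≤1 (unit? b)))
          (≤-reflexive (trans (∑-const M 1ℚ) (*-identityʳ (ι M))))
        2/M≤κ : ι 2 * inv M ≤ κ
        2/M≤κ = *-monoˡ (ι 2) (lem (proj₁ #r) #units (ι M) (inv M) (proj₂ (proj₂ #r)) #units≤M (ι-inv M 1≤M)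
          (<⇒≤ (proj₁ (proj₂ #r))) (inv≥0 M)) (ι≥0 2)
          where
          lem : ∀ (r n m v : ℚ) → r * n ≡ 1ℚ → n ≤ m → m * v ≡ 1ℚ → 0ℚ ≤ r → 0ℚ ≤ v → v ≤ r
          lem r n m v e h f p q =
            ≤by (δ h ⊠ δ p ⊠ δ q ⊞ δ (≤-reflexive (cong (λ z → z * v) (sym e))) ⊞ δ
              (≤-reflexive (cong (λ z → z * r) f)))
              (solve (r ∷ n ∷ m ∷ v ∷ []) ring)

        -- κ = 2/`#units` is at least 2/M, and 1000/125 = 2³: this is the origin of the factor 125
        -- in `E`.
        δ-small : ι 1000 * δ₀ ≤ κ * κ * κ
        δ-small = ≤-trans (≤-reflexive (trans
          (cong (ι 1000 *_) (trans (inv-* 125 (M ℕ.* M ℕ.* M))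
          (cong (inv 125 *_) (trans (inv-* (M ℕ.* M) M) (cong (_* inv M) (inv-* M M)))))) (eq (inv M))))
          (*-mono (*-mono 2/M≤κ 2/M≤κ v≥0 v≥0) 2/M≤κ (v≥0 ⊠ v≥0) v≥0)
          where
          v≥0 : 0ℚ ≤ ι 2 * inv M
          v≥0 = ι≥0 2 ⊠ inv≥0 M
          eq : ∀ v → ι 1000 * (inv 125 * (v * v * v)) ≡ ι 2 * v * (ι 2 * v) * (ι 2 * v)
          eq = solve-∀ ring

        M+26≤ : M ℕ.+ 26 ℕ.≤ 272 ℕ.* M ℕ.+ (B ℕ.+ 4)
        M+26≤ = ℕₚ.≤-trans (ℕₚ.+-monoʳ-≤ M (ℕₚ.*-mono-≤ {26} {271} (ℕₚ.m≤m+n 26 245) 1≤M))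
          (ℕₚ.m≤m+n (272 ℕ.* M) (B ℕ.+ 4))
        -- With no prime of the class between B and Z, only primes up to B and higher prime powers
        -- are left in its share.
        sparse : ∀ s → u η s a ≤ δ₀
        sparse s = ≤-trans (sparse-density η s B (Residues.class M a) (λ m → 𝟙≥0 (m ≈? a)) (λ m → 𝟙≤1 (m ≈? a))
            (λ p pp B<p p≤Z → 𝟙-no (p ≈? a) (λ e → none p (prime≥1 pp) p≤Z (B<p , pp , e))))
          (budget (B ℕ.+ 4) (ℕₚ.m≤n+m (B ℕ.+ 4) (272 ℕ.* M)) (ℕₚ.≤-trans (s≤s z≤n) (ℕₚ.m≤n+m 4 B))
            (cong (_* η) (ι-+ B 4)))
        ℓ-large : ι 81 * ι M ≤ ℓ (tower 4) * inv (8 ℕ.* side M)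
        ℓ-large = lem (ι 81 * ι M) (ι S) (inv S) (ℓ (tower 4)) (ι-inv S S≥1)
            (≤-trans (≤-reflexive (trans (cong (_* ι S) (sym (ι-* 81 M))) (sym (ι-* (81 ℕ.* M) S))))
              (≤-trans (ι-mono (ℕₚ.m≤n+m (81 ℕ.* M ℕ.* S) ((272 ℕ.* M ℕ.+ (B ℕ.+ 4)) ℕ.* E))) (T≤ℓ 3 h₄))) (inv≥0 S)
          where
          S = 8 ℕ.* side M
          S≥1 : 1 ℕ.≤ S
          S≥1 = ℕₚ.*-mono-≤ {1} {8} (s≤s z≤n)
            (ℕₚ.*-mono-≤ {1} {2} (s≤s z≤n) (ℕₚ.*-mono-≤ {1} {ratio M} {1} {ratio M}
            (ℕₚ.*-mono-≤ {1} {48} (s≤s z≤n) 1≤M) (ℕₚ.*-mono-≤ {1} {48} (s≤s z≤n) 1≤M)))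
          lem : ∀ (m s v l : ℚ) → s * v ≡ 1ℚ → m * s ≤ l → 0ℚ ≤ v → m ≤ l * v
          lem m s v l e h q =
            ≤by (δ h ⊠ δ q ⊞ δ (≤-reflexive (cong (λ z → z * m) (sym e))))
              (solve (m ∷ s ∷ v ∷ l ∷ []) ring)

    -- All conditions are decidable and the range ends at the explicit Z, so the search either finds
    -- p or supplies the hypothesis that `no-prime-absurd` refutes.
    dirichlet : Σ ℕ λ p → B ℕ.< p × Prime p × p ≈ a
    dirichlet = conclude (search (λ p → (B ℕ.<? p) ×-dec (prime? p ×-dec (p ≈? a))) Z)
      where
      conclude : (Σ ℕ λ p → 1 ℕ.≤ p × p ℕ.≤ Z × B ℕ.< p × Prime p × p ≈ a) ⊎
        (∀ p → 1 ℕ.≤ p → p ℕ.≤ Z → ¬ (B ℕ.< p × Prime p × p ≈ a)) → Σ ℕ λ p → B ℕ.< p × Prime p × p ≈ a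
      conclude (inj₁ (p , _ , _ , q)) = p , q
      conclude (inj₂ none) = ⊥-elim (no-prime-absurd (logarithm Z (ℕₚ.m≤m+n 2 top)) none)

-- Prime factors of Schemmel totients and a criterion for nontotients.

module Schemmel where

  open import Defs
  open Primes
  open import Data.Nat
  open import Data.Nat.Properties
  open import Data.Nat.Divisibility
  open import Data.Nat.Primality using (Prime; prime?; euclidsLemma; prime⇒nonZero; ¬prime[1])
  open import Data.Nat.Coprimality using (coprime-divisor) renaming (sym to coprime-sym)

  -- Sr-product r m k is the product over the primes s ≤ k dividing m. It is a local function of
  -- Sr and has no name of its own; abstracting suc p in the specification lets unification find it.
  mutual
    Sr-product : ℕ → ℕ → ℕ → ℕ
    Sr-product = _

    Sr-product-spec : ∀ r p → ¬ Prime (suc p) → Sr r (suc p) ≡ Sr-product r (suc p) p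
    Sr-product-spec r p ¬prime with prime? (suc p) | suc p ∣? suc p
    ... | yes pr | _ = ⊥-elim (¬prime pr)
    ... | no _      | _ with suc p
    ...   | m = refl

  -- s^k (s - r) is the value of S_r at s^(k+1); this records a prime power that is responsible for
  -- the factor p of n.
  PrimeFactor : ℕ → ℕ → ℕ → Set
  PrimeFactor r p n = Σ ℕ λ s → Σ ℕ λ k → Prime s × r < s × p ∣ s ^ k * (s ∸ r) × s ^ k * (s ∸ r) ∣ n

  Sr-pp-factor : ∀ r s {α p} → Prime s → p ∣ Sr-pp r s α → ¬ Sr-pp r s α ≡ 0 → PrimeFactor r p (Sr-pp r s α)
  Sr-pp-factor r s {α} ps d ≢0 with s ≤? r
  ... | yes _  = ⊥-elim (≢0 refl)
  ... | no s≰r = s , α ∸ 1 , ps , ≰⇒> s≰r , d , ∣-refl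

  factor-∣ : ∀ {r p n n'} → n ∣ n' → PrimeFactor r p n → PrimeFactor r p n'
  factor-∣ h (s , k , ps , r<s , d , e) = s , k , ps , r<s , d , ∣-trans e h

  -- p divides some local factor by Euclid's lemma. Nonvanishing matters because a prime up to r
  -- dividing m makes the whole product 0, which p divides without any such s.
  Sr-product-factor : ∀ r m k {p} → Prime p → p ∣ Sr-product r m k → ¬ Sr-product r m k ≡ 0 →
    PrimeFactor r p (Sr-product r m k)
  Sr-product-factor r m zero    pp d _ = ⊥-elim (¬prime[1] (subst Prime (∣1⇒≡1 d) pp))
  Sr-product-factor r m (suc k) pp d ≢0 with prime? (suc k) | suc k ∣? m
  ... | no _   | _    = Sr-product-factor r m k pp d ≢0
  ... | yes _  | no _ = Sr-product-factor r m k pp d ≢0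
  ... | yes ps | yes _ with euclidsLemma (Sr-pp r (suc k) (val (suc k) m)) (Sr-product r m k) pp d
  ...   | inj₁ e = factor-∣ (m∣m*n (Sr-product r m k))
    (Sr-pp-factor r (suc k) ps e (λ z → ≢0 (cong (_* Sr-product r m k) z)))
  ...   | inj₂ e = factor-∣ (n∣m*n (Sr-pp r (suc k) (val (suc k) m)))
                     (Sr-product-factor r m k pp e (λ z → ≢0
                       (trans (cong (Sr-pp r (suc k) (val (suc k) m) *_) z)
                       (*-zeroʳ (Sr-pp r (suc k) (val (suc k) m))))))

  ∣prime-power : ∀ {q} n t → Prime q → t ∣ q ^ n → Σ ℕ λ β → t ≡ q ^ β
  ∣prime-power zero    t pq d = 0 , ∣1⇒≡1 d
  ∣prime-power {q} (suc n) t pq d with q ∣? t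
  ... | no q∤t = ∣prime-power n t pq (coprime-divisor (coprime-sym (prime-∤⇒coprime pq q∤t)) d)
  ... | yes (divides t' refl) with ∣prime-power n t' pq
    (*-cancelʳ-∣ q {{prime⇒nonZero pq}} (subst (t' * q ∣_) (*-comm q (q ^ n)) d))
  ...   | β , refl = suc β , *-comm (q ^ β) q

  -- The factor p of S_r(m) stems from some s^k (s - r). The compositeness hypothesis disposes of p
  -- ∣ s - r, and d disposes of p ∣ s^k.
  nontotient : ∀ r p → 1 ≤ r → Prime (r + 1) → Prime p → r < p → (∀ β → ¬ Prime ((r + 1) ^ β * p + r)) →
    ∀ {d} → Prime d → d ∣ p ∸ r → ¬ d ∣ r + 1 → ∀ α → SchemmelNontotient r ((r + 1) ^ α * p)
  nontotient r p 1≤r pq pp r<p composite {d} pd d∣p∸r d∤q α = 1≤n , λ { (m , _ , e) → absurd m e }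
    where
    q = r + 1
    n = q ^ α * p
    1≤n : 1 ≤ n
    1≤n = *-mono-≤ (1≤^ α (prime≥1 pq)) (prime≥1 pp)
    absurd : ∀ m → Sr r m ≡ n → ⊥
    absurd m e with Sr-product-factor r m m pp (subst (p ∣_) (sym e) (n∣m*n (q ^ α)))
      (λ z → <⇒≢ 1≤n (sym (trans (sym e) z)))
    ... | s , k , ps , r<s , p∣f , f∣Sr with euclidsLemma (s ^ k) (s ∸ r) pp p∣f
    -- Here s = p, so p - r divides q^α p. Its prime factor d does not divide q, and it is not p
    -- because 0 < p - r < p.
    ...   | inj₁ p∣s^k with prime∣prime pp ps (prime∣^ s k pp p∣s^k)
    ...     | refl with euclidsLemma (q ^ α) p pd
      (∣-trans d∣p∸r (∣-trans (n∣m*n (p ^ k)) (subst (p ^ k * (p ∸ r) ∣_) e f∣Sr)))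
    ...       | inj₁ d∣q^α = d∤q (prime∣^ q α pd d∣q^α)
    ...       | inj₂ d∣p with prime∣prime pd pp d∣p
    ...         | refl = <⇒≱ (∸-monoʳ-< 1≤r (<⇒≤ r<p)) (∣⇒≤ {{>-nonZero (m<n⇒0<n∸m r<p)}} d∣p∸r)
    -- Here s - r = tp divides q^α p, so t is a power q^β and the prime s equals q^β p + r.
    absurd m e | s , k , ps , r<s , p∣f , f∣Sr | inj₂ (divides t s∸r≡) with ∣prime-power α t pq
        (*-cancelʳ-∣ p {{prime⇒nonZero pp}}
          (subst (_∣ n) s∸r≡ (∣-trans (n∣m*n (s ^ k)) (subst (s ^ k * (s ∸ r) ∣_) e f∣Sr))))
    ...   | β , refl = composite β (subst Prime (sym (trans (cong (_+ r) (sym s∸r≡)) (m∸n+n≡m (<⇒≤ r<s)))) ps)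

-- Covering the exponents β by prime divisors of q^β p + r.

module Covering where

  open Primes
  open import Data.Nat
  open import Data.Nat.Properties
  open import Data.Nat.Divisibility
  open import Data.Nat.DivMod using (%-distribˡ-+; m*n%n≡0)
  open import Data.Nat.Primality using (Prime; euclidsLemma; prime⇒nonZero; prime[2]; ¬prime[1])
  open import Data.Nat.Coprimality using (Coprime; coprime-divisor) renaming (sym to coprime-sym)
  open import Data.Nat.Tactic.RingSolver using (solve-∀)

  even-or-odd : ∀ n → (Σ ℕ λ k → n ≡ 2 * k) ⊎ (Σ ℕ λ k → n ≡ suc (2 * k))
  even-or-odd zero = inj₁ (0 , refl)
  even-or-odd (suc n) with even-or-odd n
  ... | inj₁ (k , refl) = inj₂ (k , refl)
  ... | inj₂ (k , refl) = inj₁ (suc k , cong suc (sym (+-suc k (k + 0))))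

  -- The residue classes 2^j mod 2^(j+1), j < N, together with 0 mod 2^N cover all exponents.
  exponent-cover : ∀ N β → (Σ ℕ λ k → β ≡ 2 ^ N * k) ⊎ (Σ ℕ λ j → Σ ℕ λ k → j < N × β ≡ 2 ^ j * suc (2 * k))
  exponent-cover zero    β = inj₁ (β , sym (+-identityʳ β))
  exponent-cover (suc N) β with even-or-odd β
  ... | inj₂ (k , refl) = inj₂ (0 , k , s≤s z≤n , sym (+-identityʳ (suc (2 * k))))
  ... | inj₁ (β' , refl) with exponent-cover N β'
  ...   | inj₁ (k , refl) = inj₁ (k , sym (*-assoc 2 (2 ^ N) k))
  ...   | inj₂ (j , k , j<N , refl) = inj₂ (suc j , k , s≤s j<N , sym (*-assoc 2 (2 ^ j) (suc (2 * k))))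

  power-≡1 : ∀ {d c} x k → x ≡ 1 + d * c → Σ ℕ λ c' → x ^ k ≡ 1 + d * c'
  power-≡1 {d} x zero    e = 0 , cong suc (sym (*-zeroʳ d))
  power-≡1 {d} {c} x (suc k) e with power-≡1 {d} {c} x k e
  ... | c' , e' = c + c' + c * (d * c') , trans (cong₂ _*_ e e') (expand d c c')
    where
    expand : ∀ d c c' → (1 + d * c) * (1 + d * c') ≡ 1 + d * (c + c' + c * (d * c'))
    expand = solve-∀

  -- x² - 1 = (x + 1)(x - 1) gives x² ≡ 1 mod d, whence x^(2k+1) ≡ x ≡ -1.
  odd-power-≡-1 : ∀ {d} x k → 1 ≤ x → d ∣ x + 1 → d ∣ x ^ suc (2 * k) + 1
  odd-power-≡-1 {d} x@(suc y) k _ d∣x+1@(divides c e) with power-≡1 {d} {c * y} (x ^ 2) k square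
    where
    expand : ∀ y → (1 + y) * ((1 + y) * 1) ≡ 1 + (1 + y + 1) * y
    expand = solve-∀
    square : x ^ 2 ≡ 1 + d * (c * y)
    square = trans (expand y) (cong suc (trans (cong (_* y) (trans e (*-comm c d))) (*-assoc d c y)))
  ... | c' , e' = subst (d ∣_) (sym (trans (cong (λ z → x * z + 1) (trans (sym (^-*-assoc x 2 k)) e'))
    (expand x d c')))
      (∣m∣n⇒∣m+n d∣x+1 (m∣m*n (x * c')))
    where
    expand : ∀ x d c' → x * (1 + d * c') + 1 ≡ x + 1 + d * (x * c')
    expand = solve-∀

  ∣∸1⇒≡1+ : ∀ {d} x → 1 ≤ x → d ∣ x ∸ 1 → Σ ℕ λ c → x ≡ 1 + d * c
  ∣∸1⇒≡1+ {d} (suc y) _ (divides c e) = c , cong suc (trans e (*-comm c d))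

  +1∣square∸1 : ∀ x → 1 ≤ x → x * x ∸ 1 ≡ (x ∸ 1) * (x + 1)
  +1∣square∸1 (suc y) _ = expand y
    where
    expand : ∀ y → y + y * suc y ≡ y * (suc y + 1)
    expand = solve-∀

  double-exponent : ∀ q j → q ^ (2 ^ suc j) ≡ q ^ (2 ^ j) * q ^ (2 ^ j)
  double-exponent q j = trans (cong (q ^_) (cong (2 ^ j +_) (+-identityʳ (2 ^ j)))) (^-distribˡ-+-* q (2 ^ j) (2 ^ j))

  power-of-2-or-odd-prime : ∀ n → 1 ≤ n → (Σ ℕ λ k → n ≡ 2 ^ k) ⊎ (Σ ℕ λ d → Prime d × d ≢ 2 × d ∣ n)
  power-of-2-or-odd-prime = prime-induction _ (inj₁ (0 , refl)) step
    where
    step : ∀ p n → Prime p → 1 ≤ n → (Σ ℕ λ k → n ≡ 2 ^ k) ⊎ (Σ ℕ λ d → Prime d × d ≢ 2 × d ∣ n) →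
      (Σ ℕ λ k → p * n ≡ 2 ^ k) ⊎ (Σ ℕ λ d → Prime d × d ≢ 2 × d ∣ p * n)
    step p n pp _ ih with p ≟ 2
    ... | no p≢2 = inj₂ (p , pp , p≢2 , m∣m*n n)
    step p n pp _ (inj₁ (k , refl)) | yes refl = inj₁ (suc k , refl)
    step p n pp _ (inj₂ (d , pd , d≢2 , d∣n)) | yes refl = inj₂ (d , pd , d≢2 , ∣-trans d∣n (n∣m*n p))

  4∤square+1 : ∀ x → ¬ 4 ∣ x * x + 1
  4∤square+1 x h with even-or-odd x
  ... | inj₁ (k , refl) = >⇒∤ (s≤s (s≤s z≤n)) (∣m+n∣m⇒∣n (subst (λ z → 4 ∣ z + 1) (expand k) h) (m∣m*n (k * k)))
    where
    expand : ∀ k → 2 * k * (2 * k) ≡ 4 * (k * k)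
    expand = solve-∀
  ... | inj₂ (k , refl) = >⇒∤ (s≤s (s≤s (s≤s z≤n))) (∣m+n∣m⇒∣n (subst (4 ∣_) (expand k) h) (m∣m*n (k * k + k)))
    where
    expand : ∀ k → suc (2 * k) * suc (2 * k) + 1 ≡ 4 * (k * k + k) + 2
    expand = solve-∀

  square+1-not-power-of-2 : ∀ x k → 2 ≤ x → ¬ x * x + 1 ≡ 2 ^ k
  square+1-not-power-of-2 x 0 2≤x e = <⇒≢ (≤-trans (s≤s (s≤s z≤n)) (+-monoˡ-≤ 1 (*-mono-≤ 2≤x 2≤x))) (sym e)
  square+1-not-power-of-2 x 1 2≤x e = <⇒≢ (≤-trans (s≤s (s≤s (s≤s z≤n))) (+-monoˡ-≤ 1 (*-mono-≤ 2≤x 2≤x))) (sym e)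
  square+1-not-power-of-2 x (suc (suc k)) 2≤x e = 4∤square+1 x
    (subst (4 ∣_) (sym e) (divides (2 ^ k) (shape (2 ^ k))))
    where
    shape : ∀ y → 2 * (2 * y) ≡ y * 4
    shape = solve-∀

  module OddPrimeDivisors (r : ℕ) (1≤r : 1 ≤ r) (¬mersenne : ∀ k → ¬ r + 1 ≡ 2 ^ k ∸ 1) where

    q : ℕ
    q = r + 1

    q≥2 : 2 ≤ q
    q≥2 = +-monoˡ-≤ 1 1≤r

    x : ℕ → ℕ
    x j = q ^ (2 ^ j)

    x≥1 : ∀ j → 1 ≤ x j
    x≥1 j = 1≤^ (2 ^ j) (≤-trans (s≤s z≤n) q≥2)

    x≥2 : ∀ j → 2 ≤ x j
    x≥2 j = ≤-trans q≥2 (subst (_≤ x j) (^-identityʳ q)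
      (^-monoʳ-≤ q {{>-nonZero (≤-trans (s≤s z≤n) q≥2)}} (1≤^ j (s≤s z≤n))))

    -- For j = 0 this is where the Mersenne hypothesis acts, since q + 1 = 2^k would make q = 2^k -
    -- 1. From j = 1 on, `x j` is a square, and a square plus 1 is never divisible by 4.
    odd-prime-divisor : ∀ j → Σ ℕ λ d → Prime d × d ≢ 2 × d ∣ x j + 1
    odd-prime-divisor j with power-of-2-or-odd-prime (x j + 1) (m≤n+m 1 (x j))
    ... | inj₂ d = d
    odd-prime-divisor zero | inj₁ (k , e) = ⊥-elim
      (¬mersenne k (trans (sym (m+n∸n≡m q 1)) (cong (_∸ 1) (trans (cong (_+ 1) (sym (^-identityʳ q))) e))))
    odd-prime-divisor (suc j) | inj₁ (k , e) = ⊥-elim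
      (square+1-not-power-of-2 (x j) k (x≥2 j) (trans (cong (_+ 1) (sym (double-exponent q j))) e))

    -- d ∣ r means q ≡ 1 mod d. An odd prime divisor of x j + 1 therefore does not divide r, so that
    -- r is a unit modulo it; this is why oddness was asked for.
    x+1≡2 : ∀ {d} j → d ∣ r → d ∣ x j + 1 → d ∣ 2
    x+1≡2 {d} j d∣r d∣x+1 with power-≡1 {r} {1} q (2 ^ j) (trans (+-comm r 1) (cong suc (sym (*-identityʳ r))))
    ... | c , e = ∣m+n∣m⇒∣n (subst (d ∣_) (trans (cong (_+ 1) e) (shape (r * c))) d∣x+1) (∣-trans d∣r (m∣m*n c))
      where
      shape : ∀ y → 1 + y + 1 ≡ y + 2
      shape = solve-∀

    Order : ℕ → ℕ → Set
    Order p k = p ∣ q ^ k ∸ 1 × (∀ j → 1 ≤ j → j < k → ¬ p ∣ q ^ j ∸ 1)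

    module Exponents (N' : ℕ) {p₁ p₂ : ℕ} (pp₁ : Prime p₁) (pp₂ : Prime p₂) (p₁≢p₂ : p₁ ≢ p₂)
      (ord₁ : Order p₁ (2 ^ suc N')) (ord₂ : Order p₂ (2 ^ suc N')) where

      N : ℕ
      N = suc N'

      2^-mono : ∀ {i j} → i < j → 2 ^ i < 2 ^ j
      2^-mono = ^-monoʳ-< 2 (s≤s (s≤s z≤n))

      order∤r : ∀ {p} → Order p (2 ^ N) → ¬ p ∣ r
      order∤r {p} (_ , minimal) p∣r = minimal 1 (s≤s z≤n) (2^-mono {0} {N} (s≤s z≤n))
        (subst (p ∣_) (sym (trans (cong (_∸ 1) (^-identityʳ q)) (m+n∸n≡m r 1))) p∣r)

      -- q^(2^N) - 1 factors as (x - 1)(x + 1) with x = q^(2^(N-1)), and minimality of the order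
      -- excludes the first factor.
      p₁∣ : p₁ ∣ x N' + 1
      p₁∣ with euclidsLemma (x N' ∸ 1) (x N' + 1) pp₁
        (subst (p₁ ∣_) (trans (cong (_∸ 1) (double-exponent q N')) (+1∣square∸1 (x N') (x≥1 N'))) (proj₁ ord₁))
      ... | inj₁ d = ⊥-elim (proj₂ ord₁ (2 ^ N') (1≤^ N' (s≤s z≤n)) (2^-mono {N'} {N} ≤-refl) d)
      ... | inj₂ d = d

      p₂∤ : ∀ j → suc j < N → ¬ p₂ ∣ x j + 1
      p₂∤ j h d = proj₂ ord₂ (2 ^ suc j) (1≤^ (suc j) (s≤s z≤n)) (2^-mono h)
        (subst (p₂ ∣_) (sym (trans (cong (_∸ 1) (double-exponent q j)) (+1∣square∸1 (x j) (x≥1 j))))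
          (∣-trans d (n∣m*n (x j ∸ 1))))

      -- p₂ is reserved for the residue -r, so the other primes must avoid it. For j < N - 1 its
      -- order does that; at j = N - 1 it divides x j + 1 as well, and the second prime p₁ of the
      -- same order steps in.
      cover-prime : ∀ j → j < N → Σ ℕ λ d → Prime d × d ∣ x j + 1 × ¬ d ∣ r × d ≢ p₂
      cover-prime j j<N with j ≟ N'
      ... | yes refl = p₁ , pp₁ , p₁∣ , order∤r ord₁ , p₁≢p₂
      ... | no j≢N' with odd-prime-divisor j
      ...   | d , pd , d≢2 , d∣ = d , pd , d∣ , (λ d∣r → d≢2 (prime∣prime pd prime[2] (x+1≡2 j d∣r d∣))) ,
                (λ { refl → p₂∤ j (≤∧≢⇒< j<N (λ { refl → j≢N' refl })) d∣ })

      -- All covering primes prescribe the same residue r, so it can be imposed modulo their product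
      -- L at once, and only L and p₂ have to be combined.
      CoverProduct : ℕ → Set
      CoverProduct n = Σ ℕ λ L → 1 ≤ L × Coprime r L × Coprime p₂ L ×
        (∀ j → j < n → Σ ℕ λ d → Prime d × d ∣ x j + 1 × d ∣ L)

      coprime-* : ∀ {a m n} → Coprime a m → Coprime a n → Coprime a (m * n)
      coprime-* cm cn (e∣a , e∣mn) = cn (e∣a , coprime-divisor (λ { (f∣e , f∣m) → cm (∣-trans f∣e e∣a , f∣m) }) e∣mn)

      cover-product : ∀ n → n ≤ N → CoverProduct n
      cover-product zero    _ = 1 , s≤s z≤n , (λ { (_ , e∣1) → ∣1⇒≡1 e∣1 }) , (λ { (_ , e∣1) → ∣1⇒≡1 e∣1 }) , λ _ ()
      cover-product (suc n) h with cover-product n (<⇒≤ h) | cover-prime n h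
      ... | L , 1≤L , rL , p₂L , cover | d , pd , d∣ , d∤r , d≢p₂ = d * L , *-mono-≤ (prime≥1 pd) 1≤L
          , coprime-* (coprime-sym (prime-∤⇒coprime pd d∤r)) rL
          , coprime-* (prime-∤⇒coprime pp₂ (λ e → d≢p₂ (sym (prime∣prime pp₂ pd e)))) p₂L
          , cover'
        where
        cover' : ∀ j → j < suc n → Σ ℕ λ e → Prime e × e ∣ x j + 1 × e ∣ d * L
        cover' j j<n with j ≟ n
        ... | yes refl = d , pd , d∣ , m∣m*n L
        ... | no j≢n with cover j (≤∧≢⇒< (≤-pred j<n) j≢n)
        ...   | e , pe , e∣ , e∣L = e , pe , e∣ , ∣-trans e∣L (n∣m*n d)

      -- The number a = r + L t is ≡ r mod L and ≡ -r mod p₂.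
      residue : ∀ L → Coprime L p₂ → Σ ℕ λ t → p₂ ∣ (r + L * t) + r
      residue L L⊥p₂ = t , m%n≡0⇒n∣m _ p₂
        (trans (cong (λ z → z % p₂) (shape r L t)) (trans (%-distribˡ-+ (t * L) (2 * r) p₂)
          (trans (cong (λ z → (z + (2 * r) % p₂) % p₂) tL) (trans (sym (%-distribˡ-+ (pred p₂ * (2 * r)) (2 * r) p₂))
            (trans (cong (_% p₂) (trans (+-comm (pred p₂ * (2 * r)) (2 * r))
              (trans (cong (_* (2 * r)) (suc-pred p₂)) (*-comm p₂ (2 * r))))) (m*n%n≡0 (2 * r) p₂))))))
        where
        instance
          nz : NonZero p₂
          nz = prime⇒nonZero pp₂
        t = proj₁ (Residues.quotient p₂ (pred p₂ * (2 * r)) L L⊥p₂)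
        tL = proj₂ (Residues.quotient p₂ (pred p₂ * (2 * r)) L L⊥p₂)
        shape : ∀ r L t → r + L * t + r ≡ t * L + 2 * r
        shape = solve-∀

      module Progression (L t : ℕ) (L≥1 : 1 ≤ L) (L-cover : ∀ j → j < N → Σ ℕ λ d → Prime d × d ∣ x j + 1 × d ∣ L) (p₂∣a+r : p₂ ∣ (r + L * t) + r) where

        residue-coprime : Coprime r L → Coprime (r + L * t) (L * p₂)
        residue-coprime r⊥L = coprime-*
          (λ { {e} (e∣a , e∣L) → r⊥L (∣m+n∣m⇒∣n (subst (e ∣_) (+-comm r (L * t)) e∣a) (∣-trans e∣L (m∣m*n t)) , e∣L)
          })
          (coprime-sym (prime-∤⇒coprime pp₂ (λ p₂∣a → order∤r ord₂ (∣m+n∣m⇒∣n p₂∣a+r p₂∣a))))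

        -- X and Y express p ≡ r + L t modulo L p₂ without subtraction.
        module _ {p : ℕ} (M<p : L * p₂ < p) (r<p : r < p) (X Y : ℕ) (p≡a : p + X * (L * p₂) ≡ (r + L * t) + Y * (L * p₂)) where

          p≡r-mod : ∀ {d} → d ∣ L → Σ ℕ λ U → Σ ℕ λ V → p + d * U ≡ r + d * V
          p≡r-mod {d} (divides c e) = X * (c * p₂) , c * t + Y * (c * p₂) ,
              trans (cong (p +_) (shape₁ d X c p₂))
                (trans (subst (λ z → p + X * (z * p₂) ≡ (r + z * t) + Y * (z * p₂)) e p≡a) (shape₂ r c d (t) Y p₂))
            where
            shape₁ : ∀ d X c p₂ → d * (X * (c * p₂)) ≡ X * (c * d * p₂)
            shape₁ = solve-∀
            shape₂ : ∀ r c d t Y p₂ → (r + c * d * t) + Y * (c * d * p₂) ≡ r + d * (c * t + Y * (c * p₂))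
            shape₂ = solve-∀

          ∣-odd : ∀ {d} u → d ∣ L → d ∣ u + 1 → d ∣ u * p + r
          ∣-odd {d} u d∣L d∣u+1 with p≡r-mod d∣L
          ... | U , V , e = ∣m+n∣m⇒∣n (subst (d ∣_)
            (sym (trans (shape₁ u p r d U) (trans (cong (λ z → u * z + r) e) (shape₂ u r d V))))
                (∣m∣n⇒∣m+n (∣-trans d∣u+1 (m∣m*n r)) (m∣m*n (u * V)))) (m∣m*n (u * U))
            where
            shape₁ : ∀ u p r d U → d * (u * U) + (u * p + r) ≡ u * (p + d * U) + r
            shape₁ = solve-∀
            shape₂ : ∀ u r d V → u * (r + d * V) + r ≡ (u + 1) * r + d * (u * V)
            shape₂ = solve-∀

          p₂∣p+r : p₂ ∣ p + r
          p₂∣p+r = ∣m+n∣m⇒∣n (subst (p₂ ∣_)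
            (sym (trans (shape₁ p r X L p₂) (trans (cong (_+ r) p≡a) (shape₂ (r + L * t) r Y L p₂))))
              (∣m∣n⇒∣m+n p₂∣a+r (m∣m*n (Y * L)))) (m∣m*n (X * L))
            where
            shape₁ : ∀ p r X L p₂ → p₂ * (X * L) + (p + r) ≡ p + X * (L * p₂) + r
            shape₁ = solve-∀
            shape₂ : ∀ a r Y L p₂ → a + Y * (L * p₂) + r ≡ a + r + p₂ * (Y * L)
            shape₂ = solve-∀

          ∣-even : ∀ u c → u ≡ 1 + p₂ * c → p₂ ∣ u * p + r
          ∣-even u c refl = subst (p₂ ∣_) (sym (shape p₂ c p r)) (∣m∣n⇒∣m+n p₂∣p+r (m∣m*n (c * p)))
            where
            shape : ∀ p₂ c p r → (1 + p₂ * c) * p + r ≡ p + r + p₂ * (c * p)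
            shape = solve-∀

          p≤ : ∀ β → p ≤ q ^ β * p + r
          p≤ β = ≤-trans (≤-trans (≤-reflexive (sym (+-identityʳ p))) (*-monoˡ-≤ p (1≤^ β (≤-trans (s≤s z≤n) q≥2))))
            (m≤m+n (q ^ β * p) r)

          too-small : ∀ {d} β → Prime d → d ≤ L * p₂ → d ∣ q ^ β * p + r → ¬ Prime (q ^ β * p + r)
          too-small β pd d≤M d∣ pn = <⇒≢ (≤-trans (s≤s d≤M) (≤-trans M<p (p≤ β))) (prime∣prime pd pn d∣)

          L≤M : ∀ {d} → d ∣ L → d ≤ L * p₂
          L≤M d∣L = ≤-trans (∣⇒≤ {{>-nonZero L≥1}} d∣L) (m≤m*n L p₂ {{prime⇒nonZero pp₂}})

          composite : ∀ β → ¬ Prime (q ^ β * p + r)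
          composite β with exponent-cover N β
          ... | inj₁ (k , refl) with ∣∸1⇒≡1+ (q ^ (2 ^ N)) (x≥1 N) (proj₁ ord₂)
          ...   | c , e with power-≡1 {p₂} {c} (q ^ (2 ^ N)) k e
          ...     | c' , e' = too-small β pp₂ (m≤n*m p₂ L {{>-nonZero L≥1}})
            (∣-even (q ^ (2 ^ N * k)) c' (trans (sym (^-*-assoc q (2 ^ N) k)) e'))
          composite β | inj₂ (j , k , j<N , refl) with L-cover j j<N
          ... | d , pd , d∣ , d∣L = too-small β pd (L≤M d∣L)
            (∣-odd (q ^ β) d∣L (subst (λ z → d ∣ z + 1) (^-*-assoc q (2 ^ j) (suc (2 * k)))
            (odd-power-≡-1 (x j) k (x≥1 j) d∣)))

          -- Serves the case s = p of `nontotient`. The covering prime for j = 0 divides q + 1,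
          -- hence not q, and p ≡ r modulo it.
          witness : Σ ℕ λ d → Prime d × d ∣ p ∸ r × ¬ d ∣ r + 1
          witness with L-cover 0 (s≤s z≤n)
          ... | d , pd , d∣ , d∣L with p≡r-mod d∣L
          ...   | U , V , e = d , pd , ∣m+n∣m⇒∣n (subst (d ∣_) (sym shape) (m∣m*n V)) (m∣m*n U)
                , λ d∣q → ¬prime[1] (subst Prime (∣1⇒≡1 (∣m+n∣m⇒∣n (subst (λ z → d ∣ z + 1) (^-identityʳ q) d∣) d∣q))
                  pd)
            where
            shape : d * U + (p ∸ r) ≡ d * V
            shape = +-cancelˡ-≡ r (d * U + (p ∸ r)) (d * V)
              (trans (trans (sym (+-assoc r (d * U) (p ∸ r))) (trans (cong (_+ (p ∸ r)) (+-comm r (d * U)))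
              (trans (+-assoc (d * U) r (p ∸ r))
                (trans (cong (d * U +_) (m+[n∸m]≡n (<⇒≤ r<p))) (+-comm (d * U) p))))) e)

-- From primes in the progression r + L t modulo L p₂ to nontotients.

open import Defs
open import Data.Nat using (ℕ; _+_; _*_; _^_; _≤_; _<_)
open import Data.Nat.Primality using (Prime)
open import Data.Product using (Σ; _×_)
open import Relation.Nullary using (¬_)
open import Relation.Binary.PropositionalEquality using (_≢_)

open import Data.Nat using (_/_; _%_; NonZero; >-nonZero)
open import Data.Nat.Properties using (≤-refl; ≤-trans; ≤-<-trans; *-mono-≤; m≤m+n; m≤n+m; +-assoc; +-comm)
open import Data.Nat.DivMod using (m≡m%n+[m/n]*n)
open import Data.Nat.Coprimality using () renaming (sym to coprime-sym)
open Primes using (prime≥1)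

≈⇒+-multiples : ∀ M {{_ : NonZero M}} p a → p % M ≡ a % M → p + a / M * M ≡ a + p / M * M
≈⇒+-multiples M p a e = trans (cong (_+ a / M * M) (trans (m≡m%n+[m/n]*n p M) (cong (_+ p / M * M) e)))
  (trans (+-assoc (a % M) (p / M * M) (a / M * M)) (trans (cong (a % M +_) (+-comm (p / M * M) (a / M * M)))
  (trans (sym (+-assoc (a % M) (a / M * M) (p / M * M))) (cong (_+ p / M * M) (sym (m≡m%n+[m/n]*n a M))))))

theorem2p1 : (r : ℕ) → 1 ≤ r → Prime (r + 1) → ¬ MersennePrime (r + 1)
    → (Σ ℕ λ N → 1 ≤ N × Σ ℕ λ p₁ → Σ ℕ λ p₂ → Prime p₁ × Prime p₂ × p₁ ≢ p₂
    × IsOrd p₁ (r + 1) (2 ^ N) × IsOrd p₂ (r + 1) (2 ^ N))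
    → (B : ℕ) → Σ ℕ λ p → B < p × Prime p
    × ((α : ℕ) → SchemmelNontotient r ((r + 1) ^ α * p))
theorem2p1 r 1≤r pq ¬mersenne (suc N' , _ , p₁ , p₂ , pp₁ , pp₂ , p₁≢p₂ , (_ , ord₁) , (_ , ord₂)) B =
  conclude (Cover.cover-product (suc N') ≤-refl)
  where
  module Cover = Covering.OddPrimeDivisors.Exponents r 1≤r (λ k e → ¬mersenne (pq , k , e)) N' pp₁ pp₂ p₁≢p₂ ord₁ ord₂
  Conclusion = Σ ℕ λ p → B < p × Prime p × ((α : ℕ) → SchemmelNontotient r ((r + 1) ^ α * p))
  conclude : Cover.CoverProduct (suc N') → Conclusion
  conclude (L , L≥1 , r⊥L , p₂⊥L , cover) with Cover.residue L (coprime-sym p₂⊥L)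
  -- One lower bound for p serves three ends: p > B, p larger than every covering prime, and p > r.
  ... | t , p₂∣a+r = from-prime (Dirichlet.dirichlet (L * p₂) (r + L * t) (B + (L * p₂ + r))
    (Cover.Progression.residue-coprime L t L≥1 cover p₂∣a+r r⊥L))
    where
    instance
      M≢0 : NonZero (L * p₂)
      M≢0 = >-nonZero (*-mono-≤ L≥1 (prime≥1 pp₂))
    from-prime : (Σ ℕ λ p → B + (L * p₂ + r) < p × Prime p × p % (L * p₂) ≡ (r + L * t) % (L * p₂)) → Conclusion
    from-prime (p , large , pp , p≡a) = p , ≤-<-trans (m≤m+n B (L * p₂ + r)) large , pp , nontotients
      (witness M<p r<p ((r + L * t) / (L * p₂)) (p / (L * p₂)) p≈a)
      where
      open Cover.Progression L t L≥1 cover p₂∣a+r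
      M<p : L * p₂ < p
      M<p = ≤-<-trans (≤-trans (m≤m+n (L * p₂) r) (m≤n+m (L * p₂ + r) B)) large
      r<p : r < p
      r<p = ≤-<-trans (≤-trans (m≤n+m r (L * p₂)) (m≤n+m (L * p₂ + r) B)) large
      p≈a : p + (r + L * t) / (L * p₂) * (L * p₂) ≡ (r + L * t) + p / (L * p₂) * (L * p₂)
      p≈a = ≈⇒+-multiples (L * p₂) p (r + L * t) p≡a
      nontotients : _ → (α : ℕ) → SchemmelNontotient r ((r + 1) ^ α * p)
      nontotients (d , pd , d∣p∸r , d∤q) = Schemmel.nontotient r p 1≤r pq pp r<p
        (composite M<p r<p ((r + L * t) / (L * p₂)) (p / (L * p₂)) p≈a) pd d∣p∸r d∤q
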